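{- Let $a,b$ be integers with $1<a\le b$ and $c=\mathrm{lcm}(a,b)\le6$, and let $q$ be a prime power with $q\equiv1\pmod c$. Then there exist orthogonal orthomorphisms $\theta\in\mathscr{D}_a(q)$ and $\theta'\in\mathscr{D}_b(q)$ if and only if $q>7$ and $(q,a,b)\notin\{(9,2,4),\,(13,2,3),\,(13,2,6)\}$.
   Context: Let $\mathbb{F}_q$ be the finite field of order $q$. An orthomorphism is a permutation $\theta$ of $\mathbb{F}_q$ such that $x\mapsto\theta(x)-x$ is also a permutation. Two orthomorphisms $\theta,\theta'$ are orthogonal if $x\mapsto\theta(x)-\theta'(x)$ is a permutation. For $k\mid(q-1)$, fix a generator $g$ of $\mathbb{F}_q^*$ and let $C_{k,i}=\{g^j: j\equiv i\pmod k\}$, $0\le i<k$. A cyclotomic map of index $k$ with multipliers $[a_0,\dots,a_{k-1}]$ is $\theta(0)=0$, $\theta(x)=a_ix$ for $x\in C_{k,i}$. $\mathscr{C}_k(q)$ is the set of orthomorphisms that are cyclotomic maps of index $k$, and $\mathscr{D}_k(q)=\mathscr{C}_k(q)\setminus\bigcup_{\ell<k,\ \ell\mid(q-1)}\mathscr{C}_\ell(q)$. -}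

module Defs where

open import Level using (0ℓ)
open import Data.Nat using (ℕ; zero; suc; _<_; _∸_) renaming (_+_ to _+ℕ_; _*_ to _*ℕ_)
open import Data.Nat.Divisibility using (_∣_)
open import Data.Fin using (Fin; toℕ)
open import Data.Product using (Σ; _×_; ∃)
open import Relation.Nullary using (¬_)
open import Relation.Binary.PropositionalEquality using (_≡_)
open import Function.Bundles using (_↔_)
open import Function.Definitions using (Bijective)
open import Algebra.Structures using (IsCommutativeRing)

record FiniteField (q : ℕ) : Set₁ where
  infixl 6 _+_ _-_
  infixl 7 _*_
  field
    F     : Set
    0F 1F : F
    _+_ _*_ : F → F → F
    -_    : F → F
    isCommutativeRing : IsCommutativeRing _≡_ _+_ _*_ -_ 0F 1F
    0≢1   : ¬ (0F ≡ 1F)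
    inverse : (x : F) → ¬ (x ≡ 0F) → Σ F (λ y → x * y ≡ 1F)
    enumeration : F ↔ Fin q

  _-_ : F → F → F
  x - y = x + (- y)

  _^_ : F → ℕ → F
  x ^ zero  = 1F
  x ^ suc n = x * (x ^ n)

  IsGenerator : F → Set
  IsGenerator g = ¬ (g ≡ 0F) × ((x : F) → ¬ (x ≡ 0F) → ∃ λ j → g ^ j ≡ x)

  IsPermutation : (F → F) → Set
  IsPermutation f = Bijective _≡_ _≡_ f

  IsOrthomorphism : (F → F) → Set
  IsOrthomorphism θ = IsPermutation θ × IsPermutation (λ x → θ x - x)

  Orthogonal : (F → F) → (F → F) → Set
  Orthogonal θ θ' = IsPermutation (λ x → θ x - θ' x)

  module _ (g : F) where
    -- θ is a cyclotomic map of index k (w.r.t. generator g) with multipliers a: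
    -- θ 0 = 0 and θ x = a i * x for x ∈ C_{k,i} = { g^j : j ≡ i (mod k) }.
    -- Every j ≡ i (mod k) with 0 ≤ i < k is written as j = i + m*k.
    IsCyclotomicWith : (k : ℕ) → (Fin k → F) → (F → F) → Set
    IsCyclotomicWith k a θ =
      θ 0F ≡ 0F ×
      ((i : Fin k) (m : ℕ) →
        θ (g ^ (toℕ i +ℕ m *ℕ k)) ≡ a i * g ^ (toℕ i +ℕ m *ℕ k))

    IsCyclotomic : ℕ → (F → F) → Set
    IsCyclotomic k θ = Σ (Fin k → F) (λ a → IsCyclotomicWith k a θ)

    InC : ℕ → (F → F) → Set
    InC k θ = (k ∣ (q ∸ 1)) × IsOrthomorphism θ × IsCyclotomic k θ

    InD : ℕ → (F → F) → Set
    InD k θ = InC k θ × ((ℓ : ℕ) → ℓ < k → ℓ ∣ (q ∸ 1) → ¬ InC ℓ θ)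

-- Put m = (q - 1) / k. Nonzero elements lie in the same coset of the k-th powers exactly when their
-- m-th powers agree, and θ is cyclotomic of index k exactly when θ (h^k x) = h^k θ x for all h ≢ 0.
-- A map with multiplier x on the k-th powers and y ≢ x on their other cosets is an orthomorphism of
-- index k and of no smaller one as soon as x, y lie in one coset and x - 1, y - 1 in another;
-- orthogonality of two such maps is a condition on the cosets of the differences of multipliers.
-- For large q the pigeonhole principle provides such multipliers, with bounds on q small enough to
-- make the use of character sums unnecessary. A field of order q has prime power order, and for the
-- remaining prime powers explicit multipliers, taken in ℤ/p or in a quadratic extension of it, are
-- verified by computation (for q = 16 two cube roots of unity serve). The nonexistence claims are
-- finite searches over the possible multipliers, all in fields with at most 13 elements.
module Submission where

open import Defs
open import Data.Nat using (ℕ; _<_; _≤_; _∸_)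
open import Data.Nat.Divisibility using (_∣_)
open import Data.Nat.LCM using (lcm)
open import Data.Product using (Σ; _×_; _,_; ∃)
open import Relation.Nullary using (¬_)
open import Relation.Binary.PropositionalEquality using (_≡_)
open import Function.Bundles using (_⇔_)

open import Level using (0ℓ)
open import Algebra.Bundles using (CommutativeRing; RawRing)
open import Algebra.Structures using (IsCommutativeRing)
import Algebra.Properties.Ring as RingProperties
import Algebra.Properties.AbelianGroup as AbelianGroupProperties
import Algebra.Properties.CommutativeSemigroup as CommutativeSemigroupProperties
import Algebra.Properties.Semiring.Mult.TCOptimised as Multiples
import Algebra.Solver.Ring as Solver
open import Algebra.Solver.Ring.AlmostCommutativeRing
  using (fromCommutativeRing; _-Raw-AlmostCommutative⟶_)
open import Data.Bool using (Bool; true; false; not; _∧_; _∨_)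
open import Data.Bool.Properties using (T-≡)
open import Data.Empty using (⊥; ⊥-elim)
open import Data.Fin as Fin using (Fin; toℕ)
import Data.Fin.Properties as FinP
open import Data.List as List using (List; []; _∷_; length)
open import Data.List.Membership.Propositional using (_∈_; _∉_)
import Data.List.Membership.DecPropositional as DecMembership
open import Data.List.Relation.Binary.Pointwise using (Pointwise; []; _∷_)
open import Data.List.Relation.Unary.All as All using (All; []; _∷_)
open import Data.List.Relation.Unary.Any as Any using (Any; here; there)
open import Data.List.Relation.Unary.Any.Properties using (lookup-index)
open import Data.Maybe using (Maybe; just; nothing)
open import Data.Nat as ℕ using (zero; suc; z≤n; s≤s; NonZero)
open import Data.Nat.Coprimality using (coprime-Bézout; prime⇒coprime)
open import Data.Nat.Divisibility as Div using (divides; _∣?_)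
open import Data.Nat.DivMod
  using (_/_; _%_; m≡m%n+[m/n]*n; m%n<n; m%n≤m; m%n%n≡m%n; [m+kn]%n≡m%n; m∣n⇒o%n%m≡o%m; m/n*n≡m)
open import Data.Nat.GCD using (module Bézout)
open import Data.Nat.LCM using (m∣lcm[m,n]; n∣lcm[m,n]; lcm-least)
open import Data.Nat.ListAction using (product)
open import Data.Nat.Primality
  using (Prime; prime?; euclidsLemma; prime⇒irreducible; prime⇒nonZero; prime⇒nonTrivial)
open import Data.Nat.Primality.Factorisation using (PrimeFactorisation; factorise)
import Data.Nat.Properties as ℕP
open import Data.Product using (∃₂; proj₁; proj₂)
open import Data.Product.Properties using (≡-dec)
open import Data.Sum using (_⊎_; inj₁; inj₂)
open import Function.Bundles using (Equivalence; Inverse; mk⇔)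
open import Relation.Binary.Definitions using (tri<; tri≈; tri>)
open import Relation.Binary.PropositionalEquality
  using (_≢_; refl; sym; trans; cong; cong₂; subst; subst₂; ≢-sym; module ≡-Reasoning)
open import Relation.Nullary using (Dec; yes; no; contradiction; _×-dec_; _⊎-dec_; _→-dec_; ¬?)
open import Relation.Nullary.Decidable as Decidable using (from-yes)

-- Arithmetic in a finite field

-- The field is known only through its axioms and an enumeration, and g is arbitrary, so nothing can
-- be computed in it directly. Explicit work is therefore done on pairs of natural numbers modulo p
-- and carried over by a ring homomorphism. Inequalities do not survive such a map, so each one is
-- certified by an equation: x^(q-1) = 1 forces the image of x to be nonzero. Cosets may be numbered
-- by powers of whatever element suits the computation, because homogeneity does not refer to g. The
-- bounds come from counting boxes. Exchanging x and y gives the cheapest orthogonal pair, with k²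
-- boxes, but it requires -1 to be a k-th power; otherwise reciprocals are used, at the price of a
-- third coset condition and k³ boxes. For two different indices, a³ boxes have to be overfilled by
-- about q/c candidates, whence a bound near a³c. Below the bounds every natural number q in the
-- right residue class has to be dealt with, including 10, 21 or 175, which are orders of no field.
-- This is where prime power order enters.

fin-injective⇒surjective : ∀ {n} (f : Fin n → Fin n) → (∀ {i j} → f i ≡ f j → i ≡ j) →
                           ∀ y → ∃ λ x → f x ≡ y
fin-injective⇒surjective {suc n} f inj y with FinP.any? (λ x → f x FinP.≟ y)
... | yes found = found
... | no none = contradiction
        (FinP.injective⇒≤ (λ {i} {j} e → inj (FinP.punchOut-injective (avoid i) (avoid j) e)))
        (ℕP.<⇒≱ (ℕP.n<1+n n))
  where
  avoid : ∀ x → y ≢ f x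
  avoid x e = none (x , sym e)

module Field {q : ℕ} (K : FiniteField q) where
  open FiniteField K public
  open IsCommutativeRing isCommutativeRing public
    using (+-assoc; +-comm; +-identityˡ; +-identityʳ; -‿inverseʳ;
           *-assoc; *-comm; *-identityˡ; *-identityʳ; distribˡ; distribʳ; zeroˡ; zeroʳ)

  ring : CommutativeRing 0ℓ 0ℓ
  ring = record { isCommutativeRing = isCommutativeRing }

  open RingProperties (CommutativeRing.ring ring) public
    using (-‿distribˡ-*; -‿distribʳ-*; -‿involutive; -0#≈0#)
  open AbelianGroupProperties (CommutativeRing.+-abelianGroup ring) public
    using (⁻¹-∙-comm)
  open CommutativeSemigroupProperties (CommutativeRing.+-commutativeSemigroup ring) public
    using (interchange)
  open Multiples (CommutativeRing.semiring ring) public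
    using (×-homo-+; ×1-homo-*) renaming (_×_ to _·_)

  open ≡-Reasoning

  ι : ℕ → F
  ι n = n · 1F

  ι-+ : ∀ m n → ι (m ℕ.+ n) ≡ ι m + ι n
  ι-+ m n = ×-homo-+ 1F m n

  ι-* : ∀ m n → ι (m ℕ.* n) ≡ ι m * ι n
  ι-* = ×1-homo-*

  -- The pair (a , b) stands for the integer a - b; the clause for b = 0 makes
  -- the constants 0 and 1 of the solver definitionally those of the field.
  ⟦_⟧ : ℕ × ℕ → F
  ⟦ a , zero ⟧  = ι a
  ⟦ a , suc b ⟧ = ι a - ι (suc b)

  ⟦⟧-difference : ∀ a b → ⟦ a , b ⟧ ≡ ι a - ι b
  ⟦⟧-difference a zero    = sym (trans (cong (ι a +_) -0#≈0#) (+-identityʳ (ι a)))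
  ⟦⟧-difference a (suc b) = refl

  -- Cancelling leaves one component 0, so a nonnegative integer has second component 0 and
  -- evaluates to `ι a` by definition.
  reduce : ℕ × ℕ → ℕ × ℕ
  reduce (a , b) = a ∸ b , b ∸ a

  private
    differences : RawRing 0ℓ 0ℓ
    differences = record
      { Carrier = ℕ × ℕ
      ; _≈_ = λ { (a , b) (c , d) → a ℕ.+ d ≡ c ℕ.+ b }
      ; _+_ = λ { (a , b) (c , d) → reduce (a ℕ.+ c , b ℕ.+ d) }
      ; _*_ = λ { (a , b) (c , d) → reduce (a ℕ.* c ℕ.+ b ℕ.* d , a ℕ.* d ℕ.+ b ℕ.* c) }
      ; -_ = λ { (a , b) → b , a }
      ; 0# = 0 , 0
      ; 1# = 1 , 0
      }

    difference-sum : ∀ a b c d → (a + c) - (b + d) ≡ (a - b) + (c - d)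
    difference-sum a b c d =
      trans (cong ((a + c) +_) (sym (⁻¹-∙-comm b d))) (interchange a c (- b) (- d))

    difference-product : ∀ a b c d → (a * c + b * d) - (a * d + b * c) ≡ (a - b) * (c - d)
    difference-product a b c d = sym (begin
      (a - b) * (c - d)                                ≡⟨ distribʳ (c - d) a (- b) ⟩
      a * (c - d) + (- b) * (c - d)                    ≡⟨ cong₂ _+_ (distribˡ a c (- d)) (distribˡ (- b) c (- d)) ⟩
      (a * c + a * - d) + ((- b) * c + (- b) * - d)
        ≡⟨ cong₂ (λ s t → (a * c + s) + t) (sym (-‿distribʳ-* a d))
             (cong₂ _+_ (sym (-‿distribˡ-* b c))
               (trans (sym (-‿distribˡ-* b (- d))) (trans (cong -_ (sym (-‿distribʳ-* b d))) (-‿involutive (b * d))))) ⟩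
      (a * c - a * d) + (- (b * c) + b * d)            ≡⟨ cong ((a * c - a * d) +_) (+-comm (- (b * c)) (b * d)) ⟩
      (a * c - a * d) + (b * d - b * c)                ≡⟨ sym (difference-sum (a * c) (a * d) (b * d) (b * c)) ⟩
      (a * c + b * d) - (a * d + b * c)                ∎)

    difference-cong : ∀ a b c d → a + d ≡ c + b → a - b ≡ c - d
    difference-cong a b c d e = begin
      a - b                  ≡⟨ cong (_- b) (sym (+-identityʳ a)) ⟩
      (a + 0F) - b           ≡⟨ cong (λ z → (a + z) - b) (sym (-‿inverseʳ d)) ⟩
      (a + (d - d)) - b      ≡⟨ cong (_- b) (sym (+-assoc a d (- d))) ⟩
      ((a + d) - d) - b      ≡⟨ cong (λ z → (z - d) - b) e ⟩
      ((c + b) - d) - b      ≡⟨ +-assoc (c + b) (- d) (- b) ⟩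
      (c + b) + (- d + - b)  ≡⟨ interchange c b (- d) (- b) ⟩
      (c - d) + (b - b)      ≡⟨ cong ((c - d) +_) (-‿inverseʳ b) ⟩
      (c - d) + 0F           ≡⟨ +-identityʳ (c - d) ⟩
      c - d                  ∎

    ∸-swap : ∀ a b → (a ∸ b) ℕ.+ b ≡ a ℕ.+ (b ∸ a)
    ∸-swap zero    b       = trans (cong (ℕ._+ b) (ℕP.0∸n≡0 b)) refl
    ∸-swap (suc a) zero    = refl
    ∸-swap (suc a) (suc b) = trans (ℕP.+-suc (a ∸ b) b) (cong suc (∸-swap a b))

    ⟦reduce⟧ : ∀ a b → ⟦ reduce (a , b) ⟧ ≡ ι a - ι b
    ⟦reduce⟧ a b = trans (⟦⟧-difference (a ∸ b) (b ∸ a))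
      (difference-cong (ι (a ∸ b)) (ι (b ∸ a)) (ι a) (ι b)
        (trans (sym (ι-+ (a ∸ b) b)) (trans (cong ι (∸-swap a b)) (ι-+ a (b ∸ a)))))

    equal? : ∀ x y → Maybe (⟦ x ⟧ ≡ ⟦ y ⟧)
    equal? (a , b) (c , d) with a ℕ.+ d ℕ.≟ c ℕ.+ b
    ... | yes e = just (trans (⟦⟧-difference a b) (trans
                    (difference-cong (ι a) (ι b) (ι c) (ι d)
                      (trans (sym (ι-+ a d)) (trans (cong ι e) (ι-+ c b))))
                    (sym (⟦⟧-difference c d))))
    ... | no _  = nothing

    differences⟶field : differences -Raw-AlmostCommutative⟶ fromCommutativeRing ring
    differences⟶field = record
      { ⟦_⟧ = ⟦_⟧
      ; +-homo = λ { (a , b) (c , d) → trans (⟦reduce⟧ (a ℕ.+ c) (b ℕ.+ d)) (trans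
          (trans (cong₂ _-_ (ι-+ a c) (ι-+ b d)) (difference-sum (ι a) (ι b) (ι c) (ι d)))
          (sym (cong₂ _+_ (⟦⟧-difference a b) (⟦⟧-difference c d)))) }
      ; *-homo = λ { (a , b) (c , d) → trans (⟦reduce⟧ (a ℕ.* c ℕ.+ b ℕ.* d) (a ℕ.* d ℕ.+ b ℕ.* c)) (trans
          (trans (cong₂ _-_ (trans (ι-+ (a ℕ.* c) (b ℕ.* d)) (cong₂ _+_ (ι-* a c) (ι-* b d)))
                            (trans (ι-+ (a ℕ.* d) (b ℕ.* c)) (cong₂ _+_ (ι-* a d) (ι-* b c))))
                 (difference-product (ι a) (ι b) (ι c) (ι d)))
          (sym (cong₂ _*_ (⟦⟧-difference a b) (⟦⟧-difference c d)))) }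
      ; -‿homo = λ { (a , b) → trans (⟦⟧-difference b a) (sym (trans (cong -_ (⟦⟧-difference a b))
          (trans (sym (⁻¹-∙-comm (ι a) (- ι b)))
          (trans (cong (- ι a +_) (-‿involutive (ι b))) (+-comm (- ι a) (ι b)))))) }
      ; 0-homo = refl
      ; 1-homo = refl
      }

  open Solver differences (fromCommutativeRing ring) differences⟶field equal?
    public using (solve; _:=_; _:+_; _:*_; _:-_; :-_; con)


  encode : F → Fin q
  encode = Inverse.to enumeration

  decode : Fin q → F
  decode = Inverse.from enumeration

  encode-injective : ∀ {x y} → encode x ≡ encode y → x ≡ y
  encode-injective {x} {y} e = trans (sym (Inverse.strictlyInverseʳ enumeration x))
    (trans (cong decode e) (Inverse.strictlyInverseʳ enumeration y))

  decode-injective : ∀ {i j} → decode i ≡ decode j → i ≡ j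
  decode-injective {i} {j} e = trans (sym (Inverse.strictlyInverseˡ enumeration i))
    (trans (cong encode e) (Inverse.strictlyInverseˡ enumeration j))

  decode-encode : ∀ x → decode (encode x) ≡ x
  decode-encode = Inverse.strictlyInverseʳ enumeration

  infix 4 _≟_
  _≟_ : (x y : F) → Dec (x ≡ y)
  x ≟ y = Decidable.map′ encode-injective (cong encode) (encode x FinP.≟ encode y)

  1≢0 : 1F ≢ 0F
  1≢0 e = 0≢1 (sym e)

  inv : F → F
  inv x with x ≟ 0F
  ... | yes _ = 0F
  ... | no nz = proj₁ (inverse x nz)

  *-inv : ∀ {x} → x ≢ 0F → x * inv x ≡ 1F
  *-inv {x} nz with x ≟ 0F
  ... | yes e = contradiction e nz
  ... | no nz′ = proj₂ (inverse x nz′)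

  inv-0 : inv 0F ≡ 0F
  inv-0 with 0F ≟ 0F
  ... | yes _ = refl
  ... | no nz = contradiction refl nz

  *-cancelˡ : ∀ {x y z} → x ≢ 0F → x * y ≡ x * z → y ≡ z
  *-cancelˡ {x} {y} {z} nz e = trans (sym (undo y)) (trans (cong (inv x *_) e) (undo z))
    where
    undo : ∀ w → inv x * (x * w) ≡ w
    undo w = trans (solve 3 (λ i x w → i :* (x :* w) := (x :* i) :* w) refl (inv x) x w)
                   (trans (cong (_* w) (*-inv nz)) (*-identityˡ w))

  *-cancelʳ : ∀ {x y z} → x ≢ 0F → y * x ≡ z * x → y ≡ z
  *-cancelʳ {x} {y} {z} nz e = *-cancelˡ nz (trans (*-comm x y) (trans e (*-comm z x)))

  *-≢0 : ∀ {x y} → x ≢ 0F → y ≢ 0F → x * y ≢ 0F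
  *-≢0 {x} nx ny e = ny (*-cancelˡ nx (trans e (sym (zeroʳ x))))

  inv-≢0 : ∀ {x} → x ≢ 0F → inv x ≢ 0F
  inv-≢0 {x} nz e = 1≢0 (trans (sym (*-inv nz)) (trans (cong (x *_) e) (zeroʳ x)))

  -- The convention `inv 0F ≡ 0F` makes inversion injective on the whole field. Hence the points of
  -- `Candidates` are distinct even where the denominator 1 - r vanishes.
  inv-injective : ∀ {x y} → inv x ≡ inv y → x ≡ y
  inv-injective {x} {y} e = go (x ≟ 0F) (y ≟ 0F)
    where
    inv≡0 : ∀ {z} → z ≡ 0F → inv z ≡ 0F
    inv≡0 z≡0 = trans (cong inv z≡0) inv-0
    go : Dec (x ≡ 0F) → Dec (y ≡ 0F) → x ≡ y
    go (yes x≡0) (yes y≡0) = trans x≡0 (sym y≡0)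
    go (yes x≡0) (no y≢0)  = contradiction (trans (sym e) (inv≡0 x≡0)) (inv-≢0 y≢0)
    go (no x≢0)  (yes y≡0) = contradiction (trans e (inv≡0 y≡0)) (inv-≢0 x≢0)
    go (no x≢0)  (no y≢0)  = *-cancelʳ (inv-≢0 x≢0)
      (trans (*-inv x≢0) (sym (trans (cong (y *_) e) (*-inv y≢0))))

  -‿≡0 : ∀ {x y} → x - y ≡ 0F → x ≡ y
  -‿≡0 {x} {y} e = trans (solve 2 (λ x y → x := (x :- y) :+ y) refl x y)
                         (trans (cong (_+ y) e) (+-identityˡ y))

  -‿≢0 : ∀ {x y} → x ≢ y → x - y ≢ 0F
  -‿≢0 x≢y e = x≢y (-‿≡0 e)

  +-cancelʳ : ∀ {x y} z → x + z ≡ y + z → x ≡ y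
  +-cancelʳ {x} {y} z e = begin
    x            ≡⟨ solve 2 (λ x z → x := (x :+ z) :- z) refl x z ⟩
    (x + z) - z  ≡⟨ cong (_- z) e ⟩
    (y + z) - z  ≡⟨ solve 2 (λ x z → (x :+ z) :- z := x) refl y z ⟩
    y            ∎

  ^-+ : ∀ x m n → x ^ (m ℕ.+ n) ≡ x ^ m * x ^ n
  ^-+ x zero    n = sym (*-identityˡ _)
  ^-+ x (suc m) n = trans (cong (x *_) (^-+ x m n)) (sym (*-assoc x _ _))

  1^ : ∀ n → 1F ^ n ≡ 1F
  1^ zero    = refl
  1^ (suc n) = trans (*-identityˡ _) (1^ n)

  *-^ : ∀ x y n → (x * y) ^ n ≡ x ^ n * y ^ n
  *-^ x y zero    = sym (*-identityˡ _)
  *-^ x y (suc n) = trans (cong ((x * y) *_) (*-^ x y n))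
    (solve 4 (λ x y s t → (x :* y) :* (s :* t) := (x :* s) :* (y :* t)) refl x y (x ^ n) (y ^ n))

  ^-* : ∀ x m n → x ^ (m ℕ.* n) ≡ (x ^ m) ^ n
  ^-* x zero    n = sym (1^ n)
  ^-* x (suc m) n = trans (^-+ x n (m ℕ.* n))
    (trans (cong (x ^ n *_) (^-* x m n)) (sym (*-^ x (x ^ m) n)))

  0^ : ∀ {n} → 0 < n → 0F ^ n ≡ 0F
  0^ {suc n} _ = zeroˡ _

  ^-comm : ∀ x m n → (x ^ m) ^ n ≡ (x ^ n) ^ m
  ^-comm x m n = trans (sym (^-* x m n)) (trans (cong (x ^_) (ℕP.*-comm m n)) (^-* x n m))

  ^-≢0 : ∀ {x} n → x ≢ 0F → x ^ n ≢ 0F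
  ^-≢0 zero    nz = 1≢0
  ^-≢0 (suc n) nz = *-≢0 nz (^-≢0 n nz)

  inv-^ : ∀ {x} n → x ≢ 0F → x ^ n * inv x ^ n ≡ 1F
  inv-^ {x} n nz = trans (sym (*-^ x (inv x) n)) (trans (cong (_^ n) (*-inv nz)) (1^ n))

  injective⇒permutation : ∀ {f : F → F} → (∀ {x y} → f x ≡ f y → x ≡ y) → IsPermutation f
  injective⇒permutation {f} inj = inj , λ y →
    let i , fi = fin-injective⇒surjective (λ i → encode (f (decode i)))
                   (λ e → decode-injective (inj (encode-injective e))) (encode y)
    in decode i , λ { refl → encode-injective fi }

  QuadraticRoot : ℕ → ℕ → F → Set
  QuadraticRoot n e u = u * u ≡ ι n + ι e * u

  module Modulo (p : ℕ) .{{_ : NonZero p}} (ιp≡0 : ι p ≡ 0F) where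

    ι-% : ∀ n → ι (n % p) ≡ ι n
    ι-% n = sym (begin
      ι n                              ≡⟨ cong ι (m≡m%n+[m/n]*n n p) ⟩
      ι (n % p ℕ.+ n / p ℕ.* p)        ≡⟨ ι-+ (n % p) _ ⟩
      ι (n % p) + ι (n / p ℕ.* p)      ≡⟨ cong (ι (n % p) +_) (trans (ι-* (n / p) p) (trans (cong (ι (n / p) *_) ιp≡0) (zeroʳ _))) ⟩
      ι (n % p) + 0F                   ≡⟨ +-identityʳ _ ⟩
      ι (n % p)                        ∎)

    -- The factor `p ∸ 1` plays the part of -1 wherever the computation is confined to natural
    -- numbers.
    ι[p-1] : ι (p ∸ 1) ≡ - 1F
    ι[p-1] = -‿≡0 (begin
      ι (p ∸ 1) - - 1F  ≡⟨ cong (ι (p ∸ 1) +_) (-‿involutive 1F) ⟩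
      ι (p ∸ 1) + 1F    ≡⟨ sym (ι-+ (p ∸ 1) 1) ⟩
      ι (p ∸ 1 ℕ.+ 1)   ≡⟨ cong ι (ℕP.m∸n+n≡m (ℕ.>-nonZero⁻¹ p)) ⟩
      ι p               ≡⟨ ιp≡0 ⟩
      0F                ∎)

-- The multiplicative group

-- Fin q with one element deleted; the deletion is phrased with q ∸ 1 so that q
-- need not be matched against a successor.
squeeze : ∀ {q} {z i : Fin q} → z ≢ i → Fin (q ∸ 1)
squeeze {suc q} = Fin.punchOut

squeeze-injective : ∀ {q} {z i j : Fin q} (z≢i : z ≢ i) (z≢j : z ≢ j) →
                    squeeze z≢i ≡ squeeze z≢j → i ≡ j
squeeze-injective {suc q} = FinP.punchOut-injective

spread : ∀ {q} → Fin q → Fin (q ∸ 1) → Fin q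
spread {suc q} = Fin.punchIn

spread-≢ : ∀ {q} (z : Fin q) i → spread z i ≢ z
spread-≢ {suc q} = FinP.punchInᵢ≢i

spread-injective : ∀ {q} (z : Fin q) {i j} → spread z i ≡ spread z j → i ≡ j
spread-injective {suc q} z = FinP.punchIn-injective z _ _

module Cyclic {q : ℕ} (K : FiniteField q) (g : FiniteField.F K)
              (gen : FiniteField.IsGenerator K g) where
  open Field K public
  open ≡-Reasoning

  g≢0 : g ≢ 0F
  g≢0 = proj₁ gen

  log : ∀ {x} → x ≢ 0F → ℕ
  log nz = proj₁ (proj₂ gen _ nz)

  g^log : ∀ {x} (nz : x ≢ 0F) → g ^ log nz ≡ x
  g^log nz = proj₂ (proj₂ gen _ nz)

  private
    unit : Fin (q ∸ 1) → F
    unit i = decode (spread (encode 0F) i)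

    unit≢0 : ∀ i → unit i ≢ 0F
    unit≢0 i e = spread-≢ (encode 0F) i
      (decode-injective (trans e (sym (decode-encode 0F))))

    code : ∀ {x} → x ≢ 0F → Fin (q ∸ 1)
    code {x} nz = squeeze {z = encode 0F} {i = encode x} (λ e → nz (encode-injective (sym e)))

    code-injective : ∀ {x y} (nx : x ≢ 0F) (ny : y ≢ 0F) → code nx ≡ code ny → x ≡ y
    code-injective nx ny e = encode-injective (squeeze-injective _ _ e)

  ^-% : ∀ x d .{{_ : NonZero d}} → x ^ d ≡ 1F → ∀ j → x ^ (j % d) ≡ x ^ j
  ^-% x d x^d≡1 j = begin
    x ^ (j % d)                      ≡⟨ sym (*-identityʳ _) ⟩
    x ^ (j % d) * 1F                 ≡⟨ cong (x ^ (j % d) *_) (sym x^[j/d*d]≡1) ⟩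
    x ^ (j % d) * x ^ (j / d ℕ.* d)  ≡⟨ sym (^-+ x (j % d) _) ⟩
    x ^ (j % d ℕ.+ j / d ℕ.* d)      ≡⟨ cong (x ^_) (sym (m≡m%n+[m/n]*n j d)) ⟩
    x ^ j                            ∎
    where
    x^[j/d*d]≡1 : x ^ (j / d ℕ.* d) ≡ 1F
    x^[j/d*d]≡1 = trans (cong (x ^_) (ℕP.*-comm (j / d) d))
      (trans (^-* x d (j / d)) (trans (cong (_^ (j / d)) x^d≡1) (1^ (j / d))))

  -- Every nonzero element is a power of g, and once g^d = 1 only the logarithm modulo d matters. So
  -- the q - 1 nonzero elements inject into the residues modulo d.
  order-minimal : ∀ d → 0 < d → g ^ d ≡ 1F → q ∸ 1 ≤ d
  order-minimal d@(suc _) _ g^d≡1 = FinP.injective⇒≤ {f = f} λ {i} {j} e →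
    spread-injective (encode 0F) (decode-injective (begin
      unit i                        ≡⟨ sym (g^log (unit≢0 i)) ⟩
      g ^ log (unit≢0 i)            ≡⟨ sym (^-% g d g^d≡1 (log (unit≢0 i))) ⟩
      g ^ (log (unit≢0 i) % d)      ≡⟨ cong (g ^_) (trans (sym (FinP.toℕ-fromℕ< _)) (trans (cong toℕ e) (FinP.toℕ-fromℕ< _))) ⟩
      g ^ (log (unit≢0 j) % d)      ≡⟨ ^-% g d g^d≡1 (log (unit≢0 j)) ⟩
      g ^ log (unit≢0 j)            ≡⟨ g^log (unit≢0 j) ⟩
      unit j                        ∎))
    where
    f : Fin (q ∸ 1) → Fin d
    f i = Fin.fromℕ< (m%n<n (log (unit≢0 i)) d)

  -- Two of the q powers g^0, ..., g^(q-1) coincide, which gives an exponent d with 0 < d ≤ q - 1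
  -- and g^d = 1; `order-minimal` bounds d from below.
  g^[q-1]≡1 : g ^ (q ∸ 1) ≡ 1F
  g^[q-1]≡1 with FinP.pigeonhole (ℕP.n<1+n (q ∸ 1)) (λ i → code (^-≢0 (toℕ i) g≢0))
  ... | i , j , i<j , e = subst (λ d → g ^ d ≡ 1F) d≡q-1 g^d≡1
    where
    d = toℕ j ∸ toℕ i
    g^d≡1 : g ^ d ≡ 1F
    g^d≡1 = *-cancelˡ (^-≢0 (toℕ i) g≢0) (begin
      g ^ toℕ i * g ^ d    ≡⟨ sym (^-+ g (toℕ i) d) ⟩
      g ^ (toℕ i ℕ.+ d)    ≡⟨ cong (g ^_) (ℕP.m+[n∸m]≡n (ℕP.<⇒≤ i<j)) ⟩
      g ^ toℕ j            ≡⟨ sym (code-injective (^-≢0 (toℕ i) g≢0) (^-≢0 (toℕ j) g≢0) e) ⟩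
      g ^ toℕ i            ≡⟨ sym (*-identityʳ _) ⟩
      g ^ toℕ i * 1F       ∎)
    d≡q-1 : d ≡ q ∸ 1
    d≡q-1 = ℕP.≤-antisym (ℕP.≤-trans (ℕP.m∸n≤m (toℕ j) (toℕ i)) (ℕP.≤-pred (FinP.toℕ<n j)))
                         (order-minimal d (ℕP.m<n⇒0<n∸m i<j) g^d≡1)

  0<q-1 : 0 < q ∸ 1
  0<q-1 = ℕP.≤-<-trans z≤n (FinP.toℕ<n (code 1≢0))

  instance
    q-1-nonZero : NonZero (q ∸ 1)
    q-1-nonZero = ℕ.>-nonZero 0<q-1

  fermat : ∀ {x} → x ≢ 0F → x ^ (q ∸ 1) ≡ 1F
  fermat {x} nz = begin
    x ^ (q ∸ 1)               ≡⟨ cong (_^ (q ∸ 1)) (sym (g^log nz)) ⟩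
    (g ^ log nz) ^ (q ∸ 1)    ≡⟨ ^-comm g (log nz) (q ∸ 1) ⟩
    (g ^ (q ∸ 1)) ^ log nz    ≡⟨ cong (_^ log nz) g^[q-1]≡1 ⟩
    1F ^ log nz               ≡⟨ 1^ (log nz) ⟩
    1F                        ∎

  order-divides : ∀ j → g ^ j ≡ 1F → q ∸ 1 ∣ j
  order-divides j g^j≡1 with j % (q ∸ 1) in eq
  ... | zero  = Div.m%n≡0⇒n∣m j (q ∸ 1) eq
  ... | suc r = contradiction
    (order-minimal (suc r) (s≤s z≤n)
      (subst (λ r → g ^ r ≡ 1F) eq (trans (^-% g (q ∸ 1) g^[q-1]≡1 j) g^j≡1)))
    (ℕP.<⇒≱ (subst (_< q ∸ 1) eq (m%n<n j (q ∸ 1))))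

  private
    g^-injective-≤ : ∀ {i j} → i ≤ j → j < q ∸ 1 → g ^ i ≡ g ^ j → i ≡ j
    g^-injective-≤ {i} {j} i≤j j< e with j ∸ i in eq | order-divides (j ∸ i) (*-cancelˡ (^-≢0 i g≢0)
        (trans (sym (^-+ g i (j ∸ i))) (trans (cong (g ^_) (ℕP.m+[n∸m]≡n i≤j)) (trans (sym e) (sym (*-identityʳ _))))))
    ... | zero  | _ = ℕP.≤-antisym i≤j (ℕP.m∸n≡0⇒m≤n eq)
    ... | suc d | q-1∣ = contradiction (Div.∣⇒≤ q-1∣)
            (ℕP.<⇒≱ (ℕP.≤-<-trans (ℕP.≤-trans (ℕP.≤-reflexive (sym eq)) (ℕP.m∸n≤m j i)) j<))

  g^-injective : ∀ {i j} → i < q ∸ 1 → j < q ∸ 1 → g ^ i ≡ g ^ j → i ≡ j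
  g^-injective {i} {j} i< j< e with ℕP.≤-total i j
  ... | inj₁ i≤j = g^-injective-≤ i≤j j< e
  ... | inj₂ j≤i = sym (g^-injective-≤ j≤i i< (sym e))

  quotient-nonZero : ∀ m {k} → m ℕ.* k ≡ q ∸ 1 → NonZero m
  quotient-nonZero zero    mk = contradiction mk (ℕP.<⇒≢ 0<q-1)
  quotient-nonZero (suc _) _  = _

  -- From x^m = 1 it follows that q - 1 = m k divides m times the logarithm of x, so k divides that
  -- logarithm.
  root : ∀ {x} m k → m ℕ.* k ≡ q ∸ 1 → x ≢ 0F → x ^ m ≡ 1F → ∃ λ h → h ≢ 0F × h ^ k ≡ x
  root {x} zero    k mk _  _ = contradiction mk (ℕP.<⇒≢ 0<q-1)
  root {x} m@(suc _) k mk nz x^m≡1 with Div.*-cancelʳ-∣ {k} {log nz} m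
      (subst₂ _∣_ (trans (sym mk) (ℕP.*-comm m k)) refl
        (order-divides (log nz ℕ.* m) (trans (^-* g (log nz) m) (trans (cong (_^ m) (g^log nz)) x^m≡1))))
  ... | divides e j≡e*k = g ^ e , ^-≢0 e g≢0 ,
    trans (sym (^-* g e k)) (trans (cong (g ^_) (sym j≡e*k)) (g^log nz))

  ratio-root : ∀ {x y} m k → m ℕ.* k ≡ q ∸ 1 → x ≢ 0F → y ≢ 0F → x ^ m ≡ y ^ m →
               ∃ λ h → h ≢ 0F × h ^ k * y ≡ x
  ratio-root {x} {y} m k mk nx ny e
    with h , nh , h^k ← root {x * inv y} m k mk (*-≢0 nx (inv-≢0 ny))
           (trans (*-^ x (inv y) m) (trans (cong (_* inv y ^ m) e) (inv-^ m ny)))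
    = h , nh , trans (cong (_* y) h^k)
        (trans (solve 3 (λ x i y → (x :* i) :* y := x :* (y :* i)) refl x (inv y) y)
               (trans (cong (x *_) (*-inv ny)) (*-identityʳ x)))

  -- The index of the coset of the k-th powers containing x; junk at x = 0.
  coset : ∀ k .{{_ : NonZero k}} → F → Fin k
  coset k x with x ≟ 0F
  ... | yes _ = Fin.fromℕ< (m%n<n 0 k)
  ... | no nz = Fin.fromℕ< (m%n<n (log nz) k)

  coset-≢0 : ∀ k .{{_ : NonZero k}} {x} → x ≢ 0F →
             ∃ λ j → g ^ j ≡ x × toℕ (coset k x) ≡ j % k
  coset-≢0 k {x} nz with x ≟ 0F
  ... | yes e = contradiction e nz
  ... | no nz′ = log nz′ , g^log nz′ , FinP.toℕ-fromℕ< _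

  -- Since (g^m)^k = 1, the m-th power of g^j depends on j modulo k only.
  coset-≡ : ∀ {x y} m k .{{_ : NonZero k}} → m ℕ.* k ≡ q ∸ 1 → x ≢ 0F → y ≢ 0F →
            coset k x ≡ coset k y → x ^ m ≡ y ^ m
  coset-≡ {x} {y} m k mk nx ny e
    with i , g^i , ci ← coset-≢0 k nx | j , g^j , cj ← coset-≢0 k ny = begin
    x ^ m              ≡⟨ cong (_^ m) (sym g^i) ⟩
    (g ^ i) ^ m        ≡⟨ ^-comm g i m ⟩
    (g ^ m) ^ i        ≡⟨ sym (^-% (g ^ m) k g^m^k i) ⟩
    (g ^ m) ^ (i % k)  ≡⟨ cong ((g ^ m) ^_) (trans (sym ci) (trans (cong toℕ e) cj)) ⟩
    (g ^ m) ^ (j % k)  ≡⟨ ^-% (g ^ m) k g^m^k j ⟩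
    (g ^ m) ^ j        ≡⟨ ^-comm g m j ⟩
    (g ^ j) ^ m        ≡⟨ cong (_^ m) g^j ⟩
    y ^ m              ∎
    where
    g^m^k : (g ^ m) ^ k ≡ 1F
    g^m^k = trans (sym (^-* g m k)) (trans (cong (g ^_) mk) g^[q-1]≡1)

-- The order of a finite field is a power of its characteristic

prime-∣-^ : ∀ {r p} d → Prime r → Prime p → r ∣ p ℕ.^ d → r ≡ p
prime-∣-^ zero r-prime _ r∣1 = contradiction (Div.∣1⇒≡1 r∣1) (ℕ.nonTrivial⇒≢1 {{prime⇒nonTrivial r-prime}})
prime-∣-^ {r} {p} (suc d) r-prime p-prime r∣ with euclidsLemma p (p ℕ.^ d) r-prime r∣
... | inj₂ r∣p^d = prime-∣-^ d r-prime p-prime r∣p^d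
... | inj₁ r∣p with prime⇒irreducible p-prime r∣p
...   | inj₁ r≡1 = contradiction r≡1 (ℕ.nonTrivial⇒≢1 {{prime⇒nonTrivial r-prime}})
...   | inj₂ r≡p = r≡p

module Characteristic {q : ℕ} (K : FiniteField q) where
  open Field K
  open ≡-Reasoning

  private
    factor-vanishes : ∀ ps → All Prime ps → ι (product ps) ≡ 0F → ∃ λ p → Prime p × ι p ≡ 0F
    factor-vanishes [] [] e = contradiction e 1≢0
    factor-vanishes (p ∷ ps) (p-prime ∷ ps-prime) e with ι p ≟ 0F
    ... | yes ιp≡0 = p , p-prime , ιp≡0
    ... | no ιp≢0 = factor-vanishes ps ps-prime
          (*-cancelˡ ιp≢0 (trans (sym (ι-* p (product ps))) (trans e (sym (zeroʳ (ι p))))))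

    -- The numbers 0, ..., q cannot all have different images, so some positive integer vanishes in
    -- the field, and then so does one of its prime factors, as there are no zero divisors.
    prime-characteristic : ∃ λ p → Prime p × ι p ≡ 0F
    prime-characteristic with FinP.pigeonhole (ℕP.n<1+n q) (λ (i : Fin (suc q)) → encode (ι (toℕ i)))
    ... | i , j , i<j , e = factor-vanishes factors factorsPrime
          (subst (λ n → ι n ≡ 0F) isFactorisation
            (+-cancelʳ (ι (toℕ i)) (begin
              ι n + ι (toℕ i)       ≡⟨ sym (ι-+ n (toℕ i)) ⟩
              ι (n ℕ.+ toℕ i)       ≡⟨ cong ι (ℕP.m∸n+n≡m (ℕP.<⇒≤ i<j)) ⟩
              ι (toℕ j)             ≡⟨ sym (encode-injective e) ⟩
              ι (toℕ i)             ≡⟨ sym (+-identityˡ _) ⟩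
              0F + ι (toℕ i)        ∎)))
      where
      n = toℕ j ∸ toℕ i
      open PrimeFactorisation (factorise n {{ℕ.>-nonZero (ℕP.m<n⇒0<n∸m i<j)}})

    module OfCharacteristic (p : ℕ) (p-prime : Prime p) (ιp≡0 : ι p ≡ 0F) where
      instance
        p-nonZero : NonZero p
        p-nonZero = prime⇒nonZero p-prime

      open Modulo p ιp≡0

      ι-invertible : ∀ e → 0 < e → e < p → ∃ λ f → ι f * ι e ≡ 1F
      ι-invertible e@(suc _) _ e<p with coprime-Bézout (prime⇒coprime p-prime e<p)
      ... | Bézout.-+ x y eq = y , (begin
        ι y * ι e          ≡⟨ sym (ι-* y e) ⟩
        ι (y ℕ.* e)        ≡⟨ cong ι (sym eq) ⟩
        ι (1 ℕ.+ x ℕ.* p)  ≡⟨ ι-+ 1 (x ℕ.* p) ⟩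
        1F + ι (x ℕ.* p)   ≡⟨ cong (1F +_) (trans (ι-* x p) (trans (cong (ι x *_) ιp≡0) (zeroʳ _))) ⟩
        1F + 0F            ≡⟨ +-identityʳ 1F ⟩
        1F                 ∎)
      -- Here y e = -1 modulo p. The inverse of e is therefore -y, written as the natural number (p
      -- - 1) y.
      ... | Bézout.+- x y eq = (p ∸ 1) ℕ.* y , (begin
        ι ((p ∸ 1) ℕ.* y) * ι e    ≡⟨ cong (_* ι e) (trans (ι-* (p ∸ 1) y) (cong (_* ι y) ι[p-1])) ⟩
        - 1F * ι y * ι e           ≡⟨ solve 3 (λ o y e → :- o :* y :* e := (:- o) :* (y :* e)) refl 1F (ι y) (ι e) ⟩
        - 1F * (ι y * ι e)         ≡⟨ cong (- 1F *_) (sym (ι-* y e)) ⟩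
        - 1F * ι (y ℕ.* e)         ≡⟨ solve 1 (λ z → (:- con (1 , 0)) :* z := con (1 , 0) :- (con (1 , 0) :+ z)) refl _ ⟩
        1F - (1F + ι (y ℕ.* e))    ≡⟨ cong (λ z → 1F - z) (trans (sym (ι-+ 1 (y ℕ.* e))) (cong ι eq)) ⟩
        1F - ι (x ℕ.* p)           ≡⟨ cong (λ z → 1F - z) (trans (ι-* x p) (trans (cong (ι x *_) ιp≡0) (zeroʳ _))) ⟩
        1F - 0F                    ≡⟨ solve 1 (λ o → o :- con (0 , 0) := o) refl 1F ⟩
        1F                         ∎)

      -- Elements are listed without repetition, so N is the size. Scalars are repeated sums of 1,
      -- hence closure under addition already provides the scalar multiples (`ι*∈`).
      record Subspace (N : ℕ) : Set where
        field
          element   : Fin N → F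
          injective : ∀ {i j} → element i ≡ element j → i ≡ j
        _∋_ : F → Set
        _∋_ v = ∃ λ i → element i ≡ v
        field
          0∈ : _∋_ 0F
          +∈ : ∀ {u v} → _∋_ u → _∋_ v → _∋_ (u + v)

        ι*∈ : ∀ n {v} → _∋_ v → _∋_ (ι n * v)
        ι*∈ zero    {v} _ = subst _∋_ (sym (zeroˡ v)) 0∈
        ι*∈ (suc n) {v} v∈ = subst _∋_ (begin
          v + ι n * v        ≡⟨ solve 2 (λ v n → v :+ n :* v := (con (1 , 0) :+ n) :* v) refl v (ι n) ⟩
          (1F + ι n) * v     ≡⟨ cong (_* v) (sym (ι-+ 1 n)) ⟩
          ι (suc n) * v      ∎) (+∈ v∈ (ι*∈ n v∈))

        size≤q : N ≤ q
        size≤q = FinP.injective⇒≤ {f = λ i → encode (element i)} λ e → injective (encode-injective e)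

      zero-space : Subspace 1
      zero-space = record
        { element = λ _ → 0F
        ; injective = λ { {Fin.zero} {Fin.zero} _ → refl }
        ; 0∈ = Fin.zero , refl
        ; +∈ = λ { (_ , refl) (_ , refl) → Fin.zero , sym (+-identityˡ 0F) }
        }

      module Adjoin {N} (S : Subspace N) (v : F) (v∉ : ¬ Subspace._∋_ S v) where
        open Subspace S

        combination : Fin p × Fin N → F
        combination (c , i) = ι (toℕ c) * v + element i

        private
          -- The difference of the coefficients of v would be invertible modulo p, which puts v in S.
          not-less : ∀ c i c′ i′ → combination (c , i) ≡ combination (c′ , i′) → ¬ (toℕ c < toℕ c′)
          not-less c i c′ i′ eq c<c′ = v∉ (subst _∋_ (begin
            ι f * (element i + ι (p ∸ 1) * element i′)
              ≡⟨ cong (λ z → ι f * (element i + z * element i′)) ι[p-1] ⟩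
            ι f * (element i + - 1F * element i′)
              ≡⟨ cong (ι f *_) (solve 4 (λ a s t cv → s :+ (:- con (1 , 0)) :* t := (cv :+ s) :- (cv :+ t)) refl v (element i) (element i′) (ι (toℕ c) * v)) ⟩
            ι f * ((ι (toℕ c) * v + element i) - (ι (toℕ c) * v + element i′))
              ≡⟨ cong (λ z → ι f * (z - (ι (toℕ c) * v + element i′))) eq ⟩
            ι f * ((ι (toℕ c′) * v + element i′) - (ι (toℕ c) * v + element i′))
              ≡⟨ cong (λ z → ι f * ((z * v + element i′) - (ι (toℕ c) * v + element i′)))
                   (trans (cong ι (sym (ℕP.m∸n+n≡m (ℕP.<⇒≤ c<c′)))) (ι-+ e (toℕ c))) ⟩
            ι f * (((ι e + ι (toℕ c)) * v + element i′) - (ι (toℕ c) * v + element i′))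
              ≡⟨ solve 5 (λ f e c v t → f :* (((e :+ c) :* v :+ t) :- (c :* v :+ t)) := (f :* e) :* v) refl
                   (ι f) (ι e) (ι (toℕ c)) v (element i′) ⟩
            (ι f * ι e) * v   ≡⟨ cong (_* v) fe≡1 ⟩
            1F * v            ≡⟨ *-identityˡ v ⟩
            v                 ∎)
            (ι*∈ f (+∈ (i , refl) (ι*∈ (p ∸ 1) (i′ , refl)))))
            where
            e = toℕ c′ ∸ toℕ c
            inverse-of-e = ι-invertible e (ℕP.m<n⇒0<n∸m c<c′) (ℕP.≤-<-trans (ℕP.m∸n≤m (toℕ c′) (toℕ c)) (FinP.toℕ<n c′))
            f = proj₁ inverse-of-e
            fe≡1 = proj₂ inverse-of-e

        combination-injective : ∀ {x y} → combination x ≡ combination y → x ≡ y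
        combination-injective {c , i} {c′ , i′} eq with ℕP.<-cmp (toℕ c) (toℕ c′)
        ... | tri< c<c′ _ _ = contradiction c<c′ (not-less c i c′ i′ eq)
        ... | tri> _ _ c′<c = contradiction c′<c (not-less c′ i′ c i (sym eq))
        ... | tri≈ _ c≡c′ _ with refl ← FinP.toℕ-injective c≡c′ =
              cong (c ,_) (injective (+-cancelʳ (ι (toℕ c) * v) (trans (+-comm _ _) (trans eq (+-comm _ _)))))

        adjoin : Subspace (p ℕ.* N)
        adjoin = record
          { element = λ k → combination (Fin.remQuot N k)
          ; injective = λ {j} {k} e → trans (sym (FinP.combine-remQuot {p} N j))
              (trans (cong (λ { (c , i) → Fin.combine c i }) (combination-injective e)) (FinP.combine-remQuot {p} N k))
          ; 0∈ = let i , ei = 0∈ in at (Fin.fromℕ< (m%n<n 0 p)) i (begin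
              ι (toℕ (Fin.fromℕ< (m%n<n 0 p))) * v + element i
                ≡⟨ cong₂ (λ z w → z * v + w) (trans (cong ι (FinP.toℕ-fromℕ< (m%n<n 0 p))) (ι-% 0)) ei ⟩
              0F * v + 0F  ≡⟨ solve 1 (λ v → con (0 , 0) :* v :+ con (0 , 0) := con (0 , 0)) refl v ⟩
              0F           ∎)
          ; +∈ = λ { (j , refl) (k , refl) → sum (Fin.remQuot N j) (Fin.remQuot N k) }
          }
          where
          at : ∀ {u} c i → combination (c , i) ≡ u → ∃ λ k → combination (Fin.remQuot N k) ≡ u
          at c i e = Fin.combine c i , trans (cong combination (FinP.remQuot-combine {p} {N} c i)) e
          sum : ∀ x y → ∃ λ k → combination (Fin.remQuot {p} N k) ≡ combination x + combination y
          sum (c , i) (d , j) = let k , ek = +∈ (i , refl) (j , refl) ; e = (toℕ c ℕ.+ toℕ d) in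
            at (Fin.fromℕ< (m%n<n e p)) k (begin
              ι (toℕ (Fin.fromℕ< (m%n<n e p))) * v + element k
                ≡⟨ cong₂ (λ z w → z * v + w)
                     (trans (cong ι (FinP.toℕ-fromℕ< (m%n<n e p))) (trans (ι-% e) (ι-+ (toℕ c) (toℕ d)))) ek ⟩
              (ι (toℕ c) + ι (toℕ d)) * v + (element i + element j)
                ≡⟨ solve 5 (λ c d v s t → (c :+ d) :* v :+ (s :+ t) := (c :* v :+ s) :+ (d :* v :+ t)) refl
                     (ι (toℕ c)) (ι (toℕ d)) v (element i) (element j) ⟩
              combination (c , i) + combination (d , j) ∎)

      -- Adjoining an element multiplies the size by p ≥ 2 and so raises it by at least 1. The bound
      -- `q < p ^ d + fuel` thus survives when fuel drops by 1, and at fuel 0 it contradicts that a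
      -- subspace has at most q elements.
      grow : ∀ fuel d → q < p ℕ.^ d ℕ.+ fuel → Subspace (p ℕ.^ d) → ∃ λ n → q ≡ p ℕ.^ n
      grow zero d q<N S = contradiction (Subspace.size≤q S) (ℕP.<⇒≱ (subst (q <_) (ℕP.+-identityʳ _) q<N))
      grow (suc fuel) d q<N S
        with FinP.all? {n = q} (λ k → FinP.any? (λ i → Subspace.element S i ≟ decode k))
      ... | yes all = d , ℕP.≤-antisym
            (FinP.injective⇒≤ {f = λ k → proj₁ (all k)} λ {j} {k} e →
              decode-injective (trans (sym (proj₂ (all j))) (trans (cong (Subspace.element S) e) (proj₂ (all k)))))
            (Subspace.size≤q S)
      ... | no ¬all with k , v∉ ← FinP.¬∀⟶∃¬ q _ (λ k → FinP.any? (λ i → Subspace.element S i ≟ decode k)) ¬all =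
            grow fuel (suc d)
              (ℕP.<-≤-trans q<N (ℕP.≤-trans (ℕP.≤-reflexive (ℕP.+-suc (p ℕ.^ d) fuel))
                (ℕP.+-monoˡ-≤ fuel (ℕP.≤-trans (ℕP.m<m*n (p ℕ.^ d) p {{ℕP.m^n≢0 p d}} (ℕ.nonTrivial⇒n>1 p {{prime⇒nonTrivial p-prime}})) (ℕP.≤-reflexive (ℕP.*-comm (p ℕ.^ d) p))))))
              (Adjoin.adjoin S (decode k) v∉)

      prime-power : ∃ λ n → q ≡ p ℕ.^ n
      prime-power = grow q 0 ℕP.≤-refl zero-space


    p : ℕ
    p = proj₁ prime-characteristic

    p-prime : Prime p
    p-prime = proj₁ (proj₂ prime-characteristic)

    ιp≡0 : ι p ≡ 0F
    ιp≡0 = proj₂ (proj₂ prime-characteristic)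

    q-prime-power : ∃ λ n → q ≡ p ℕ.^ n
    q-prime-power = OfCharacteristic.prime-power p p-prime ιp≡0

  prime-divisor⇒characteristic : ∀ {r} → Prime r → r ∣ q → r ≡ p
  prime-divisor⇒characteristic r-prime r∣q = prime-∣-^ (proj₁ q-prime-power) r-prime p-prime (subst (_ ∣_) (proj₂ q-prime-power) r∣q)

  ι-prime-divisor : ∀ {r} → Prime r → r ∣ q → ι r ≡ 0F
  ι-prime-divisor r-prime r∣q = trans (cong ι (prime-divisor⇒characteristic r-prime r∣q)) ιp≡0

  prime-divisor-unique : ∀ {r s} → Prime r → Prime s → r ∣ q → s ∣ q → r ≡ s
  prime-divisor-unique r-prime s-prime r∣q s∣q = trans (prime-divisor⇒characteristic r-prime r∣q)
    (sym (prime-divisor⇒characteristic s-prime s∣q))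

-- Cyclotomic maps

module Cyclotomic {q : ℕ} (K : FiniteField q) (g : FiniteField.F K)
                  (gen : FiniteField.IsGenerator K g) where
  open Cyclic K g gen public
  open ≡-Reasoning

  -- For k > 0 this is "cyclotomic of index k" freed from the choice of generator.
  Homogeneous : ℕ → (F → F) → Set
  Homogeneous k θ = ∀ {h x} → h ≢ 0F → x ≢ 0F → θ (h ^ k * x) ≡ h ^ k * θ x

  homogeneous-multiple : ∀ {k c θ} → k ∣ c → Homogeneous k θ → Homogeneous c θ
  homogeneous-multiple {k} {c} {θ} (divides e refl) hom {h} {x} h≢0 x≢0 =
    subst (λ y → θ (y * x) ≡ y * θ x) (sym (^-* h e k)) (hom (^-≢0 e h≢0) x≢0)

  cyclotomic⇒homogeneous : ∀ k .{{_ : NonZero k}} {θ} → IsCyclotomic g k θ → Homogeneous k θ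
  cyclotomic⇒homogeneous k {θ} (a , _ , θ-coset) {h} {x} nh nx = begin
    θ (h ^ k * x)                       ≡⟨ cong θ h^k*x ⟩
    θ (g ^ (i′ ℕ.+ (s ℕ.+ j / k) ℕ.* k))    ≡⟨ θ-coset i (s ℕ.+ j / k) ⟩
    a i * g ^ (i′ ℕ.+ (s ℕ.+ j / k) ℕ.* k)  ≡⟨ cong (a i *_) (sym h^k*x) ⟩
    a i * (h ^ k * x)                   ≡⟨ solve 3 (λ a h x → a :* (h :* x) := h :* (a :* x)) refl (a i) (h ^ k) x ⟩
    h ^ k * (a i * x)                   ≡⟨ cong (λ z → h ^ k * (a i * z)) x≡ ⟩
    h ^ k * (a i * g ^ (i′ ℕ.+ j / k ℕ.* k))  ≡⟨ cong (h ^ k *_) (sym (θ-coset i (j / k))) ⟩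
    h ^ k * θ (g ^ (i′ ℕ.+ j / k ℕ.* k))      ≡⟨ cong (λ z → h ^ k * θ z) (sym x≡) ⟩
    h ^ k * θ x                         ∎
    where
    s = log nh
    j = log nx
    i = Fin.fromℕ< (m%n<n j k)
    i′ = toℕ i
    x≡ : x ≡ g ^ (i′ ℕ.+ j / k ℕ.* k)
    x≡ = trans (sym (g^log nx)) (cong (g ^_) (trans (m≡m%n+[m/n]*n j k)
           (cong (ℕ._+ j / k ℕ.* k) (sym (FinP.toℕ-fromℕ< (m%n<n j k))))))
    h^k*x : h ^ k * x ≡ g ^ (i′ ℕ.+ (s ℕ.+ j / k) ℕ.* k)
    h^k*x = begin
      h ^ k * x                                      ≡⟨ cong₂ (λ y z → y ^ k * z) (sym (g^log nh)) x≡ ⟩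
      (g ^ s) ^ k * g ^ (i′ ℕ.+ j / k ℕ.* k)         ≡⟨ cong₂ _*_ (sym (^-* g s k)) (^-+ g i′ (j / k ℕ.* k)) ⟩
      g ^ (s ℕ.* k) * (g ^ i′ * g ^ (j / k ℕ.* k))   ≡⟨ solve 3 (λ a b c → a :* (b :* c) := b :* (a :* c)) refl _ _ _ ⟩
      g ^ i′ * (g ^ (s ℕ.* k) * g ^ (j / k ℕ.* k))   ≡⟨ cong (g ^ i′ *_) (sym (^-+ g (s ℕ.* k) (j / k ℕ.* k))) ⟩
      g ^ i′ * g ^ (s ℕ.* k ℕ.+ j / k ℕ.* k)         ≡⟨ cong (λ e → g ^ i′ * g ^ e) (sym (ℕP.*-distribʳ-+ k s (j / k))) ⟩
      g ^ i′ * g ^ ((s ℕ.+ j / k) ℕ.* k)             ≡⟨ sym (^-+ g i′ ((s ℕ.+ j / k) ℕ.* k)) ⟩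
      g ^ (i′ ℕ.+ (s ℕ.+ j / k) ℕ.* k)               ∎

  homogeneous⇒cyclotomic : ∀ k {θ} → θ 0F ≡ 0F → Homogeneous k θ → IsCyclotomic g k θ
  homogeneous⇒cyclotomic k {θ} θ0 hom = (λ i → θ (g ^ toℕ i) * inv (g ^ toℕ i)) , θ0 , λ i m → begin
    θ (g ^ (toℕ i ℕ.+ m ℕ.* k))              ≡⟨ cong θ (split i m) ⟩
    θ ((g ^ m) ^ k * g ^ toℕ i)              ≡⟨ hom (^-≢0 m g≢0) (^-≢0 (toℕ i) g≢0) ⟩
    (g ^ m) ^ k * θ (g ^ toℕ i)              ≡⟨ cong ((g ^ m) ^ k *_) (sym (trans
      (cong (θ (g ^ toℕ i) *_) (*-inv (^-≢0 (toℕ i) g≢0))) (*-identityʳ (θ (g ^ toℕ i))))) ⟩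
    (g ^ m) ^ k * (θ (g ^ toℕ i) * (g ^ toℕ i * inv (g ^ toℕ i)))
      ≡⟨ solve 4 (λ h t x i → h :* (t :* (x :* i)) := (t :* i) :* (h :* x)) refl ((g ^ m) ^ k) _ _ _ ⟩
    (θ (g ^ toℕ i) * inv (g ^ toℕ i)) * ((g ^ m) ^ k * g ^ toℕ i)
      ≡⟨ cong (_ *_) (sym (split i m)) ⟩
    (θ (g ^ toℕ i) * inv (g ^ toℕ i)) * g ^ (toℕ i ℕ.+ m ℕ.* k)  ∎
    where
    split : ∀ i m → g ^ (toℕ i ℕ.+ m ℕ.* k) ≡ (g ^ m) ^ k * g ^ toℕ i
    split i m = trans (^-+ g (toℕ i) (m ℕ.* k)) (trans (*-comm _ _) (cong (_* g ^ toℕ i) (^-* g m k)))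

  inD : ∀ {k θ} → k ∣ q ∸ 1 → θ 0F ≡ 0F → Homogeneous k θ →
        (∀ {x y} → θ x ≡ θ y → x ≡ y) → (∀ {x y} → θ x - x ≡ θ y - y → x ≡ y) →
        (∀ ℓ → 0 < ℓ → ℓ < k → ¬ Homogeneous ℓ θ) → InD g k θ
  inD {k} {θ} k∣q-1 θ0 hom inj inj′ proper =
    (k∣q-1 , (injective⇒permutation inj , injective⇒permutation inj′) , homogeneous⇒cyclotomic k θ0 hom) ,
    -- `InD` also ranges over ℓ = 0, which does not divide the positive number q - 1.
    λ { zero _ 0∣q-1 _ → contradiction (Div.0∣⇒≡0 0∣q-1) (≢-sym (ℕP.<⇒≢ 0<q-1))
      ; ℓ@(suc _) ℓ<k _ (_ , _ , cyclotomic) →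
          proper ℓ (s≤s z≤n) ℓ<k (cyclotomic⇒homogeneous ℓ cyclotomic) }

  OrthogonalPair : ℕ → ℕ → Set
  OrthogonalPair a b = Σ (F → F) λ θ → Σ (F → F) λ θ′ → InD g a θ × InD g b θ′ × Orthogonal θ θ′

  -- Once equal images are known to come from equal multipliers, the multiplier cancels. The point 0
  -- is kept apart from the others because multipliers at nonzero points do not vanish.
  scaling-injective : ∀ {μ : F → F} → (∀ {x} → x ≢ 0F → μ x ≢ 0F) →
    (∀ {s t} → s ≢ 0F → t ≢ 0F → μ s * s ≡ μ t * t → μ s ≡ μ t) →
    ∀ {s t} → μ s * s ≡ μ t * t → s ≡ t
  scaling-injective {μ} μ≢0 same {s} {t} e with s ≟ 0F | t ≟ 0F
  ... | yes s≡0 | yes t≡0 = trans s≡0 (sym t≡0)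
  ... | yes s≡0 | no t≢0 = contradiction (trans (sym e) (trans (cong (μ s *_) s≡0) (zeroʳ _))) (*-≢0 (μ≢0 t≢0) t≢0)
  ... | no s≢0 | yes t≡0 = contradiction (trans e (trans (cong (μ t *_) t≡0) (zeroʳ _))) (*-≢0 (μ≢0 s≢0) s≢0)
  ... | no s≢0 | no t≢0 = *-cancelˡ (μ≢0 s≢0) (trans e (cong (_* t) (sym (same s≢0 t≢0 e))))

  cancel-class : ∀ m {u v s t} → u ≢ 0F → u ^ m ≡ v ^ m → u * s ≡ v * t → s ^ m ≡ t ^ m
  cancel-class m {u} {v} {s} {t} u≢0 uv e = *-cancelˡ (^-≢0 m u≢0) (begin
    u ^ m * s ^ m  ≡⟨ sym (*-^ u s m) ⟩
    (u * s) ^ m    ≡⟨ cong (_^ m) e ⟩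
    (v * t) ^ m    ≡⟨ *-^ v t m ⟩
    v ^ m * t ^ m  ≡⟨ cong (_* t ^ m) (sym uv) ⟩
    u ^ m * t ^ m  ∎)

  choose : F → F → F → F
  choose x y u with u ≟ 1F
  ... | yes _ = x
  ... | no _  = y

  choose-ind : ∀ (P : F → Set) {x y} → P x → P y → ∀ u → P (choose x y u)
  choose-ind P px py u with u ≟ 1F
  ... | yes _ = px
  ... | no _  = py

  choose-1 : ∀ {x y u} → u ≡ 1F → choose x y u ≡ x
  choose-1 {u = u} e with u ≟ 1F
  ... | yes _ = refl
  ... | no n  = contradiction e n

  choose-≢1 : ∀ {x y u} → u ≢ 1F → choose x y u ≡ y
  choose-≢1 {u = u} n with u ≟ 1F
  ... | yes e = contradiction e n
  ... | no _  = refl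

  record SameType (m : ℕ) (x y : F) : Set where
    field
      x≢y   : x ≢ y
      x≢0   : x ≢ 0F
      y≢0   : y ≢ 0F
      x≢1   : x ≢ 1F
      y≢1   : y ≢ 1F
      x~y   : x ^ m ≡ y ^ m
      x-1~y-1 : (x - 1F) ^ m ≡ (y - 1F) ^ m

  sameType-sym : ∀ {m x y} → SameType m x y → SameType m y x
  sameType-sym t = record
    { x≢y = ≢-sym x≢y ; x≢0 = y≢0 ; y≢0 = x≢0 ; x≢1 = y≢1 ; y≢1 = x≢1
    ; x~y = sym x~y ; x-1~y-1 = sym x-1~y-1 }
    where open SameType t

  -- The multiplier is x on the group of k-th powers and y on its other cosets, where m = (q - 1) / k.
  twoValued : ℕ → F → F → F → F
  twoValued m x y t = choose x y (t ^ m) * t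

  module _ (m k : ℕ) (mk : m ℕ.* k ≡ q ∸ 1) where

    pow-k-class : ∀ {h} → h ≢ 0F → (h ^ k) ^ m ≡ 1F
    pow-k-class {h} nh = trans (^-comm h k m) (trans (sym (^-* h m k)) (trans (cong (h ^_) mk) (fermat nh)))

    -- Multiplication by x and by y has the same effect on cosets of the k-th powers, so t^m, and
    -- with it the choice between x and y, can be recovered from the image of t.
    twoValued-injective : ∀ {x y} → x ≢ 0F → y ≢ 0F → x ^ m ≡ y ^ m →
                          ∀ {s t} → twoValued m x y s ≡ twoValued m x y t → s ≡ t
    twoValued-injective {x} {y} nx ny x~y = scaling-injective
      (λ {t} _ → choose-ind (_≢ 0F) nx ny (t ^ m))
      λ {s} {t} _ _ e → cong (choose x y) (cancel-class m (choose-ind (_≢ 0F) nx ny (s ^ m))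
        (trans (choose-ind (λ z → z ^ m ≡ x ^ m) refl (sym x~y) (s ^ m))
          (sym (choose-ind (λ z → z ^ m ≡ x ^ m) refl (sym x~y) (t ^ m)))) e)

    twoValued-∈D : ∀ {x y} → SameType m x y → InD g k (twoValued m x y)
    twoValued-∈D {x} {y} xy = inD (divides m (sym mk)) (zeroʳ _)
      (λ {h} {t} nh nt → begin
        choose x y ((h ^ k * t) ^ m) * (h ^ k * t)
          ≡⟨ cong (λ u → choose x y u * (h ^ k * t))
               (trans (*-^ (h ^ k) t m) (trans (cong (_* t ^ m) (pow-k-class nh)) (*-identityˡ _))) ⟩
        choose x y (t ^ m) * (h ^ k * t)
          ≡⟨ solve 3 (λ c h t → c :* (h :* t) := h :* (c :* t)) refl (choose x y (t ^ m)) (h ^ k) t ⟩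
        h ^ k * (choose x y (t ^ m) * t)  ∎)
      (twoValued-injective x≢0 y≢0 x~y)
      (λ {s} {t} e → twoValued-injective (-‿≢0 x≢1) (-‿≢0 y≢1) x-1~y-1
        (trans (sym (minus-id s)) (trans e (minus-id t))))
      -- 1 is a k-th power and g^ℓ is not. Homogeneity of index ℓ, applied to the step from 1 to
      -- g^ℓ, would therefore identify x with y.
      λ ℓ 0<ℓ ℓ<k hom → x≢y (*-cancelʳ (^-≢0 ℓ g≢0) (begin
        x * g ^ ℓ                                       ≡⟨ cong (_* g ^ ℓ) (sym (choose-1 (1^ m))) ⟩
        choose x y (1F ^ m) * g ^ ℓ                     ≡⟨ solve 2 (λ c h → c :* h := h :* (c :* con (1 , 0))) refl _ (g ^ ℓ) ⟩
        g ^ ℓ * (choose x y (1F ^ m) * 1F)              ≡⟨ sym (hom g≢0 1≢0) ⟩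
        choose x y ((g ^ ℓ * 1F) ^ m) * (g ^ ℓ * 1F)    ≡⟨ cong (λ z → choose x y (z ^ m) * z) (*-identityʳ _) ⟩
        choose x y ((g ^ ℓ) ^ m) * g ^ ℓ                ≡⟨ cong (_* g ^ ℓ) (choose-≢1 (nontrivial ℓ 0<ℓ ℓ<k)) ⟩
        y * g ^ ℓ                                       ∎))
      where
      open SameType xy
      minus-id : ∀ t → twoValued m x y t - t ≡ twoValued m (x - 1F) (y - 1F) t
      minus-id t with t ^ m ≟ 1F
      ... | yes _ = solve 2 (λ x t → x :* t :- t := (x :- con (1 , 0)) :* t) refl x t
      ... | no _  = solve 2 (λ x t → x :* t :- t := (x :- con (1 , 0)) :* t) refl y t
      nontrivial : ∀ ℓ → 0 < ℓ → ℓ < k → (g ^ ℓ) ^ m ≢ 1F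
      nontrivial ℓ@(suc _) _ ℓ<k e = ℕP.<⇒≱ (ℕP.*-monoˡ-< m {{quotient-nonZero m mk}} ℓ<k)
        (ℕP.≤-trans (ℕP.≤-reflexive (trans (ℕP.*-comm k m) mk))
          (Div.∣⇒≤ {{ℕP.m*n≢0 ℓ m {{_}} {{quotient-nonZero m mk}}}} (order-divides (ℓ ℕ.* m) (trans (^-* g ℓ m) e))))

    -- The difference of two such maps of one index is again two-valued, with multipliers x - z and
    -- y - w, so `twoValued-injective` applies to it too.
    equal-index-pair : ∀ {x y z w} → SameType m x y → SameType m z w → x ≢ z → y ≢ w →
                       (x - z) ^ m ≡ (y - w) ^ m → OrthogonalPair k k
    equal-index-pair {x} {y} {z} {w} xy zw x≢z y≢w e =
      twoValued m x y , twoValued m z w , twoValued-∈D xy , twoValued-∈D zw ,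
      injective⇒permutation λ {s} {t} eq → twoValued-injective (-‿≢0 x≢z) (-‿≢0 y≢w) e
        (trans (sym (difference s)) (trans eq (difference t)))
      where
      difference : ∀ t → twoValued m x y t - twoValued m z w t ≡ twoValued m (x - z) (y - w) t
      difference t with t ^ m ≟ 1F
      ... | yes _ = solve 3 (λ x z t → x :* t :- z :* t := (x :- z) :* t) refl x z t
      ... | no _  = solve 3 (λ x z t → x :* t :- z :* t := (x :- z) :* t) refl y w t

  -- All four differences of multipliers lie in one coset of the a-th powers, so the image of t
  -- under the difference reveals the a-coset of t and hence which of x, y is in use. With that one
  -- fixed, subtracting z or w leads to the same coset of the b-th powers, so the b-coset of t is
  -- revealed as well.
  mixed-index-pair : ∀ mₐ a m_b b → mₐ ℕ.* a ≡ q ∸ 1 → m_b ℕ.* b ≡ q ∸ 1 →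
    ∀ {x y z w} → SameType mₐ x y → SameType m_b z w → x ≢ z → x ≢ w → y ≢ z → y ≢ w →
    (∀ {u v} → u ∈ x ∷ y ∷ [] → v ∈ z ∷ w ∷ [] → (u - v) ^ mₐ ≡ (y - w) ^ mₐ) →
    (∀ {u} → u ∈ x ∷ y ∷ [] → (u - z) ^ m_b ≡ (u - w) ^ m_b) →
    OrthogonalPair a b
  mixed-index-pair mₐ a m_b b ma mb {x} {y} {z} {w} xy zw x≢z x≢w y≢z y≢w classₐ class_b =
    twoValued mₐ x y , twoValued m_b z w , twoValued-∈D mₐ a ma xy , twoValued-∈D m_b b mb zw ,
    injective⇒permutation λ {s} {t} e → scaling-injective {μ}
      (λ {t} _ → μ≢0 (t ^ mₐ) (t ^ m_b)) (λ {s} {t} _ _ → same s t)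
      (trans (sym (difference s)) (trans e (difference t)))
    where
    X : F → F
    X = choose x y
    Z : F → F
    Z = choose z w
    μ : F → F
    μ t = X (t ^ mₐ) - Z (t ^ m_b)
    difference : ∀ t → X (t ^ mₐ) * t - Z (t ^ m_b) * t ≡ μ t * t
    difference t = solve 3 (λ x z t → x :* t :- z :* t := (x :- z) :* t) refl (X (t ^ mₐ)) (Z (t ^ m_b)) t
    μ≢0 : ∀ u v → X u - Z v ≢ 0F
    μ≢0 u v = choose-ind (λ x → x - Z v ≢ 0F)
      (choose-ind (λ z → x - z ≢ 0F) (-‿≢0 x≢z) (-‿≢0 x≢w) v)
      (choose-ind (λ z → y - z ≢ 0F) (-‿≢0 y≢z) (-‿≢0 y≢w) v) u
    X∈ : ∀ u → X u ∈ x ∷ y ∷ []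
    X∈ = choose-ind (_∈ x ∷ y ∷ []) (here refl) (there (here refl))
    Z∈ : ∀ u → Z u ∈ z ∷ w ∷ []
    Z∈ = choose-ind (_∈ z ∷ w ∷ []) (here refl) (there (here refl))
    μ-class-b : ∀ u v → (X u - Z v) ^ m_b ≡ (X u - w) ^ m_b
    μ-class-b u = choose-ind (λ z → (X u - z) ^ m_b ≡ (X u - w) ^ m_b) (class_b (X∈ u)) refl
    same : ∀ s t → μ s * s ≡ μ t * t → μ s ≡ μ t
    same s t e = cong₂ _-_ Xs≡Xt (cong Z s~t)
      where
      Xs≡Xt : X (s ^ mₐ) ≡ X (t ^ mₐ)
      Xs≡Xt = cong X (cancel-class mₐ (μ≢0 (s ^ mₐ) (s ^ m_b))
        (trans (classₐ (X∈ (s ^ mₐ)) (Z∈ (s ^ m_b))) (sym (classₐ (X∈ (t ^ mₐ)) (Z∈ (t ^ m_b))))) e)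
      s~t : s ^ m_b ≡ t ^ m_b
      s~t = cancel-class m_b (μ≢0 (s ^ mₐ) (s ^ m_b))
        (trans (μ-class-b (s ^ mₐ) (s ^ m_b))
          (trans (cong (λ x → (x - w) ^ m_b) Xs≡Xt) (sym (μ-class-b (t ^ mₐ) (t ^ m_b))))) e

-- Multipliers from the pigeonhole principle

module LargeFields {q : ℕ} (K : FiniteField q) (g : FiniteField.F K)
                   (gen : FiniteField.IsGenerator K g) where
  open Cyclotomic K g gen public
  open ≡-Reasoning

  private
    place : ∀ {n} (L : List F) (f : F → Fin n) x → Dec (x ∈ L) → Fin (n ℕ.+ length L)
    place {n} L f x (yes x∈L) = n Fin.↑ʳ Any.index x∈L
    place L f x (no _)        = f x Fin.↑ˡ length L

    disjoint : ∀ {n} {L : List F} {i : Fin n} {j : Fin (length L)} → n Fin.↑ʳ j ≢ i Fin.↑ˡ length L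
    disjoint {n} {L} {i} {j} e = ℕP.<⇒≱ (FinP.toℕ<n i) (ℕP.≤-trans (ℕP.m≤m+n n (toℕ j)) (ℕP.≤-reflexive
      (trans (sym (FinP.toℕ-↑ʳ n j)) (trans (cong toℕ e) (FinP.toℕ-↑ˡ i (length L))))))

    place-≡ : ∀ {n} (L : List F) (f : F → Fin n) {x y} (x? : Dec (x ∈ L)) (y? : Dec (y ∈ L)) → x ≢ y →
              place L f x x? ≡ place L f y y? → x ∉ L × y ∉ L × f x ≡ f y
    place-≡ {n} L f (yes x∈L) (yes y∈L) x≢y e = contradiction
      (trans (lookup-index x∈L) (trans (cong (List.lookup L) (FinP.↑ʳ-injective n _ _ e)) (sym (lookup-index y∈L)))) x≢y
    place-≡ {n} L f (yes x∈L) (no _) _ e = contradiction e (disjoint {n} {L})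
    place-≡ {n} L f (no _) (yes y∈L) _ e = contradiction (sym e) (disjoint {n} {L})
    place-≡ L f (no x∉L) (no y∉L) _ e = x∉L , y∉L , FinP.↑ˡ-injective (length L) _ _ e

  -- Members of L get boxes of their own, so a collision can only occur outside L. Repetitions in L,
  -- such as 1 and -1 in characteristic 2, do no harm.
  pigeonhole-avoiding : ∀ {N n} (e : Fin N → F) → (∀ {i j} → e i ≡ e j → i ≡ j) →
    (L : List F) (f : F → Fin n) → n ℕ.+ length L < N →
    ∃₂ λ i j → e i ≢ e j × e i ∉ L × e j ∉ L × f (e i) ≡ f (e j)
  pigeonhole-avoiding e e-inj L f n<N = from-collision
    (FinP.pigeonhole n<N (λ i → place L f (e i) (e i ∈? L)))
    where
    open DecMembership _≟_ using (_∈?_)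
    from-collision : (∃₂ λ i j → i Fin.< j × place L f (e i) (e i ∈? L) ≡ place L f (e j) (e j ∈? L)) →
                     ∃₂ λ i j → e i ≢ e j × e i ∉ L × e j ∉ L × f (e i) ≡ f (e j)
    from-collision (i , j , i<j , eq) = i , j , ei≢ej , place-≡ L f (e i ∈? L) (e j ∈? L) ei≢ej eq
      where
      ei≢ej : e i ≢ e j
      ei≢ej ei≡ej = FinP.<⇒≢ i<j (e-inj ei≡ej)

  pigeonhole-field : ∀ {n} (L : List F) (f : F → Fin n) → n ℕ.+ length L < q →
    ∃₂ λ x y → x ≢ y × x ∉ L × y ∉ L × f x ≡ f y
  pigeonhole-field L f n<q =
    let i , j , rest = pigeonhole-avoiding decode decode-injective L f n<q
    in decode i , decode j , rest

  -1^even : ∀ {m} → 2 ∣ m → (- 1F) ^ m ≡ 1F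
  -1^even (divides e refl) = trans (cong ((- 1F) ^_) (ℕP.*-comm e 2)) (trans (^-* (- 1F) 2 e)
    (trans (cong (_^ e) (solve 0 ((:- con (1 , 0)) :* ((:- con (1 , 0)) :* con (1 , 0)) := con (1 , 0)) refl)) (1^ e)))

  -- As k is even, (-1)^m = (-1)^(m (k + 1)) = (-1)^(q - 1) = 1, in characteristic 2 as in any
  -- other.
  -1^odd-index : ∀ {m} k → m ℕ.* suc k ≡ q ∸ 1 → 2 ∣ k → (- 1F) ^ m ≡ 1F
  -1^odd-index {m} k mk 2∣k = begin
    (- 1F) ^ m                      ≡⟨ sym (*-identityʳ _) ⟩
    (- 1F) ^ m * 1F                 ≡⟨ cong ((- 1F) ^ m *_) (sym (-1^even (Div.∣n⇒∣m*n m 2∣k))) ⟩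
    (- 1F) ^ m * (- 1F) ^ (m ℕ.* k) ≡⟨ sym (^-+ (- 1F) m _) ⟩
    (- 1F) ^ (m ℕ.+ m ℕ.* k)        ≡⟨ cong ((- 1F) ^_) (trans (sym (ℕP.*-suc m k)) mk) ⟩
    (- 1F) ^ (q ∸ 1)                ≡⟨ fermat (λ e → 1≢0 (trans (sym (-‿involutive 1F)) (trans (cong -_ e) -0#≈0#))) ⟩
    1F                              ∎

  module _ (m k : ℕ) .{{_ : NonZero k}} (mk : m ℕ.* k ≡ q ∸ 1) where

    private
      class : F → Fin k
      class = coset k

    same-class : ∀ {x y} → x ≢ 0F → y ≢ 0F → class x ≡ class y → x ^ m ≡ y ^ m
    same-class = coset-≡ m k mk

    sameType-exists : k ℕ.* k ℕ.+ 2 < q → ∃₂ λ x y → SameType m x y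
    sameType-exists large =
      let x , y , x≢y , x∉ , y∉ , e =
            pigeonhole-field (0F ∷ 1F ∷ []) (λ x → Fin.combine (class x) (class (x - 1F))) large
      in x , y , same-box x≢y x∉ y∉ e
      where
      same-box : ∀ {x y} → x ≢ y → x ∉ 0F ∷ 1F ∷ [] → y ∉ 0F ∷ 1F ∷ [] →
        Fin.combine (class x) (class (x - 1F)) ≡ Fin.combine (class y) (class (y - 1F)) → SameType m x y
      same-box {x} {y} x≢y x∉ y∉ e = record
        { x≢y = x≢y ; x≢0 = x≢0 ; y≢0 = y≢0 ; x≢1 = x≢1 ; y≢1 = y≢1
        ; x~y = same-class x≢0 y≢0 (proj₁ split)
        ; x-1~y-1 = same-class (-‿≢0 x≢1) (-‿≢0 y≢1) (proj₂ split) }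
        where
        split = FinP.combine-injective (class x) (class (x - 1F)) (class y) (class (y - 1F)) e
        x≢0 : x ≢ 0F
        x≢0 x≡0 = x∉ (here x≡0)
        y≢0 : y ≢ 0F
        y≢0 y≡0 = y∉ (here y≡0)
        x≢1 : x ≢ 1F
        x≢1 x≡1 = x∉ (there (here x≡1))
        y≢1 : y ≢ 1F
        y≢1 y≡1 = y∉ (there (here y≡1))

    -- The second map exchanges the two multipliers, so the differences x - y and y - x only have to
    -- agree up to the factor -1.
    swapped-pair : (- 1F) ^ m ≡ 1F → ∀ {x y} → SameType m x y → OrthogonalPair k k
    swapped-pair -1~1 {x} {y} xy = equal-index-pair m k mk xy (sameType-sym xy) x≢y (≢-sym x≢y) (begin
      (x - y) ^ m            ≡⟨ cong (_^ m) (solve 2 (λ x y → x :- y := (:- con (1 , 0)) :* (y :- x)) refl x y) ⟩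
      (- 1F * (y - x)) ^ m   ≡⟨ *-^ (- 1F) (y - x) m ⟩
      (- 1F) ^ m * (y - x) ^ m  ≡⟨ cong (_* (y - x) ^ m) -1~1 ⟩
      1F * (y - x) ^ m       ≡⟨ *-identityˡ _ ⟩
      (y - x) ^ m            ∎)
      where open SameType xy

    -- The second map takes z = 1/x and w = 1/y: the classes of z, z - 1 and x - z are
    -- functions of those of x, x - 1 and x + 1.
    reciprocal-pair : k ℕ.* (k ℕ.* k) ℕ.+ 3 < q → OrthogonalPair k k
    reciprocal-pair large =
      let _ , _ , x≢y , x∉ , y∉ , e = pigeonhole-field excluded box large in from-collision x≢y x∉ y∉ e
      where
      excluded : List F
      excluded = 0F ∷ 1F ∷ - 1F ∷ []
      box : F → Fin (k ℕ.* (k ℕ.* k))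
      box x = Fin.combine (class x) (Fin.combine (class (x - 1F)) (class (x + 1F)))
      from-collision : ∀ {x y} → x ≢ y → x ∉ excluded → y ∉ excluded → box x ≡ box y → OrthogonalPair k k
      from-collision {x} {y} x≢y x∉ y∉ e = equal-index-pair m k mk
        (record { x≢y = x≢y ; x≢0 = nonzero x∉ ; y≢0 = nonzero y∉ ; x≢1 = nonone x∉ ; y≢1 = nonone y∉
                ; x~y = x~y ; x-1~y-1 = x-1~y-1 })
        (record { x≢y = λ e → x≢y (inv-injective e)
                ; x≢0 = inv-≢0 (nonzero x∉) ; y≢0 = inv-≢0 (nonzero y∉)
                ; x≢1 = inv-≢1 x∉ ; y≢1 = inv-≢1 y∉
                ; x~y = ratio (*-inv (nonzero x∉)) (*-inv (nonzero y∉)) refl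
                ; x-1~y-1 = ratio (inv-minus-1 x∉) (inv-minus-1 y∉) (negated x-1~y-1) })
        (inv-≢ x∉) (inv-≢ y∉)
        (ratio (minus-inv x∉) (minus-inv y∉)
          (trans (*-^ _ _ m) (trans (cong₂ _*_ x-1~y-1 x+1~y+1) (sym (*-^ _ _ m)))))
        where
        nonzero : ∀ {x} → x ∉ excluded → x ≢ 0F
        nonzero x∉ e = x∉ (here e)
        nonone : ∀ {x} → x ∉ excluded → x ≢ 1F
        nonone x∉ e = x∉ (there (here e))
        x+1≢0 : ∀ {x} → x ∉ excluded → x + 1F ≢ 0F
        x+1≢0 {x} x∉ e = x∉ (there (there (here (-‿≡0 (trans (cong (x +_) (-‿involutive 1F)) e)))))
        split = FinP.combine-injective (class x) _ (class y) _ e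
        split′ = FinP.combine-injective (class (x - 1F)) (class (x + 1F)) (class (y - 1F)) (class (y + 1F)) (proj₂ split)
        x~y : x ^ m ≡ y ^ m
        x~y = same-class (nonzero x∉) (nonzero y∉) (proj₁ split)
        x-1~y-1 : (x - 1F) ^ m ≡ (y - 1F) ^ m
        x-1~y-1 = same-class (-‿≢0 (nonone x∉)) (-‿≢0 (nonone y∉)) (proj₁ split′)
        x+1~y+1 : (x + 1F) ^ m ≡ (y + 1F) ^ m
        x+1~y+1 = same-class (x+1≢0 x∉) (x+1≢0 y∉) (proj₂ split′)
        inv-≢1 : ∀ {x} → x ∉ excluded → inv x ≢ 1F
        inv-≢1 {x} x∉ e = nonone x∉ (trans (sym (*-identityʳ x)) (trans (cong (x *_) (sym e)) (*-inv (nonzero x∉))))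
        minus-inv : ∀ {x} → x ∉ excluded → x * (x - inv x) ≡ (x - 1F) * (x + 1F)
        minus-inv {x} x∉ = begin
          x * (x - inv x)        ≡⟨ solve 2 (λ x i → x :* (x :- i) := x :* x :- x :* i) refl x (inv x) ⟩
          x * x - x * inv x      ≡⟨ cong (λ z → x * x - z) (*-inv (nonzero x∉)) ⟩
          x * x - 1F             ≡⟨ solve 1 (λ x → x :* x :- con (1 , 0) := (x :- con (1 , 0)) :* (x :+ con (1 , 0))) refl x ⟩
          (x - 1F) * (x + 1F)    ∎
        inv-≢ : ∀ {x} → x ∉ excluded → x ≢ inv x
        inv-≢ {x} x∉ e = *-≢0 (-‿≢0 (nonone x∉)) (x+1≢0 x∉) (trans (sym (minus-inv x∉))
          (trans (cong (λ z → x * (x - z)) (sym e)) (solve 1 (λ x → x :* (x :- x) := con (0 , 0)) refl x)))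
        inv-minus-1 : ∀ {x} → x ∉ excluded → x * (inv x - 1F) ≡ - 1F * (x - 1F)
        inv-minus-1 {x} x∉ = begin
          x * (inv x - 1F)  ≡⟨ solve 2 (λ x i → x :* (i :- con (1 , 0)) := x :* i :- x) refl x (inv x) ⟩
          x * inv x - x     ≡⟨ cong (_- x) (*-inv (nonzero x∉)) ⟩
          1F - x            ≡⟨ solve 1 (λ x → con (1 , 0) :- x := (:- con (1 , 0)) :* (x :- con (1 , 0))) refl x ⟩
          - 1F * (x - 1F)   ∎
        -- The factor -1 occurs for x and y alike and cancels; this lets the construction serve the
        -- cases in which -1 is not a k-th power.
        negated : ∀ {u v} → u ^ m ≡ v ^ m → (- 1F * u) ^ m ≡ (- 1F * v) ^ m
        negated e = trans (*-^ _ _ m) (trans (cong (_ *_) e) (sym (*-^ _ _ m)))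
        ratio : ∀ {u v c d} → x * u ≡ c → y * v ≡ d → c ^ m ≡ d ^ m → u ^ m ≡ v ^ m
        ratio {u} {v} xu yv c~d = *-cancelˡ (^-≢0 m (nonzero x∉)) (begin
          x ^ m * u ^ m  ≡⟨ sym (*-^ x u m) ⟩
          (x * u) ^ m    ≡⟨ trans (cong (_^ m) xu) (trans c~d (cong (_^ m) (sym yv))) ⟩
          (y * v) ^ m    ≡⟨ *-^ y v m ⟩
          y ^ m * v ^ m  ≡⟨ cong (_* v ^ m) (sym x~y) ⟩
          x ^ m * v ^ m  ∎)

  coarsen : ∀ {M c} m k .{{_ : NonZero k}} → M ℕ.* c ≡ q ∸ 1 → m ℕ.* k ≡ q ∸ 1 → k ∣ c →
            ∀ {u v} → u ^ M ≡ v ^ M → u ^ m ≡ v ^ m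
  coarsen {M} {c} m k Mc mk (divides e refl) {u} {v} uv = begin
    u ^ m            ≡⟨ cong (u ^_) m≡M*e ⟩
    u ^ (M ℕ.* e)    ≡⟨ ^-* u M e ⟩
    (u ^ M) ^ e      ≡⟨ cong (_^ e) uv ⟩
    (v ^ M) ^ e      ≡⟨ sym (^-* v M e) ⟩
    v ^ (M ℕ.* e)    ≡⟨ cong (v ^_) (sym m≡M*e) ⟩
    v ^ m            ∎
    where
    m≡M*e : m ≡ M ℕ.* e
    m≡M*e = ℕP.*-cancelʳ-≡ m (M ℕ.* e) k (trans mk (trans (sym Mc) (sym (ℕP.*-assoc M e k))))

  -- z and w are fixed first; the candidates for x and y are then the (q - 1) / c - 1 points
  -- w + (z - w) / (1 - r) with r ≢ 1 a c-th power, at which (x - z) / (x - w) = r.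
  module Mixed (a b c mₐ m_b M : ℕ) .{{_ : NonZero a}} .{{_ : NonZero b}} .{{_ : NonZero c}}
               (a∣c : a ∣ c) (b∣c : b ∣ c)
               (ma : mₐ ℕ.* a ≡ q ∸ 1) (mb : m_b ℕ.* b ≡ q ∸ 1) (Mc : M ℕ.* c ≡ q ∸ 1) where

    private
      toA : ∀ {u v} → u ^ M ≡ v ^ M → u ^ mₐ ≡ v ^ mₐ
      toA = coarsen {M} mₐ a Mc ma a∣c

      toB : ∀ {u v} → u ^ M ≡ v ^ M → u ^ m_b ≡ v ^ m_b
      toB = coarsen {M} m_b b Mc mb b∣c

      class : F → Fin a
      class = coset a

      module Candidates {z w : F} (zw : SameType M z w) where
        open SameType zw renaming (x≢y to z≢w)

        r : Fin M → F
        r i = g ^ (toℕ i ℕ.* c)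

        point : Fin M → F
        point i = w + (z - w) * inv (1F - r i)

        point-injective : ∀ {i j} → point i ≡ point j → i ≡ j
        point-injective {i} {j} e = FinP.toℕ-injective (ℕP.*-cancelʳ-≡ (toℕ i) (toℕ j) c
          (g^-injective (bound i) (bound j) r≡))
          where
          bound : ∀ i → toℕ i ℕ.* c < q ∸ 1
          bound i = ℕP.<-≤-trans (ℕP.*-monoˡ-< c (FinP.toℕ<n i)) (ℕP.≤-reflexive Mc)
          1-r≡ : 1F - r i ≡ 1F - r j
          1-r≡ = inv-injective (*-cancelˡ (-‿≢0 z≢w) (+-cancelʳ w (trans (+-comm _ w) (trans e (+-comm w _)))))
          r≡ : r i ≡ r j
          r≡ = trans (sym (-‿involutive (r i))) (trans (cong -_ (+-cancelʳ 1F
                 (trans (+-comm _ 1F) (trans 1-r≡ (+-comm 1F _))))) (-‿involutive (r j)))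

        -- Index 0 has r = 1, and there the convention `inv 0F ≡ 0F` turns the point into w. Staying
        -- away from w is thus what makes 1 - r invertible.
        module _ (i : Fin M) (≢w : point i ≢ w) where
          private
            x = point i

            1-r≢0 : 1F - r i ≢ 0F
            1-r≢0 e = ≢w (trans (cong (λ d → w + (z - w) * d) (trans (cong inv e) inv-0))
              (solve 2 (λ w z → w :+ (z :- w) :* con (0 , 0) := w) refl w z))

          point-ratio : x - z ≡ r i * (x - w)
          point-ratio = begin
            (w + (z - w) * d) - z
              ≡⟨ solve 3 (λ w z d → (w :+ (z :- w) :* d) :- z := (z :- w) :* (d :- con (1 , 0))) refl w z d ⟩
            (z - w) * (d - 1F)
              ≡⟨ cong (λ o → (z - w) * (d - o)) (sym (*-inv 1-r≢0)) ⟩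
            (z - w) * (d - (1F - r i) * d)
              ≡⟨ solve 4 (λ w z d r → (z :- w) :* (d :- (con (1 , 0) :- r) :* d) := r :* ((w :+ (z :- w) :* d) :- w))
                   refl w z d (r i) ⟩
            r i * ((w + (z - w) * d) - w)  ∎
            where d = inv (1F - r i)

          point≢z : x ≢ z
          point≢z e = *-≢0 (^-≢0 (toℕ i ℕ.* c) g≢0) (-‿≢0 ≢w) (trans (sym point-ratio) (trans (cong (_- z) e) (-‿inverseʳ z)))

          point-class : (x - z) ^ M ≡ (x - w) ^ M
          point-class = begin
            (x - z) ^ M              ≡⟨ cong (_^ M) point-ratio ⟩
            (r i * (x - w)) ^ M      ≡⟨ *-^ (r i) (x - w) M ⟩
            r i ^ M * (x - w) ^ M    ≡⟨ cong (λ y → y ^ M * (x - w) ^ M) (^-* g (toℕ i) c) ⟩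
            ((g ^ toℕ i) ^ c) ^ M * (x - w) ^ M  ≡⟨ cong (_* (x - w) ^ M) (pow-k-class M c Mc (^-≢0 (toℕ i) g≢0)) ⟩
            1F * (x - w) ^ M         ≡⟨ *-identityˡ _ ⟩
            (x - w) ^ M              ∎

    mixed-pair : c ℕ.* c ℕ.+ 2 < q → a ℕ.* (a ℕ.* a) ℕ.+ 3 < M → OrthogonalPair a b
    mixed-pair large-q large-M =
      let _ , w , zw = sameType-exists M c Mc large-q
          i , j , x≢y , x∉ , y∉ , e = pigeonhole-avoiding (Candidates.point zw) (Candidates.point-injective zw)
                                        (excluded w) (box w) large-M
      in from-collision zw i j x≢y x∉ y∉ e
      where
      excluded : F → List F
      excluded w = 0F ∷ 1F ∷ w ∷ []
      -- Three cosets of a-th powers suffice: (x - z) / (x - w) is a c-th power by the choice of the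
      -- candidates, which settles x - z and the condition on b-th powers.
      box : F → F → Fin (a ℕ.* (a ℕ.* a))
      box w x = Fin.combine (class x) (Fin.combine (class (x - 1F)) (class (x - w)))
      from-collision : ∀ {z w} (zw : SameType M z w) i j → let open Candidates zw in
        point i ≢ point j → point i ∉ excluded w → point j ∉ excluded w →
        box w (point i) ≡ box w (point j) → OrthogonalPair a b
      from-collision {z} {w} zw i j x≢y x∉ y∉ e = mixed-index-pair mₐ a m_b b ma mb
          (record { x≢y = x≢y ; x≢0 = λ e → x∉ (here e) ; y≢0 = λ e → y∉ (here e) ; x≢1 = x≢1 ; y≢1 = y≢1
                  ; x~y = coset-≡ mₐ a ma (λ e → x∉ (here e)) (λ e → y∉ (here e)) (proj₁ split)
                  ; x-1~y-1 = coset-≡ mₐ a ma (-‿≢0 x≢1) (-‿≢0 y≢1) (proj₁ split′) })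
          (record { x≢y = z≢w ; x≢0 = z≢0 ; y≢0 = w≢0 ; x≢1 = z≢1 ; y≢1 = w≢1
                  ; x~y = toB z~w ; x-1~y-1 = toB z-1~w-1 })
          (point≢z i x≢w) x≢w (point≢z j y≢w) y≢w
          classₐ
          (λ { (here refl) → toB (point-class i x≢w) ; (there (here refl)) → toB (point-class j y≢w) })
        where
        open Candidates zw
        open SameType zw renaming (x≢y to z≢w; x≢0 to z≢0; y≢0 to w≢0; x≢1 to z≢1; y≢1 to w≢1; x~y to z~w; x-1~y-1 to z-1~w-1)
        x = point i
        y = point j
        x≢1 : x ≢ 1F
        x≢1 e = x∉ (there (here e))
        y≢1 : y ≢ 1F
        y≢1 e = y∉ (there (here e))
        x≢w : x ≢ w
        x≢w e = x∉ (there (there (here e)))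
        y≢w : y ≢ w
        y≢w e = y∉ (there (there (here e)))
        split = FinP.combine-injective (class x) _ (class y) _ e
        split′ = FinP.combine-injective (class (x - 1F)) (class (x - w)) (class (y - 1F)) (class (y - w)) (proj₂ split)
        x-w~y-w : (x - w) ^ mₐ ≡ (y - w) ^ mₐ
        x-w~y-w = coset-≡ mₐ a ma (-‿≢0 x≢w) (-‿≢0 y≢w) (proj₂ split′)
        classₐ : ∀ {u v} → u ∈ x ∷ y ∷ [] → v ∈ z ∷ w ∷ [] → (u - v) ^ mₐ ≡ (y - w) ^ mₐ
        classₐ (here refl) (here refl)                 = trans (toA (point-class i x≢w)) x-w~y-w
        classₐ (here refl) (there (here refl))         = x-w~y-w
        classₐ (there (here refl)) (here refl)         = toA (point-class j y≢w)
        classₐ (there (here refl)) (there (here refl)) = refl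

-- Quadratic extensions of ℤ/p

-- (a , b) stands for a + b u in (ℤ/p)[u] with u² = n + e u. Elements are kept reduced only
-- by the operations; prime fields are the case n = e = 0, in which u is sent to 0.
module QuadraticRing (p n e : ℕ) .{{_ : NonZero p}} where
  R : Set
  R = ℕ × ℕ

  infix 4 _≟R_
  infixl 6 _⊖_
  infixl 7 _⊗_

  _≟R_ : (x y : R) → Dec (x ≡ y)
  _≟R_ = ≡-dec ℕ._≟_ ℕ._≟_

  0R 1R : R
  0R = 0 , 0
  1R = 1 , 0

  _⊗_ _⊖_ : R → R → R
  (a , b) ⊗ (c , d) = (a ℕ.* c ℕ.+ n ℕ.* (b ℕ.* d)) % p , (a ℕ.* d ℕ.+ b ℕ.* c ℕ.+ e ℕ.* (b ℕ.* d)) % p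
  (a , b) ⊖ (c , d) = (a ℕ.+ (p ∸ 1) ℕ.* c) % p , (b ℕ.+ (p ∸ 1) ℕ.* d) % p

  pow : R → ℕ → R
  pow x zero    = 1R
  pow x (suc m) = x ⊗ pow x m

  module Evaluation {q : ℕ} (K : FiniteField q) (ιp≡0 : Field.ι K p ≡ FiniteField.0F K)
                    (u : FiniteField.F K) (u²≡n+eu : Field.QuadraticRoot K n e u) where
    open Field K
    open Modulo p ιp≡0
    open ≡-Reasoning

    φ : R → F
    φ (a , b) = ι a + ι b * u

    φ-0 : φ 0R ≡ 0F
    φ-0 = solve 1 (λ u → con (0 , 0) :+ con (0 , 0) :* u := con (0 , 0)) refl u

    φ-1 : φ 1R ≡ 1F
    φ-1 = solve 1 (λ u → con (1 , 0) :+ con (0 , 0) :* u := con (1 , 0)) refl u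

    φ-⊗ : ∀ x y → φ (x ⊗ y) ≡ φ x * φ y
    φ-⊗ (a , b) (c , d) = begin
      ι ((a ℕ.* c ℕ.+ n ℕ.* (b ℕ.* d)) % p) + ι ((a ℕ.* d ℕ.+ b ℕ.* c ℕ.+ e ℕ.* (b ℕ.* d)) % p) * u
        ≡⟨ cong₂ (λ s t → s + t * u)
             (trans (ι-% _) (trans (ι-+ (a ℕ.* c) _) (cong₂ _+_ (ι-* a c) (trans (ι-* n _) (cong (ι n *_) (ι-* b d))))))
             (trans (ι-% _) (trans (ι-+ (a ℕ.* d ℕ.+ b ℕ.* c) _) (cong₂ _+_
               (trans (ι-+ (a ℕ.* d) _) (cong₂ _+_ (ι-* a d) (ι-* b c)))
               (trans (ι-* e _) (cong (ι e *_) (ι-* b d)))))) ⟩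
      (ι a * ι c + ι n * (ι b * ι d)) + (ι a * ι d + ι b * ι c + ι e * (ι b * ι d)) * u
        ≡⟨ solve 7 (λ a b c d n e u → (a :* c :+ n :* (b :* d)) :+ (a :* d :+ b :* c :+ e :* (b :* d)) :* u
             := a :* c :+ (a :* d :+ b :* c) :* u :+ (b :* d) :* (n :+ e :* u)) refl
             (ι a) (ι b) (ι c) (ι d) (ι n) (ι e) u ⟩
      ι a * ι c + (ι a * ι d + ι b * ι c) * u + (ι b * ι d) * (ι n + ι e * u)
        ≡⟨ cong (λ z → ι a * ι c + (ι a * ι d + ι b * ι c) * u + (ι b * ι d) * z) (sym u²≡n+eu) ⟩
      ι a * ι c + (ι a * ι d + ι b * ι c) * u + (ι b * ι d) * (u * u)
        ≡⟨ solve 5 (λ a b c d u → a :* c :+ (a :* d :+ b :* c) :* u :+ (b :* d) :* (u :* u)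
             := (a :+ b :* u) :* (c :+ d :* u)) refl (ι a) (ι b) (ι c) (ι d) u ⟩
      (ι a + ι b * u) * (ι c + ι d * u)  ∎

    φ-⊖ : ∀ x y → φ (x ⊖ y) ≡ φ x - φ y
    φ-⊖ (a , b) (c , d) = begin
      ι ((a ℕ.+ (p ∸ 1) ℕ.* c) % p) + ι ((b ℕ.+ (p ∸ 1) ℕ.* d) % p) * u
        ≡⟨ cong₂ (λ s t → s + t * u) (minus a c) (minus b d) ⟩
      (ι a + - 1F * ι c) + (ι b + - 1F * ι d) * u
        ≡⟨ solve 5 (λ a b c d u → (a :+ (:- con (1 , 0)) :* c) :+ (b :+ (:- con (1 , 0)) :* d) :* u
             := (a :+ b :* u) :- (c :+ d :* u)) refl (ι a) (ι b) (ι c) (ι d) u ⟩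
      (ι a + ι b * u) - (ι c + ι d * u)  ∎
      where
      minus : ∀ a c → ι ((a ℕ.+ (p ∸ 1) ℕ.* c) % p) ≡ ι a + - 1F * ι c
      minus a c = trans (ι-% _) (trans (ι-+ a _) (cong (ι a +_) (trans (ι-* (p ∸ 1) c) (cong (_* ι c) ι[p-1]))))

    φ-pow : ∀ x m → φ (pow x m) ≡ φ x ^ m
    φ-pow x zero    = φ-1
    φ-pow x (suc m) = trans (φ-⊗ x (pow x m)) (cong (φ x *_) (φ-pow x m))

-- Verification of explicit multipliers

module Certificate (p n : ℕ) .{{_ : NonZero p}} (a b c M : ℕ) .{{_ : NonZero a}} .{{_ : NonZero b}} where
  open QuadraticRing p n 0 public

  -- As M c = q - 1 and 0^(q-1) = 0, this equation makes the image of x nonzero; applied to x ⊖ y it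
  -- certifies that two images differ. Taking the power in two stages shortens the computation.
  Unit : R → Set
  Unit x = pow (pow x M) c ≡ 1R

  unit? : ∀ x → Dec (Unit x)
  unit? x = pow (pow x M) c ≟R 1R

  at : List R → ℕ → R
  at []       _       = 0R
  at (x ∷ xs) zero    = x
  at (x ∷ xs) (suc i) = at xs i

  module _ (ρ : R) where
    ζ : R
    ζ = pow ρ M

    -- Says that ζ has exact order c in the field, so that the powers of ρ represent all cosets of
    -- the c-th powers.
    ProperRoot : Set
    ProperRoot = Unit ρ × (∀ {i} → i < c ∸ 1 → Unit (pow ζ (suc i) ⊖ 1R))

    value : (ℕ → R) → ℕ → R
    value f i = pow (f i) M ⊗ pow ζ i

    -- Multiplication by f i on the i-th coset of the c-th powers permutes the cosets.
    Separated : (ℕ → R) → Set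
    Separated f = (∀ {i} → i < c → Unit (f i)) ×
                  (∀ {i} → i < c → ∀ {j} → j < i → Unit (value f i ⊖ value f j))

    -- Every shift by 1, ..., k - 1 changes some multiplier, which excludes each smaller index.
    Aperiodic : ℕ → (ℕ → R) → Set
    Aperiodic k f = ∀ {ℓ} → ℓ < k ∸ 1 → ∃ λ i → i < k × Unit (f (suc ℓ ℕ.+ i) ⊖ f i)

    multiplier : ∀ k .{{_ : NonZero k}} → List R → ℕ → R
    multiplier k xs i = at xs (i % k)

    Admissible : ∀ k .{{_ : NonZero k}} → List R → Set
    Admissible k xs = Separated (multiplier k xs) × Separated (λ i → multiplier k xs i ⊖ 1R) ×
                      Aperiodic k (multiplier k xs)

    Valid : List R → List R → Set
    Valid xs ys = ProperRoot × Admissible a xs × Admissible b ys ×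
                  Separated (λ i → multiplier a xs i ⊖ multiplier b ys i)

    valid? : ∀ xs ys → Dec (Valid xs ys)
    valid? xs ys =
      (unit? ρ ×-dec ℕP.allUpTo? (λ i → unit? (pow ζ (suc i) ⊖ 1R)) (c ∸ 1)) ×-dec
      admissible? a xs ×-dec admissible? b ys ×-dec
      separated? (λ i → multiplier a xs i ⊖ multiplier b ys i)
      where
      separated? : ∀ f → Dec (Separated f)
      separated? f = ℕP.allUpTo? (λ i → unit? (f i)) c ×-dec
        ℕP.allUpTo? (λ i → ℕP.allUpTo? (λ j → unit? (value f i ⊖ value f j)) i) c
      admissible? : ∀ k .{{_ : NonZero k}} xs → Dec (Admissible k xs)
      admissible? k xs = separated? (multiplier k xs) ×-dec separated? (λ i → multiplier k xs i ⊖ 1R) ×-dec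
        ℕP.allUpTo? (λ ℓ → ℕP.anyUpTo? (λ i → unit? (multiplier k xs (suc ℓ ℕ.+ i) ⊖ multiplier k xs i)) k) (k ∸ 1)

  module Soundness {q : ℕ} (K : FiniteField q) (g : FiniteField.F K) (gen : FiniteField.IsGenerator K g) where
    open Cyclotomic K g gen
    open ≡-Reasoning

    module _ (ιp≡0 : ι p ≡ 0F) (u : F) (u²≡n : QuadraticRoot n 0 u) .{{_ : NonZero c}}
             (a∣c : a ∣ c) (b∣c : b ∣ c) (Mc : M ℕ.* c ≡ q ∸ 1) where
      open Evaluation K ιp≡0 u u²≡n

      φ-unit : ∀ x → Unit x → φ x ≢ 0F
      φ-unit x unit φx≡0 = 1≢0 (begin
        1F                     ≡⟨ sym φ-1 ⟩
        φ 1R                   ≡⟨ cong φ (sym unit) ⟩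
        φ (pow (pow x M) c)    ≡⟨ trans (φ-pow (pow x M) c) (cong (_^ c) (φ-pow x M)) ⟩
        (φ x ^ M) ^ c          ≡⟨ trans (sym (^-* (φ x) M c)) (cong (φ x ^_) Mc) ⟩
        φ x ^ (q ∸ 1)          ≡⟨ cong (_^ (q ∸ 1)) φx≡0 ⟩
        0F ^ (q ∸ 1)           ≡⟨ 0^ 0<q-1 ⟩
        0F                     ∎)

      φ-unit-⊖ : ∀ x y → Unit (x ⊖ y) → φ x ≢ φ y
      φ-unit-⊖ x y unit e = φ-unit (x ⊖ y) unit (trans (φ-⊖ x y) (trans (cong (_- φ y) e) (-‿inverseʳ (φ y))))

      module _ (ρ : R) (root : ProperRoot ρ) where
        private
          r : F
          r = φ ρ

          r≢0 : r ≢ 0F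
          r≢0 = φ-unit ρ (proj₁ root)

          z : F
          z = r ^ M

          φζ : ∀ i → φ (pow (ζ ρ) i) ≡ z ^ i
          φζ i = trans (φ-pow (ζ ρ) i) (cong (_^ i) (φ-pow ρ M))

          z^c≡1 : z ^ c ≡ 1F
          z^c≡1 = trans (sym (^-* r M c)) (trans (cong (r ^_) Mc) (fermat r≢0))

          z^≢1 : ∀ i → 0 < i → i < c → z ^ i ≢ 1F
          z^≢1 (suc i) _ i<c e = φ-unit-⊖ (pow (ζ ρ) (suc i)) 1R (proj₂ root (ℕP.∸-monoˡ-≤ 1 i<c))
            (trans (φζ (suc i)) (trans e (sym φ-1)))

          z^-< : ∀ {i j} → i < j → j < c → z ^ i ≢ z ^ j
          z^-< {i} {j} i<j j<c e = z^≢1 (j ∸ i) (ℕP.m<n⇒0<n∸m i<j) (ℕP.≤-<-trans (ℕP.m∸n≤m j i) j<c)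
            (*-cancelˡ (^-≢0 i (^-≢0 M r≢0)) (trans (sym (^-+ z i (j ∸ i)))
              (trans (cong (z ^_) (ℕP.m+[n∸m]≡n (ℕP.<⇒≤ i<j))) (trans (sym e) (sym (*-identityʳ _))))))

          z^-injective : ∀ {i j} → i < c → j < c → z ^ i ≡ z ^ j → i ≡ j
          z^-injective {i} {j} i<c j<c e with ℕP.<-cmp i j
          ... | tri< i<j _ _ = contradiction e (z^-< i<j j<c)
          ... | tri≈ _ i≡j _ = i≡j
          ... | tri> _ _ j<i = contradiction (sym e) (z^-< j<i i<c)

          abstract
            -- The elements r^0, ..., r^(c-1) lie in different cosets because z = r^M has order c,
            -- so they meet all c of them. This replaces the numbering of cosets by powers of g with
            -- the one by powers of ρ on which the certificates rely.
            class-exists : ∀ y → ∃ λ (i : Fin c) → coset c (r ^ toℕ i) ≡ coset c y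
            class-exists y = fin-injective⇒surjective (λ i → coset c (r ^ toℕ i)) inj (coset c y)
              where
              inj : ∀ {i j : Fin c} → coset c (r ^ toℕ i) ≡ coset c (r ^ toℕ j) → i ≡ j
              inj {i} {j} e = FinP.toℕ-injective (z^-injective (FinP.toℕ<n i) (FinP.toℕ<n j) (begin
                z ^ toℕ i            ≡⟨ ^-comm r M (toℕ i) ⟩
                (r ^ toℕ i) ^ M      ≡⟨ coset-≡ M c Mc (^-≢0 (toℕ i) r≢0) (^-≢0 (toℕ j) r≢0) e ⟩
                (r ^ toℕ j) ^ M      ≡⟨ ^-comm r (toℕ j) M ⟩
                z ^ toℕ j            ∎))

          class : F → ℕ
          class y = toℕ (proj₁ (class-exists y))

          class<c : ∀ y → class y < c
          class<c y = FinP.toℕ<n (proj₁ (class-exists y))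

          class-spec : ∀ {y} → y ≢ 0F → y ^ M ≡ z ^ class y
          class-spec {y} y≢0 = trans (sym (coset-≡ M c Mc (^-≢0 (class y) r≢0) y≢0 (proj₂ (class-exists y))))
            (^-comm r (class y) M)

          class-unique : ∀ {y} i → y ≢ 0F → y ^ M ≡ z ^ i → class y ≡ i % c
          class-unique {y} i y≢0 e = z^-injective (class<c y) (m%n<n i c)
            (trans (sym (class-spec y≢0)) (trans e (sym (^-% z c z^c≡1 i))))

          class-r^ : ∀ i → class (r ^ i) ≡ i % c
          class-r^ i = class-unique i (^-≢0 i r≢0) (^-comm r i M)

          Map : (ℕ → R) → F → F
          Map f y = φ (f (class y)) * y

          -- The M-th power of an image equals the image of `value` at the class of the argument.
          -- These being pairwise different, the class can be recovered.
          separated-injective : ∀ f → Separated ρ f → ∀ {s t} → Map f s ≡ Map f t → s ≡ t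
          separated-injective f (units , distinct) = scaling-injective
            (λ {s} _ → φ-unit (f (class s)) (units (class<c s))) same
            where
            φ-value : ∀ {s} → s ≢ 0F → φ (value ρ f (class s)) ≡ Map f s ^ M
            φ-value {s} s≢0 = begin
              φ (pow (f (class s)) M ⊗ pow (ζ ρ) (class s))
                ≡⟨ trans (φ-⊗ (pow (f (class s)) M) (pow (ζ ρ) (class s))) (cong₂ _*_ (φ-pow (f (class s)) M) (φζ (class s))) ⟩
              φ (f (class s)) ^ M * z ^ class s  ≡⟨ cong (φ (f (class s)) ^ M *_) (sym (class-spec s≢0)) ⟩
              φ (f (class s)) ^ M * s ^ M        ≡⟨ sym (*-^ (φ (f (class s))) s M) ⟩
              Map f s ^ M                        ∎
            same : ∀ {s t} → s ≢ 0F → t ≢ 0F → Map f s ≡ Map f t → φ (f (class s)) ≡ φ (f (class t))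
            same {s} {t} s≢0 t≢0 e with ℕP.<-cmp (class s) (class t)
            ... | tri≈ _ i≡j _ = cong (λ i → φ (f i)) i≡j
            ... | tri< i<j _ _ = contradiction (trans (φ-value t≢0) (trans (cong (_^ M) (sym e)) (sym (φ-value s≢0))))
                                   (φ-unit-⊖ (value ρ f (class t)) (value ρ f (class s)) (distinct (class<c t) i<j))
            ... | tri> _ _ j<i = contradiction (trans (φ-value s≢0) (trans (cong (_^ M) e) (sym (φ-value t≢0))))
                                   (φ-unit-⊖ (value ρ f (class s)) (value ρ f (class t)) (distinct (class<c s) j<i))

          Map-⊖ : ∀ f h y → Map (λ i → f i ⊖ h i) y ≡ Map f y - Map h y
          Map-⊖ f h y = trans (cong (_* y) (φ-⊖ (f (class y)) (h (class y))))
            (solve 3 (λ f h y → (f :- h) :* y := f :* y :- h :* y) refl _ _ y)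

          Map-⊖1 : ∀ f y → Map (λ i → f i ⊖ 1R) y ≡ Map f y - y
          Map-⊖1 f y = trans (Map-⊖ f (λ _ → 1R) y)
            (cong (λ w → Map f y - w) (trans (cong (_* y) φ-1) (*-identityˡ y)))

          module _ (k : ℕ) .{{_ : NonZero k}} (k∣c : k ∣ c) (xs : List R) (adm : Admissible ρ k xs) where
            f : ℕ → R
            f = multiplier ρ k xs

            f-cong : ∀ {i j} → i % k ≡ j % k → f i ≡ f j
            f-cong = cong (at xs)

            f-%c : ∀ i → f (i % c) ≡ f i
            f-%c i = f-cong (m∣n⇒o%n%m≡o%m k c i k∣c)

            class-shift : ∀ {h y} → h ≢ 0F → y ≢ 0F → f (class (h ^ k * y)) ≡ f (class y)
            class-shift {h} {y} h≢0 y≢0 = begin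
              f (class (h ^ k * y))   ≡⟨ cong f (class-unique i (*-≢0 (^-≢0 k h≢0) y≢0) (begin
                (h ^ k * y) ^ M                ≡⟨ *-^ (h ^ k) y M ⟩
                (h ^ k) ^ M * y ^ M            ≡⟨ cong₂ _*_ (^-comm h k M) (class-spec y≢0) ⟩
                (h ^ M) ^ k * z ^ class y      ≡⟨ cong (λ w → w ^ k * z ^ class y) (class-spec h≢0) ⟩
                (z ^ class h) ^ k * z ^ class y   ≡⟨ *-comm _ _ ⟩
                z ^ class y * (z ^ class h) ^ k   ≡⟨ cong (z ^ class y *_) (sym (^-* z (class h) k)) ⟩
                z ^ class y * z ^ (class h ℕ.* k) ≡⟨ sym (^-+ z (class y) (class h ℕ.* k)) ⟩
                z ^ i                             ∎)) ⟩
              f (i % c)               ≡⟨ f-%c i ⟩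
              f i                     ≡⟨ f-cong ([m+kn]%n≡m%n (class y) (class h) k) ⟩
              f (class y)             ∎
              where i = class y ℕ.+ class h ℕ.* k

            f-class-r^ : ∀ i → f (class (r ^ i)) ≡ f i
            f-class-r^ i = trans (cong f (class-r^ i)) (f-%c i)

            not-homogeneous : ∀ ℓ → 0 < ℓ → ℓ < k → ¬ Homogeneous ℓ (Map f)
            not-homogeneous (suc ℓ) _ ℓ<k hom with proj₂ (proj₂ adm) (ℕP.∸-monoˡ-≤ 1 ℓ<k)
            ... | i , _ , unit = φ-unit-⊖ (f (suc ℓ ℕ.+ i)) (f i) unit (*-cancelʳ (^-≢0 (suc ℓ ℕ.+ i) r≢0) (begin
              φ (f (suc ℓ ℕ.+ i)) * r ^ (suc ℓ ℕ.+ i)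
                ≡⟨ cong (λ v → φ v * r ^ (suc ℓ ℕ.+ i)) (sym (f-class-r^ (suc ℓ ℕ.+ i))) ⟩
              Map f (r ^ (suc ℓ ℕ.+ i))           ≡⟨ cong (Map f) (^-+ r (suc ℓ) i) ⟩
              Map f (r ^ suc ℓ * r ^ i)           ≡⟨ hom r≢0 (^-≢0 i r≢0) ⟩
              r ^ suc ℓ * Map f (r ^ i)           ≡⟨ cong (λ v → r ^ suc ℓ * (φ v * r ^ i)) (f-class-r^ i) ⟩
              r ^ suc ℓ * (φ (f i) * r ^ i)
                ≡⟨ solve 3 (λ a b d → a :* (b :* d) := b :* (a :* d)) refl (r ^ suc ℓ) (φ (f i)) (r ^ i) ⟩
              φ (f i) * (r ^ suc ℓ * r ^ i)       ≡⟨ cong (φ (f i) *_) (sym (^-+ r (suc ℓ) i)) ⟩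
              φ (f i) * r ^ (suc ℓ ℕ.+ i)         ∎))

            map-∈D : InD g k (Map f)
            map-∈D = inD (Div.∣-trans k∣c (divides M (sym Mc))) (zeroʳ _)
              (λ {h} {y} h≢0 y≢0 → trans (cong (λ v → φ v * (h ^ k * y)) (class-shift h≢0 y≢0))
                (solve 3 (λ v h y → v :* (h :* y) := h :* (v :* y)) refl (φ (f (class y))) (h ^ k) y))
              (separated-injective f (proj₁ adm))
              (λ {s} {t} e → separated-injective (λ i → f i ⊖ 1R) (proj₁ (proj₂ adm))
                (trans (Map-⊖1 f s) (trans e (sym (Map-⊖1 f t)))))
              not-homogeneous

        valid⇒pair : ∀ xs ys → Admissible ρ a xs → Admissible ρ b ys →
                     Separated ρ (λ i → multiplier ρ a xs i ⊖ multiplier ρ b ys i) → OrthogonalPair a b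
        valid⇒pair xs ys xs-adm ys-adm sep =
          Map (multiplier ρ a xs) , Map (multiplier ρ b ys) ,
          map-∈D a a∣c xs xs-adm , map-∈D b b∣c ys ys-adm ,
          injective⇒permutation λ {s} {t} e →
            separated-injective (λ i → multiplier ρ a xs i ⊖ multiplier ρ b ys i) sep
              (trans (Map-⊖ (multiplier ρ a xs) (multiplier ρ b ys) s)
                (trans e (sym (Map-⊖ (multiplier ρ a xs) (multiplier ρ b ys) t))))

-- Tables of multipliers and their verification

data Entry : Set where
  -- r and s are distinct primes dividing q, so no field has q elements
  composite : (r s : ℕ) → Entry
  -- multipliers in (ℤ/p)[√n], the first of each list belonging to the coset of the k-th powers
  -- and the next ones to its translates by the powers of ρ
  explicit  : (p n : ℕ) (ρ : ℕ × ℕ) (xs ys : List (ℕ × ℕ)) → Entry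

inPrimeField : (p ρ : ℕ) (xs ys : List ℕ) → Entry
inPrimeField p ρ xs ys = explicit p 0 (ρ , 0) (List.map (_, 0) xs) (List.map (_, 0) ys)

-- Euler's criterion in the field of order q, where n need not be a square modulo p: for odd p and q
-- = p² every nonzero n passes, since p - 1 divides (q - 1) / 2. The case n = 0 is the prime field,
-- with u = 0.
SquareRoot : (p n q : ℕ) .{{_ : NonZero p}} → Set
SquareRoot p n q = n ≡ 0 ⊎ (2 ∣ q ∸ 1 × pow (n , 0) ((q ∸ 1) / 2) ≡ 1R)
  where open QuadraticRing p 0 0

square-root : ∀ {q} (K : FiniteField q) g → FiniteField.IsGenerator K g → (let open Field K) →
          ∀ p n .{{_ : NonZero p}} → ι p ≡ 0F → SquareRoot p n q → ∃ (QuadraticRoot n 0)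
square-root K g gen p zero ιp≡0 (inj₁ refl) = 0F , solve 0 (con (0 , 0) :* con (0 , 0) := con (0 , 0) :+ con (0 , 0) :* con (0 , 0)) refl
  where open Field K
square-root {q} K g gen p n ιp≡0 (inj₂ (2∣q-1 , n^≡1)) =
  let h , _ , h² = root m 2 (m/n*n≡m 2∣q-1) n≢0 n^m≡1
  in h , trans (cong (h *_) (sym (*-identityʳ h))) (trans h²
       (solve 2 (λ n u → n := n :+ con (0 , 0) :* u) refl (ι n) h))
  where
  open Cyclotomic K g gen
  open ≡-Reasoning
  open QuadraticRing p 0 0
  open Evaluation K ιp≡0 0F (solve 0 (con (0 , 0) :* con (0 , 0) := con (0 , 0) :+ con (0 , 0) :* con (0 , 0)) refl)
  m = (q ∸ 1) / 2
  n^m≡1 : ι n ^ m ≡ 1F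
  n^m≡1 = begin
    ι n ^ m            ≡⟨ cong (_^ m) (solve 1 (λ n → n := n :+ con (0 , 0) :* con (0 , 0)) refl (ι n)) ⟩
    φ (n , 0) ^ m      ≡⟨ sym (φ-pow (n , 0) m) ⟩
    φ (pow (n , 0) m)  ≡⟨ cong φ n^≡1 ⟩
    φ 1R               ≡⟨ φ-1 ⟩
    1F                 ∎
  n≢0 : ι n ≢ 0F
  n≢0 ιn≡0 = 1≢0 (begin
    1F                      ≡⟨ sym (1^ 2) ⟩
    1F ^ 2                  ≡⟨ cong (_^ 2) (sym n^m≡1) ⟩
    (ι n ^ m) ^ 2           ≡⟨ trans (sym (^-* (ι n) m 2)) (cong (ι n ^_) (m/n*n≡m 2∣q-1)) ⟩
    ι n ^ (q ∸ 1)           ≡⟨ cong (_^ (q ∸ 1)) ιn≡0 ⟩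
    0F ^ (q ∸ 1)            ≡⟨ 0^ 0<q-1 ⟩
    0F                      ∎)

module _ (a b c : ℕ) .{{_ : NonZero a}} .{{_ : NonZero b}} .{{_ : NonZero c}} where

  Good : ℕ → Entry → Set
  Good q (composite r s) = Prime r × Prime s × r ∣ q × s ∣ q × r ≢ s
  Good q (explicit zero _ _ _ _) = ⊥
  Good q (explicit p@(suc _) n ρ xs ys) =
    Prime p × p ∣ q × SquareRoot p n q × Certificate.Valid p n a b c ((q ∸ 1) / c) ρ xs ys

  good? : ∀ q e → Dec (Good q e)
  good? q (composite r s) = prime? r ×-dec prime? s ×-dec r ∣? q ×-dec s ∣? q ×-dec ¬? (r ℕ.≟ s)
  good? q (explicit zero _ _ _ _) = no λ ()
  good? q (explicit p@(suc _) n ρ xs ys) =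
    prime? p ×-dec p ∣? q ×-dec
    (n ℕ.≟ 0 ⊎-dec (2 ∣? q ∸ 1 ×-dec pow (n , 0) ((q ∸ 1) / 2) ≟R 1R)) ×-dec
    Certificate.valid? p n a b c ((q ∸ 1) / c) ρ xs ys
    where open QuadraticRing p 0 0

  InTable : List (ℕ × Entry) → ℕ → Set
  InTable table q = Any (λ (q′ , e) → q′ ≡ q × Good q e) table

  -- A decidable disjunction, so that all q below a bound can be checked by evaluation. `Other`
  -- holds the orders that are settled by a separate argument or excepted in the theorem.
  Covered : (ℕ → Set) → List (ℕ × Entry) → ℕ → Set
  Covered Other table q = q < 8 ⊎ ¬ (c ∣ q ∸ 1) ⊎ Other q ⊎ InTable table q

  covered? : ∀ {Other} → (∀ q → Dec (Other q)) → ∀ table q → Dec (Covered Other table q)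
  covered? other? table q = q ℕ.<? 8 ⊎-dec ¬? (c ∣? q ∸ 1) ⊎-dec other? q ⊎-dec
    Any.any? (λ (q′ , e) → q′ ℕ.≟ q ×-dec good? q e) table

  module SmallFields {q : ℕ} (K : FiniteField q) (g : FiniteField.F K) (gen : FiniteField.IsGenerator K g)
                     (a∣c : a ∣ c) (b∣c : b ∣ c) (c∣q-1 : c ∣ q ∸ 1) where
    open Cyclotomic K g gen
    open Characteristic K

    good⇒pair : ∀ e → Good q e → OrthogonalPair a b
    good⇒pair (composite r s) (r-prime , s-prime , r∣q , s∣q , r≢s) =
      ⊥-elim (r≢s (prime-divisor-unique r-prime s-prime r∣q s∣q))
    good⇒pair (explicit p@(suc _) n ρ xs ys) (p-prime , p∣q , sqrt , root , xs-adm , ys-adm , sep) =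
      let ιp≡0 = ι-prime-divisor p-prime p∣q
          u , u²≡n = square-root K g gen p n ιp≡0 sqrt
      in Certificate.Soundness.valid⇒pair p n a b c ((q ∸ 1) / c) K g gen ιp≡0 u u²≡n a∣c b∣c
           (m/n*n≡m c∣q-1) ρ root xs ys xs-adm ys-adm sep

    table⇒pair : ∀ table → InTable table q → OrthogonalPair a b
    table⇒pair ((_ , e) ∷ _) (here (_ , good)) = good⇒pair e good
    table⇒pair (_ ∷ table) (there found) = table⇒pair table found

-- Exhaustive search

-- Backtracking over sequences of multipliers. Elements are represented by indices below q, with 0
-- for 0; lg is a discrete logarithm. A map d attaches to the multiplier v in position i the
-- multiplier d i v of a further map that has to be a permutation; the key of d i v is the coset of
-- the k-th powers to which that map sends the i-th one. Prefixes are stored in reverse, so the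
-- position of an entry is the length of the tail after it.
Prefix : Set
Prefix = List (ℕ × List ℕ)

upTo : ℕ → (ℕ → Bool) → Bool
upTo zero    f = true
upTo (suc n) f = f n ∧ upTo n f

∧-true : ∀ {b c} → b ∧ c ≡ true → b ≡ true × c ≡ true
∧-true {true} {true} _ = refl , refl

upTo-sound : ∀ {n f i} → upTo n f ≡ true → i < n → f i ≡ true
upTo-sound {suc n} {f} {i} e i<1+n with i ℕ.≟ n
... | yes i≡n = trans (cong f i≡n) (proj₁ (∧-true e))
... | no i≢n  = upTo-sound (proj₂ (∧-true {f n} e)) (ℕP.≤∧≢⇒< (ℕP.≤-pred i<1+n) i≢n)

∨-true : ∀ {b c} → b ∨ c ≡ true → b ≡ true ⊎ c ≡ true
∨-true {true}  _ = inj₁ refl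
∨-true {false} e = inj₂ e

module Search (q : ℕ) (lg : ℕ → ℕ) (k : ℕ) .{{_ : NonZero k}} (ds : List (ℕ → ℕ → ℕ)) where

  keys : ℕ → ℕ → List ℕ
  keys i v = List.map (λ d → (lg (d i v) ℕ.+ i) % k) ds

  Apart : List ℕ → ℕ × List ℕ → Set
  Apart ks (_ , ks′) = Pointwise _≢_ ks ks′

  Admits : Prefix → ℕ → Set
  Admits ws v = All (λ d → d (length ws) v ≢ 0) ds × All (Apart (keys (length ws) v)) ws

  -- The search returns booleans rather than decisions because the latter retain a proof for every node.
  differ : List ℕ → List ℕ → Bool
  differ (m ∷ ms) (n ∷ ns) = not (m ℕ.≡ᵇ n) ∧ differ ms ns
  differ _        _        = true

  apart : List ℕ → Prefix → Bool
  apart ks []              = true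
  apart ks ((_ , ks′) ∷ ws) = differ ks ks′ ∧ apart ks ws

  nonzero : List (ℕ → ℕ → ℕ) → ℕ → ℕ → Bool
  nonzero []       i v = true
  nonzero (d ∷ ds) i v = not (d i v ℕ.≡ᵇ 0) ∧ nonzero ds i v

  -- A universal statement: every completion of the prefix by m further admissible multipliers
  -- satisfies P. A branch that cannot be continued counts as true.
  leaves : (Prefix → Bool) → ℕ → ℕ → Prefix → Bool
  leaves P zero    i ws = P ws
  leaves P (suc m) i ws = upTo q λ v →
    not (nonzero ds i v ∧ apart (keys i v) ws) ∨ leaves P m (suc i) ((v , keys i v) ∷ ws)

  private
    ≢⇒not-≡ᵇ : ∀ {m n} → m ≢ n → not (m ℕ.≡ᵇ n) ≡ true
    ≢⇒not-≡ᵇ {m} {n} m≢n with m ℕ.≡ᵇ n | ℕP.≡ᵇ⇒≡ m n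
    ... | true  | m≡n = contradiction (m≡n _) m≢n
    ... | false | _   = refl

    differ-complete : ∀ {ms ns} → Pointwise _≢_ ms ns → differ ms ns ≡ true
    differ-complete []             = refl
    differ-complete (m≢n ∷ ms≢ns) = cong₂ _∧_ (≢⇒not-≡ᵇ m≢n) (differ-complete ms≢ns)

    apart-complete : ∀ {ks ws} → All (Apart ks) ws → apart ks ws ≡ true
    apart-complete []            = refl
    apart-complete (ks≢ ∷ rest) = cong₂ _∧_ (differ-complete ks≢) (apart-complete rest)

    nonzero-complete : ∀ {ds i v} → All (λ d → d i v ≢ 0) ds → nonzero ds i v ≡ true
    nonzero-complete []           = refl
    nonzero-complete (d≢0 ∷ rest) = cong₂ _∧_ (≢⇒not-≡ᵇ d≢0) (nonzero-complete rest)

  leaves-step : ∀ {P m ws v} → leaves P (suc m) (length ws) ws ≡ true → v < q → Admits ws v →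
                leaves P m (suc (length ws)) ((v , keys (length ws) v) ∷ ws) ≡ true
  leaves-step {P} {m} {ws} {v} e v<q (nz , ap) =
    trans (cong (λ b → not b ∨ leaves P m (suc (length ws)) ((v , keys (length ws) v) ∷ ws))
      (sym (cong₂ _∧_ (nonzero-complete nz) (apart-complete ap)))) (upTo-sound e v<q)

  prefix : (ℕ → ℕ) → ℕ → Prefix
  prefix s zero    = []
  prefix s (suc i) = (s i , keys i (s i)) ∷ prefix s i

  length-prefix : ∀ s i → length (prefix s i) ≡ i
  length-prefix s zero    = refl
  length-prefix s (suc i) = cong suc (length-prefix s i)

entry : Prefix → ℕ → ℕ
entry []             i = 0
entry ((w , _) ∷ ws) i with i ℕ.≟ length ws
... | yes _ = w
... | no _  = entry ws i

entry-prefix : ∀ q lg k .{{_ : NonZero k}} ds s {i n} → i < n → entry (Search.prefix q lg k ds s n) i ≡ s i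
entry-prefix q lg k ds s {i} {suc n} i<1+n with i ℕ.≟ length (Search.prefix q lg k ds s n)
... | yes e = cong s (sym (trans e (Search.length-prefix q lg k ds s n)))
... | no ne = entry-prefix q lg k ds s (ℕP.≤∧≢⇒< (ℕP.≤-pred i<1+n)
        (λ e → ne (trans e (sym (Search.length-prefix q lg k ds s n)))))

Periodic : ℕ → (ℓ : ℕ) .{{_ : NonZero ℓ}} → (ℕ → ℕ) → Set
Periodic k ℓ s = ∀ {i} → i < k → s i ≡ s (i % ℓ)

periodic : ℕ → (ℓ : ℕ) .{{_ : NonZero ℓ}} → (ℕ → ℕ) → Bool
periodic k ℓ s = upTo k λ i → s i ℕ.≡ᵇ s (i % ℓ)

periodic-sound : ∀ k ℓ .{{_ : NonZero ℓ}} s → periodic k ℓ s ≡ true → Periodic k ℓ s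
periodic-sound k ℓ s e {i} i<k = ℕP.≡ᵇ⇒≡ (s i) (s (i % ℓ)) (Equivalence.from T-≡ (upTo-sound e i<k))

module _ (q : ℕ) (minus : ℕ → ℕ → ℕ) (lg : ℕ → ℕ) (A B ℓ : ℕ)
         .{{_ : NonZero A}} .{{_ : NonZero B}} .{{_ : NonZero ℓ}} where

  orthomorphism : List (ℕ → ℕ → ℕ)
  orthomorphism = (λ _ v → v) ∷ (λ _ v → minus v 1) ∷ []

  orthogonalTo : (ℕ → ℕ) → List (ℕ → ℕ → ℕ)
  orthogonalTo α = (λ i v → minus (α (i % A)) v) ∷ orthomorphism

  module First = Search q lg A orthomorphism
  module Second (ws : Prefix) = Search q lg B (orthogonalTo (entry ws))

  -- Every pair of orthogonal orthomorphisms of indices A and B has a first member of index 1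
  -- or a second one of index ℓ.
  degenerate : Bool
  degenerate = First.leaves (λ ws → periodic A 1 (entry ws) ∨
    Second.leaves ws (λ ws′ → periodic B ℓ (entry ws′)) B 0 []) A 0 []

  module Soundness (K : FiniteField q) (r : FiniteField.F K) (gen : FiniteField.IsGenerator K r) where
    open Cyclotomic K r gen
    open ≡-Reasoning

    module _ (el : ℕ → F) (el-surjective : ∀ x → ∃ λ v → v < q × el v ≡ x)
      (el-0 : el 0 ≡ 0F) (el-1 : el 1 ≡ 1F) (1<q : 1 < q)
      (minus<q : ∀ {v} → v < q → ∀ {w} → w < q → minus v w < q)
      (el-minus : ∀ {v} → v < q → ∀ {w} → w < q → el (minus v w) ≡ el v - el w)
      (r^lg : ∀ {v} → v < q → v ≢ 0 → r ^ lg v ≡ el v) where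

      -- Applied to each map that has to be a permutation: the orthomorphisms themselves, their
      -- differences with the identity, and θ - θ′. The numbers a i are indices of the multipliers.
      record Realises (k : ℕ) (a : ℕ → ℕ) (f : F → F) : Set where
        field
          f-injective : ∀ {x y} → f x ≡ f y → x ≡ y
          f-0         : f 0F ≡ 0F
          homogeneous : Homogeneous k f
          bounded     : ∀ i → a i < q
          f-r^        : ∀ i → i < k → f (r ^ i) ≡ el (a i) * r ^ i

      module _ {k : ℕ} .{{_ : NonZero k}} (k∣q-1 : k ∣ q ∸ 1) {a : ℕ → ℕ} {f : F → F} (real : Realises k a f) where
        open Realises real

        realised-nonzero : ∀ i → i < k → a i ≢ 0
        realised-nonzero i i<k ai≡0 = ^-≢0 i g≢0 (f-injective (begin
          f (r ^ i)           ≡⟨ f-r^ i i<k ⟩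
          el (a i) * r ^ i    ≡⟨ cong (_* r ^ i) (trans (cong el ai≡0) el-0) ⟩
          0F * r ^ i          ≡⟨ zeroˡ _ ⟩
          0F                  ≡⟨ sym f-0 ⟩
          f 0F                ∎))

        realised-power : ∀ i → i < k → f (r ^ i) ≡ r ^ (lg (a i) ℕ.+ i)
        realised-power i i<k = trans (f-r^ i i<k) (trans
          (cong (_* r ^ i) (sym (r^lg (bounded i) (realised-nonzero i i<k)))) (sym (^-+ r (lg (a i)) i)))

        -- Equal keys put f (r^i) and f (r^j) into one coset of the k-th powers. By homogeneity
        -- their ratio h^k moves inside f, and injectivity gives r^i = h^k r^j, which for i, j < k
        -- forces i = j.
        realised-fresh : ∀ {i j} → i < k → j < k → (lg (a i) ℕ.+ i) % k ≡ (lg (a j) ℕ.+ j) % k → i ≡ j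
        realised-fresh {i} {j} i<k j<k e = same-position (ratio-root m k mk (^-≢0 s g≢0) (^-≢0 t g≢0) (begin
          (r ^ s) ^ m          ≡⟨ ^-comm r s m ⟩
          (r ^ m) ^ s          ≡⟨ sym (^-% (r ^ m) k r^m^k s) ⟩
          (r ^ m) ^ (s % k)    ≡⟨ cong ((r ^ m) ^_) e ⟩
          (r ^ m) ^ (t % k)    ≡⟨ ^-% (r ^ m) k r^m^k t ⟩
          (r ^ m) ^ t          ≡⟨ ^-comm r m t ⟩
          (r ^ t) ^ m          ∎))
          where
          m = Div.quotient k∣q-1
          mk : m ℕ.* k ≡ q ∸ 1
          mk = sym (Div._∣_.equality k∣q-1)
          s = lg (a i) ℕ.+ i
          t = lg (a j) ℕ.+ j
          r^m^k : (r ^ m) ^ k ≡ 1F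
          r^m^k = trans (sym (^-* r m k)) (trans (cong (r ^_) mk) g^[q-1]≡1)
          bound : ∀ {i} → i < k → m ℕ.* i < q ∸ 1
          bound {i} i<k = ℕP.<-≤-trans (ℕP.*-monoʳ-< m {{quotient-nonZero m mk}} i<k) (ℕP.≤-reflexive mk)
          same-position : (∃ λ h → h ≢ 0F × h ^ k * r ^ t ≡ r ^ s) → i ≡ j
          same-position (h , h≢0 , hk) = ℕP.*-cancelˡ-≡ i j m {{quotient-nonZero m mk}} (g^-injective (bound i<k) (bound j<k) (begin
            r ^ (m ℕ.* i)                  ≡⟨ ^-* r m i ⟩
            (r ^ m) ^ i                    ≡⟨ ^-comm r m i ⟩
            (r ^ i) ^ m                    ≡⟨ cong (_^ m) r^i ⟩
            (h ^ k * r ^ j) ^ m            ≡⟨ *-^ (h ^ k) (r ^ j) m ⟩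
            (h ^ k) ^ m * (r ^ j) ^ m      ≡⟨ cong (_* (r ^ j) ^ m) (pow-k-class m k mk h≢0) ⟩
            1F * (r ^ j) ^ m               ≡⟨ *-identityˡ _ ⟩
            (r ^ j) ^ m                    ≡⟨ ^-comm r j m ⟩
            (r ^ m) ^ j                    ≡⟨ sym (^-* r m j) ⟩
            r ^ (m ℕ.* j)                  ∎))
            where
            r^i : r ^ i ≡ h ^ k * r ^ j
            r^i = f-injective (begin
              f (r ^ i)              ≡⟨ realised-power i i<k ⟩
              r ^ s                  ≡⟨ sym hk ⟩
              h ^ k * r ^ t          ≡⟨ cong (h ^ k *_) (sym (realised-power j j<k)) ⟩
              h ^ k * f (r ^ j)      ≡⟨ sym (homogeneous h≢0 (^-≢0 j g≢0)) ⟩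
              f (h ^ k * r ^ j)      ∎)

      module _ (k : ℕ) .{{_ : NonZero k}} (k∣q-1 : k ∣ q ∸ 1) (ds : List (ℕ → ℕ → ℕ)) (s : ℕ → ℕ)
               (s<q : ∀ i → s i < q) (realised : All (λ d → ∃ (Realises k (λ i → d i (s i)))) ds) where
        open Search q lg k ds

        private
          keys-apart : ∀ {i j} → i < k → j < i → ∀ {ds : List (ℕ → ℕ → ℕ)} → All (λ d → ∃ (Realises k (λ i → d i (s i)))) ds →
            Pointwise _≢_ (List.map (λ d → (lg (d i (s i)) ℕ.+ i) % k) ds) (List.map (λ d → (lg (d j (s j)) ℕ.+ j) % k) ds)
          keys-apart i<k j<i [] = []
          keys-apart i<k j<i (real ∷ reals) =
            (λ e → ℕP.<⇒≢ j<i (sym (realised-fresh k∣q-1 (proj₂ real) i<k (ℕP.<-trans j<i i<k) e))) ∷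
            keys-apart i<k j<i reals

          apart-prefix : ∀ {i} → i < k → ∀ j → j ≤ i → All (Apart (keys i (s i))) (prefix s j)
          apart-prefix i<k zero    _   = []
          apart-prefix i<k (suc j) j<i = keys-apart i<k j<i realised ∷ apart-prefix i<k j (ℕP.<⇒≤ j<i)

          admits-prefix : ∀ i → i < k → Admits (prefix s i) (s i)
          admits-prefix i i<k = subst (λ n → All (λ d → d n (s i) ≢ 0) ds × All (Apart (keys n (s i))) (prefix s i))
            (sym (length-prefix s i))
            (All.map (λ real → realised-nonzero k∣q-1 (proj₂ real) i i<k) realised , apart-prefix i<k i ℕP.≤-refl)

          follow : ∀ {P} m i → i ℕ.+ m ≡ k → leaves P m i (prefix s i) ≡ true → P (prefix s k) ≡ true
          follow {P} zero i e found = subst (λ n → P (prefix s n) ≡ true) (trans (sym (ℕP.+-identityʳ i)) e) found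
          follow {P} (suc m) i e found = follow m (suc i) (trans (sym (ℕP.+-suc i m)) e)
            (subst (λ n → leaves P m (suc n) ((s i , keys n (s i)) ∷ prefix s i) ≡ true) (length-prefix s i)
              (leaves-step {P} {m} {prefix s i}
                (subst (λ n → leaves P (suc m) n (prefix s i) ≡ true) (sym (length-prefix s i)) found)
                (s<q i)
                (admits-prefix i (ℕP.≤-trans (ℕP.m≤m+n (suc i) m) (ℕP.≤-reflexive (trans (sym (ℕP.+-suc i m)) e))))))

        -- The sequence s passes every test, because the maps it realises are injective. Its branch
        -- is therefore never pruned, and P was evaluated at its leaf.
        leaves-sound : ∀ {P} → leaves P k 0 [] ≡ true → P (prefix s k) ≡ true
        leaves-sound {P} found = follow {P} k 0 refl found

      module Multipliers (k : ℕ) .{{_ : NonZero k}} (θ : F → F) (hom : Homogeneous k θ) where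

        multiplier-exists : ∀ i → ∃ λ v → v < q × el v ≡ θ (r ^ (i % k)) * inv (r ^ (i % k))
        multiplier-exists i = el-surjective _

        multiplier : ℕ → ℕ
        multiplier i = proj₁ (multiplier-exists i)

        multiplier<q : ∀ i → multiplier i < q
        multiplier<q i = proj₁ (proj₂ (multiplier-exists i))

        multiplier-% : ∀ i → θ (r ^ (i % k)) ≡ el (multiplier i) * r ^ (i % k)
        multiplier-% i = begin
          θ x                   ≡⟨ sym (*-identityʳ _) ⟩
          θ x * 1F              ≡⟨ cong (θ x *_) (sym (*-inv (^-≢0 (i % k) g≢0))) ⟩
          θ x * (x * inv x)     ≡⟨ solve 3 (λ t x i → t :* (x :* i) := (t :* i) :* x) refl (θ x) x (inv x) ⟩
          (θ x * inv x) * x     ≡⟨ cong (_* x) (sym (proj₂ (proj₂ (multiplier-exists i)))) ⟩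
          el (multiplier i) * x ∎
          where x = r ^ (i % k)

        multiplier-spec : ∀ i → θ (r ^ i) ≡ el (multiplier i) * r ^ i
        multiplier-spec i = begin
          θ (r ^ i)                                  ≡⟨ cong θ split ⟩
          θ ((r ^ (i / k)) ^ k * r ^ (i % k))        ≡⟨ hom (^-≢0 (i / k) g≢0) (^-≢0 (i % k) g≢0) ⟩
          (r ^ (i / k)) ^ k * θ (r ^ (i % k))        ≡⟨ cong ((r ^ (i / k)) ^ k *_) (multiplier-% i) ⟩
          (r ^ (i / k)) ^ k * (el (multiplier i) * r ^ (i % k))
            ≡⟨ solve 3 (λ a b c → a :* (b :* c) := b :* (a :* c)) refl ((r ^ (i / k)) ^ k) (el (multiplier i)) (r ^ (i % k)) ⟩
          el (multiplier i) * ((r ^ (i / k)) ^ k * r ^ (i % k))  ≡⟨ cong (el (multiplier i) *_) (sym split) ⟩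
          el (multiplier i) * r ^ i                  ∎
          where
          split : r ^ i ≡ (r ^ (i / k)) ^ k * r ^ (i % k)
          split = begin
            r ^ i                                  ≡⟨ cong (r ^_) (m≡m%n+[m/n]*n i k) ⟩
            r ^ (i % k ℕ.+ i / k ℕ.* k)            ≡⟨ ^-+ r (i % k) _ ⟩
            r ^ (i % k) * r ^ (i / k ℕ.* k)        ≡⟨ *-comm _ _ ⟩
            r ^ (i / k ℕ.* k) * r ^ (i % k)        ≡⟨ cong (_* r ^ (i % k)) (^-* r (i / k) k) ⟩
            (r ^ (i / k)) ^ k * r ^ (i % k)        ∎

        multiplier-cong : ∀ {i j} → i % k ≡ j % k → multiplier i ≡ multiplier j
        multiplier-cong {i} {j} e = cong (λ n → proj₁ (el-surjective (θ (r ^ n) * inv (r ^ n)))) e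

        -- Multiplication by h^ℓ shifts logarithms by a multiple of ℓ. As ℓ divides k, the period
        -- makes the multiplier a function of the logarithm modulo ℓ.
        periodic⇒homogeneous : ∀ ℓ .{{_ : NonZero ℓ}} → ℓ ∣ k → Periodic k ℓ multiplier → Homogeneous ℓ θ
        periodic⇒homogeneous ℓ ℓ∣k periodic {h} {x} h≢0 x≢0 = begin
          θ (h ^ ℓ * x)                         ≡⟨ cong θ h^ℓ*x≡r^n ⟩
          θ (r ^ n)                             ≡⟨ multiplier-spec n ⟩
          el (multiplier n) * r ^ n             ≡⟨ cong₂ (λ v y → el v * y) (shift n j same-residue) (sym h^ℓ*x≡r^n) ⟩
          el (multiplier j) * (h ^ ℓ * x)
            ≡⟨ solve 3 (λ a b c → a :* (b :* c) := b :* (a :* c)) refl (el (multiplier j)) (h ^ ℓ) x ⟩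
          h ^ ℓ * (el (multiplier j) * x)       ≡⟨ cong (λ y → h ^ ℓ * (el (multiplier j) * y)) (sym (g^log x≢0)) ⟩
          h ^ ℓ * (el (multiplier j) * r ^ j)   ≡⟨ cong (h ^ ℓ *_) (sym (multiplier-spec j)) ⟩
          h ^ ℓ * θ (r ^ j)                     ≡⟨ cong (λ y → h ^ ℓ * θ y) (g^log x≢0) ⟩
          h ^ ℓ * θ x                           ∎
          where
          j = log x≢0
          n = j ℕ.+ log h≢0 ℕ.* ℓ
          h^ℓ*x≡r^n : h ^ ℓ * x ≡ r ^ n
          h^ℓ*x≡r^n = begin
            h ^ ℓ * x                          ≡⟨ cong₂ (λ y z → y ^ ℓ * z) (sym (g^log h≢0)) (sym (g^log x≢0)) ⟩
            (r ^ log h≢0) ^ ℓ * r ^ j          ≡⟨ *-comm _ _ ⟩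
            r ^ j * (r ^ log h≢0) ^ ℓ          ≡⟨ cong (r ^ j *_) (sym (^-* r (log h≢0) ℓ)) ⟩
            r ^ j * r ^ (log h≢0 ℕ.* ℓ)        ≡⟨ sym (^-+ r j _) ⟩
            r ^ n                              ∎
          same-residue : n % ℓ ≡ j % ℓ
          same-residue = [m+kn]%n≡m%n j (log h≢0) ℓ
          reduced : ∀ i → multiplier i ≡ multiplier (i % ℓ)
          reduced i = trans (multiplier-cong (sym (m%n%n≡m%n i k))) (trans (periodic (m%n<n i k))
            (cong multiplier (m∣n⇒o%n%m≡o%m ℓ k i ℓ∣k)))
          shift : ∀ i j → i % ℓ ≡ j % ℓ → multiplier i ≡ multiplier j
          shift i j e = trans (reduced i) (trans (cong multiplier e) (sym (reduced j)))

      homogeneous-minus : ∀ {k θ θ′} → Homogeneous k θ → Homogeneous k θ′ → Homogeneous k (λ x → θ x - θ′ x)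
      homogeneous-minus {k} {θ} {θ′} hom hom′ {h} {x} h≢0 x≢0 = trans (cong₂ _-_ (hom h≢0 x≢0) (hom′ h≢0 x≢0))
        (solve 3 (λ h s t → h :* s :- h :* t := h :* (s :- t)) refl (h ^ k) (θ x) (θ′ x))

      degenerate-sound : A ∣ B → ℓ ∣ B → B ∣ q ∸ 1 → degenerate ≡ true → ∀ {θ θ′} →
        θ 0F ≡ 0F → Homogeneous A θ → IsOrthomorphism θ →
        θ′ 0F ≡ 0F → Homogeneous B θ′ → IsOrthomorphism θ′ → Orthogonal θ θ′ →
        Homogeneous 1 θ ⊎ Homogeneous ℓ θ′
      degenerate-sound A∣B ℓ∣B B∣q-1 search {θ} {θ′} θ0 hom (perm , perm₁) θ′0 hom′ (perm′ , perm′₁) orth =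
        conclude (∨-true (leaves-sound A (Div.∣-trans A∣B B∣q-1) orthomorphism α.multiplier α.multiplier<q
                   (orthomorphism-realised A hom θ0 perm perm₁) search))
        where
        module α = Multipliers A θ hom
        module β = Multipliers B θ′ hom′
        minus-0 : ∀ {f h : F → F} → f 0F ≡ 0F → h 0F ≡ 0F → f 0F - h 0F ≡ 0F
        minus-0 f0 h0 = trans (cong₂ _-_ f0 h0) (-‿inverseʳ 0F)
        orthomorphism-realised : ∀ k .{{_ : NonZero k}} {θ} (hom : Homogeneous k θ) → θ 0F ≡ 0F →
          IsPermutation θ → IsPermutation (λ x → θ x - x) →
          All (λ d → ∃ (Realises k (λ i → d i (Multipliers.multiplier k θ hom i)))) orthomorphism
        orthomorphism-realised k {θ} hom θ0 perm perm₁ =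
          (θ , record { f-injective = proj₁ perm ; f-0 = θ0 ; homogeneous = hom ; bounded = multiplier<q
                      ; f-r^ = λ i _ → multiplier-spec i }) ∷
          ((λ x → θ x - x) , record
            { f-injective = proj₁ perm₁ ; f-0 = minus-0 {θ} {λ x → x} θ0 refl
            ; homogeneous = homogeneous-minus {k} {θ} {λ x → x} hom (λ _ _ → refl)
            ; bounded = λ i → minus<q (multiplier<q i) 1<q
            ; f-r^ = λ i _ → trans (cong (_- r ^ i) (multiplier-spec i)) (trans
                (solve 2 (λ a x → a :* x :- x := (a :- con (1 , 0)) :* x) refl (el (multiplier i)) (r ^ i))
                (cong (_* r ^ i) (trans (cong (λ o → el (multiplier i) - o) (sym el-1)) (sym (el-minus (multiplier<q i) 1<q))))) }) ∷ []
          where open Multipliers k θ hom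
        ws : Prefix
        ws = First.prefix α.multiplier A
        ws′ : Prefix
        ws′ = Second.prefix ws β.multiplier B
        conclude : periodic A 1 (entry ws) ≡ true ⊎
          Second.leaves ws (λ ws′ → periodic B ℓ (entry ws′)) B 0 [] ≡ true → Homogeneous 1 θ ⊎ Homogeneous ℓ θ′
        conclude (inj₁ constant) = inj₁ (α.periodic⇒homogeneous 1 (Div.1∣ A) (from-prefix (periodic-sound A 1 (entry ws) constant)))
          where
          from-prefix : Periodic A 1 (entry (ws)) → Periodic A 1 α.multiplier
          from-prefix p {i} i<A = trans (sym (entry-prefix q lg A orthomorphism α.multiplier i<A))
            (trans (p i<A) (entry-prefix q lg A orthomorphism α.multiplier (ℕP.≤-<-trans (m%n≤m i 1) i<A)))
        conclude (inj₂ found) = inj₂ (β.periodic⇒homogeneous ℓ ℓ∣B (from-prefix (periodic-sound B ℓ (entry ws′)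
          (leaves-sound B B∣q-1 (orthogonalTo (entry (ws))) β.multiplier β.multiplier<q
            ((_ , orthogonal-realised) ∷ orthomorphism-realised B hom′ θ′0 perm′ perm′₁) found))))
          where
          from-prefix : Periodic B ℓ (entry (ws′)) → Periodic B ℓ β.multiplier
          from-prefix p {i} i<B = trans (sym (entry-prefix q lg B (orthogonalTo (entry ws)) β.multiplier i<B))
            (trans (p i<B) (entry-prefix q lg B (orthogonalTo (entry ws)) β.multiplier (ℕP.≤-<-trans (m%n≤m i ℓ) i<B)))
          entry-α : ∀ i → entry (ws) (i % A) ≡ α.multiplier i
          entry-α i = trans (entry-prefix q lg A orthomorphism α.multiplier (m%n<n i A)) (α.multiplier-cong (m%n%n≡m%n i A))
          orthogonal-realised : Realises B
            (λ i → minus (entry (ws) (i % A)) (β.multiplier i)) (λ x → θ x - θ′ x)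
          orthogonal-realised = record
            { f-injective = proj₁ orth ; f-0 = minus-0 {θ} {θ′} θ0 θ′0
            ; homogeneous = homogeneous-minus {B} {θ} {θ′} (homogeneous-multiple {A} {B} {θ} A∣B hom) hom′
            ; bounded = λ i → minus<q (subst (_< q) (sym (entry-α i)) (α.multiplier<q i)) (β.multiplier<q i)
            ; f-r^ = λ i _ → begin
                θ (r ^ i) - θ′ (r ^ i)
                  ≡⟨ cong₂ _-_ (α.multiplier-spec i) (β.multiplier-spec i) ⟩
                el (α.multiplier i) * r ^ i - el (β.multiplier i) * r ^ i
                  ≡⟨ solve 3 (λ a b x → a :* x :- b :* x := (a :- b) :* x) refl (el (α.multiplier i)) (el (β.multiplier i)) (r ^ i) ⟩
                (el (α.multiplier i) - el (β.multiplier i)) * r ^ i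
                  ≡⟨ cong (_* r ^ i) (sym (el-minus (α.multiplier<q i) (β.multiplier<q i))) ⟩
                el (minus (α.multiplier i) (β.multiplier i)) * r ^ i
                  ≡⟨ cong (λ v → el (minus v (β.multiplier i)) * r ^ i) (sym (entry-α i)) ⟩
                el (minus (entry (ws) (i % A)) (β.multiplier i)) * r ^ i  ∎ }

-- The index x + p y stands for x + y u.
quadraticMinus : (p n e : ℕ) .{{_ : NonZero p}} → ℕ → ℕ → ℕ
quadraticMinus p n e v w = let x , y = (v % p , v / p) ⊖ (w % p , w / p) in x ℕ.+ p ℕ.* y
  where open QuadraticRing p n e

primeMinus : (p : ℕ) .{{_ : NonZero p}} → ℕ → ℕ → ℕ
primeMinus p v w = (v ℕ.+ (p ∸ w)) % p

module IndexedField (q p n e : ℕ) .{{_ : NonZero p}} (minus : ℕ → ℕ → ℕ) (ρ : ℕ × ℕ) (logs : List ℕ) where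
  open QuadraticRing p n e

  element : ℕ → R
  element v = v % p , v / p

  lg : ℕ → ℕ
  lg v = lookup logs v
    where
    lookup : List ℕ → ℕ → ℕ
    lookup []       _       = 0
    lookup (l ∷ _)  zero    = l
    lookup (_ ∷ ls) (suc i) = lookup ls i

  Unit : R → Set
  Unit x = pow x (q ∸ 1) ≡ 1R

  -- The q listed elements are certified to be distinct by units, and so they exhaust any field of
  -- order q. The operation `minus` on indices is compared with `_⊖_` for all arguments.
  Correct : Set
  Correct = 1 < q × element 1 ≡ 1R × element 0 ≡ 0R × Unit ρ ×
    (∀ {v} → v < q → ∀ {w} → w < v → Unit (element v ⊖ element w)) ×
    (∀ {v} → v < q → v ≢ 0 → pow ρ (lg v) ≡ element v) ×
    (∀ {v} → v < q → ∀ {w} → w < q → minus v w < q × element (minus v w) ≡ element v ⊖ element w)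

  correct? : Dec Correct
  correct? = 1 ℕ.<? q ×-dec element 1 ≟R 1R ×-dec element 0 ≟R 0R ×-dec unit? ρ ×-dec
    ℕP.allUpTo? (λ v → ℕP.allUpTo? (λ w → unit? (element v ⊖ element w)) v) q ×-dec
    ℕP.allUpTo? (λ v → ¬? (v ℕ.≟ 0) →-dec pow ρ (lg v) ≟R element v) q ×-dec
    ℕP.allUpTo? (λ v → ℕP.allUpTo? (λ w →
      minus v w ℕ.<? q ×-dec element (minus v w) ≟R (element v ⊖ element w)) q) q
    where
    unit? : ∀ x → Dec (Unit x)
    unit? x = pow x (q ∸ 1) ≟R 1R

  module _ (K : FiniteField q) (g : FiniteField.F K) (gen : FiniteField.IsGenerator K g) where
    open Cyclotomic K g gen
    open ≡-Reasoning

    module _ (ιp≡0 : ι p ≡ 0F) (u : F) (u²≡n+eu : QuadraticRoot n e u) (correct : Correct) where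
      open Evaluation K ιp≡0 u u²≡n+eu

      private
        1<q = proj₁ correct
        element-1 = proj₁ (proj₂ correct)
        element-0 = proj₁ (proj₂ (proj₂ correct))
        ρ-unit = proj₁ (proj₂ (proj₂ (proj₂ correct)))
        separated = proj₁ (proj₂ (proj₂ (proj₂ (proj₂ correct))))
        ρ^lg = proj₁ (proj₂ (proj₂ (proj₂ (proj₂ (proj₂ correct)))))
        minus-correct = proj₂ (proj₂ (proj₂ (proj₂ (proj₂ (proj₂ correct)))))

        r : F
        r = φ ρ

        el : ℕ → F
        el v = φ (element v)

        unit≢0 : ∀ x → Unit x → φ x ≢ 0F
        unit≢0 x unit φx≡0 = 1≢0 (begin
          1F                     ≡⟨ sym (trans (cong φ unit) φ-1) ⟩
          φ (pow x (q ∸ 1))      ≡⟨ φ-pow x (q ∸ 1) ⟩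
          φ x ^ (q ∸ 1)          ≡⟨ cong (_^ (q ∸ 1)) φx≡0 ⟩
          0F ^ (q ∸ 1)           ≡⟨ 0^ 0<q-1 ⟩
          0F                     ∎)

        el-≢ : ∀ {v w} → v < q → w < v → el v ≢ el w
        el-≢ {v} {w} v<q w<v e = unit≢0 (element v ⊖ element w) (separated v<q w<v)
          (trans (φ-⊖ (element v) (element w)) (trans (cong (_- el w) e) (-‿inverseʳ (el w))))

        el-injective : ∀ {v w} → v < q → w < q → el v ≡ el w → v ≡ w
        el-injective {v} {w} v<q w<q e with ℕP.<-cmp v w
        ... | tri< v<w _ _ = contradiction (sym e) (el-≢ w<q v<w)
        ... | tri≈ _ v≡w _ = v≡w
        ... | tri> _ _ w<v = contradiction e (el-≢ v<q w<v)

        abstract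
          el-surjective : ∀ x → ∃ λ v → v < q × el v ≡ x
          el-surjective x =
            let i , ei = fin-injective⇒surjective (λ i → encode (el (toℕ i)))
                  (λ {i} {j} e → FinP.toℕ-injective (el-injective (FinP.toℕ<n i) (FinP.toℕ<n j) (encode-injective e)))
                  (encode x)
            in toℕ i , FinP.toℕ<n i , encode-injective ei

        el-0 : el 0 ≡ 0F
        el-0 = trans (cong φ element-0) φ-0

        r^lg : ∀ {v} → v < q → v ≢ 0 → r ^ lg v ≡ el v
        r^lg {v} v<q v≢0 = trans (sym (φ-pow ρ (lg v))) (cong φ (ρ^lg v<q v≢0))

        -- The table of logarithms has base ρ, so the search takes `φ ρ` as its generator in place
        -- of g.
        r-gen : IsGenerator r
        r-gen = unit≢0 ρ ρ-unit , λ x x≢0 →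
          let v , v<q , elv = el-surjective x
          in lg v , trans (r^lg v<q (λ v≡0 → x≢0 (trans (sym elv) (trans (cong el v≡0) el-0)))) elv

      -- A map of index a is homogeneous of index A, so one search at A and B covers all divisors a
      -- and b. It ends in a first map of index 1 < a or a second of index ℓ < b, against membership
      -- in the classes D.
      no-pair : ∀ {A B ℓ} .{{_ : NonZero A}} .{{_ : NonZero B}} .{{_ : NonZero ℓ}} →
        A ∣ B → ℓ ∣ B → B ∣ q ∸ 1 → degenerate q minus lg A B ℓ ≡ true →
        ∀ {a b} .{{_ : NonZero a}} .{{_ : NonZero b}} → a ∣ A → b ∣ B → 1 < a → ℓ < b → ¬ OrthogonalPair a b
      no-pair {A} {B} {ℓ} A∣B ℓ∣B B∣q-1 search {a} {b} a∣A b∣B 1<a ℓ<b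
        (θ , θ′ , ((_ , orth , cyc) , proper) , ((_ , orth′ , cyc′) , proper′) , orthogonal) =
        conclude (Soundness.degenerate-sound q minus lg A B ℓ K r r-gen el el-surjective el-0
          (trans (cong φ element-1) φ-1) 1<q
          (λ v<q w<q → proj₁ (minus-correct v<q w<q))
          (λ {v} v<q {w} w<q → trans (cong φ (proj₂ (minus-correct v<q w<q))) (φ-⊖ (element v) (element w)))
          r^lg A∣B ℓ∣B B∣q-1 search
          θ0 (homogeneous-multiple {a} {A} {θ} a∣A (cyclotomic⇒homogeneous a cyc)) orth
          θ′0 (homogeneous-multiple {b} {B} {θ′} b∣B (cyclotomic⇒homogeneous b cyc′)) orth′ orthogonal)
        where
        θ0 : θ 0F ≡ 0F
        θ0 = proj₁ (proj₂ cyc)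
        θ′0 : θ′ 0F ≡ 0F
        θ′0 = proj₁ (proj₂ cyc′)
        conclude : Homogeneous 1 θ ⊎ Homogeneous ℓ θ′ → _
        conclude (inj₁ hom) = proper 1 1<a (Div.1∣ _) (Div.1∣ _ , orth , homogeneous⇒cyclotomic 1 θ0 hom)
        conclude (inj₂ hom) = proper′ ℓ ℓ<b ℓ∣q-1 (ℓ∣q-1 , orth′ , homogeneous⇒cyclotomic ℓ θ′0 hom)
          where ℓ∣q-1 = Div.∣-trans ℓ∣B B∣q-1

-- Explicit multipliers for small fields, found by computer search

table-2-2 : List (ℕ × Entry)
table-2-2 =
  (11 , inPrimeField 11 2 (2 ∷ 6 ∷ []) (6 ∷ 10 ∷ [])) ∷
  []

table-3-3 : List (ℕ × Entry)
table-3-3 =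
  (10 , composite 2 5) ∷
  []

-- The orders q ≡ 5 modulo 8, for which (q - 1) / 4 is odd, together with 9 and 17, which do not
-- exceed 4² + 2. Swapping serves the others.
table-4-4 : List (ℕ × Entry)
table-4-4 =
  (9 , explicit 3 2 (1 , 1) ((2 , 0) ∷ (1 , 1) ∷ (2 , 2) ∷ (0 , 1) ∷ []) ((0 , 1) ∷ (2 , 0) ∷ (1 , 1) ∷ (2 , 2) ∷ [])) ∷
  (13 , inPrimeField 13 2 (2 ∷ 5 ∷ 12 ∷ 9 ∷ []) (3 ∷ 6 ∷ 5 ∷ 4 ∷ [])) ∷
  (17 , inPrimeField 17 3 (4 ∷ 13 ∷ 13 ∷ 13 ∷ []) (13 ∷ 4 ∷ 4 ∷ 4 ∷ [])) ∷
  (21 , composite 3 7) ∷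
  (29 , inPrimeField 29 2 (2 ∷ 17 ∷ 17 ∷ 17 ∷ []) (21 ∷ 2 ∷ 2 ∷ 2 ∷ [])) ∷
  (37 , inPrimeField 37 2 (3 ∷ 21 ∷ 21 ∷ 21 ∷ []) (25 ∷ 3 ∷ 3 ∷ 3 ∷ [])) ∷
  (45 , composite 3 5) ∷
  (53 , inPrimeField 53 2 (2 ∷ 45 ∷ 45 ∷ 45 ∷ []) (48 ∷ 2 ∷ 2 ∷ 2 ∷ [])) ∷
  (61 , inPrimeField 61 2 (2 ∷ 23 ∷ 23 ∷ 23 ∷ []) (26 ∷ 2 ∷ 2 ∷ 2 ∷ [])) ∷
  []

table-5-5 : List (ℕ × Entry)
table-5-5 =
  (11 , inPrimeField 11 2 (2 ∷ 3 ∷ 3 ∷ 10 ∷ 8 ∷ []) (5 ∷ 9 ∷ 9 ∷ 4 ∷ 7 ∷ [])) ∷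
  (21 , composite 3 7) ∷
  (26 , composite 2 13) ∷
  []

-- The orders q ≡ 7 modulo 12, for which (q - 1) / 6 is odd, together with those up to 6² + 2 = 38.
table-6-6 : List (ℕ × Entry)
table-6-6 =
  (13 , inPrimeField 13 2 (2 ∷ 2 ∷ 5 ∷ 5 ∷ 7 ∷ 6 ∷ []) (7 ∷ 9 ∷ 4 ∷ 8 ∷ 8 ∷ 5 ∷ [])) ∷
  (19 , inPrimeField 19 2 (8 ∷ 12 ∷ 12 ∷ 12 ∷ 12 ∷ 12 ∷ []) (2 ∷ 3 ∷ 4 ∷ 4 ∷ 13 ∷ 2 ∷ [])) ∷
  (25 , explicit 5 2 (2 , 1) ((2 , 0) ∷ (3 , 0) ∷ (3 , 0) ∷ (3 , 0) ∷ (3 , 0) ∷ (3 , 0) ∷ []) ((3 , 0) ∷ (2 , 0) ∷ (2 , 0) ∷ (2 , 0) ∷ (2 , 0) ∷ (2 , 0) ∷ [])) ∷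
  (31 , inPrimeField 31 3 (3 ∷ 17 ∷ 17 ∷ 17 ∷ 17 ∷ 17 ∷ []) (7 ∷ 25 ∷ 25 ∷ 25 ∷ 25 ∷ 25 ∷ [])) ∷
  (37 , inPrimeField 37 2 (4 ∷ 34 ∷ 34 ∷ 34 ∷ 34 ∷ 34 ∷ []) (34 ∷ 4 ∷ 4 ∷ 4 ∷ 4 ∷ 4 ∷ [])) ∷
  (43 , inPrimeField 43 3 (2 ∷ 22 ∷ 22 ∷ 22 ∷ 22 ∷ 22 ∷ []) (22 ∷ 42 ∷ 42 ∷ 42 ∷ 42 ∷ 42 ∷ [])) ∷
  (55 , composite 5 11) ∷
  (67 , inPrimeField 67 2 (3 ∷ 45 ∷ 45 ∷ 45 ∷ 45 ∷ 45 ∷ []) (54 ∷ 6 ∷ 6 ∷ 6 ∷ 6 ∷ 6 ∷ [])) ∷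
  (79 , inPrimeField 79 3 (3 ∷ 37 ∷ 37 ∷ 37 ∷ 37 ∷ 37 ∷ []) (43 ∷ 77 ∷ 77 ∷ 77 ∷ 77 ∷ 77 ∷ [])) ∷
  (91 , composite 7 13) ∷
  (103 , inPrimeField 103 5 (3 ∷ 27 ∷ 27 ∷ 27 ∷ 27 ∷ 27 ∷ []) (27 ∷ 69 ∷ 69 ∷ 69 ∷ 69 ∷ 69 ∷ [])) ∷
  (115 , composite 5 23) ∷
  (127 , inPrimeField 127 3 (3 ∷ 48 ∷ 48 ∷ 48 ∷ 48 ∷ 48 ∷ []) (48 ∷ 101 ∷ 101 ∷ 101 ∷ 101 ∷ 101 ∷ [])) ∷
  (139 , inPrimeField 139 2 (2 ∷ 126 ∷ 126 ∷ 126 ∷ 126 ∷ 126 ∷ []) (130 ∷ 2 ∷ 2 ∷ 2 ∷ 2 ∷ 2 ∷ [])) ∷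
  (151 , inPrimeField 151 6 (2 ∷ 21 ∷ 21 ∷ 21 ∷ 21 ∷ 21 ∷ []) (21 ∷ 99 ∷ 99 ∷ 99 ∷ 99 ∷ 99 ∷ [])) ∷
  (163 , inPrimeField 163 2 (2 ∷ 7 ∷ 7 ∷ 7 ∷ 7 ∷ 7 ∷ []) (137 ∷ 2 ∷ 2 ∷ 2 ∷ 2 ∷ 2 ∷ [])) ∷
  (175 , composite 5 7) ∷
  (187 , composite 11 17) ∷
  (199 , inPrimeField 199 3 (2 ∷ 29 ∷ 29 ∷ 29 ∷ 29 ∷ 29 ∷ []) (29 ∷ 122 ∷ 122 ∷ 122 ∷ 122 ∷ 122 ∷ [])) ∷
  (211 , inPrimeField 211 2 (2 ∷ 26 ∷ 26 ∷ 26 ∷ 26 ∷ 26 ∷ []) (26 ∷ 110 ∷ 110 ∷ 110 ∷ 110 ∷ 110 ∷ [])) ∷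
  []

table-2-4 : List (ℕ × Entry)
table-2-4 =
  (13 , inPrimeField 13 2 (2 ∷ 5 ∷ []) (3 ∷ 6 ∷ 7 ∷ 3 ∷ [])) ∷
  (17 , inPrimeField 17 3 (2 ∷ 9 ∷ []) (5 ∷ 14 ∷ 14 ∷ 14 ∷ [])) ∷
  (21 , composite 3 7) ∷
  (25 , explicit 5 2 (2 , 1) ((2 , 0) ∷ (3 , 0) ∷ []) ((0 , 1) ∷ (0 , 4) ∷ (0 , 4) ∷ (0 , 4) ∷ [])) ∷
  (29 , inPrimeField 29 2 (8 ∷ 2 ∷ []) (6 ∷ 5 ∷ 5 ∷ 5 ∷ [])) ∷
  (33 , composite 3 11) ∷
  (37 , inPrimeField 37 2 (2 ∷ 5 ∷ []) (21 ∷ 25 ∷ 25 ∷ 25 ∷ [])) ∷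
  (41 , inPrimeField 41 6 (2 ∷ 5 ∷ []) (5 ∷ 32 ∷ 32 ∷ 32 ∷ [])) ∷
  (45 , composite 3 5) ∷
  []

table-2-3 : List (ℕ × Entry)
table-2-3 =
  (19 , inPrimeField 19 2 (2 ∷ 8 ∷ []) (4 ∷ 6 ∷ 6 ∷ [])) ∷
  (25 , explicit 5 2 (2 , 1) ((2 , 0) ∷ (3 , 0) ∷ []) ((0 , 1) ∷ (0 , 3) ∷ (0 , 3) ∷ [])) ∷
  (31 , inPrimeField 31 3 (2 ∷ 10 ∷ []) (4 ∷ 8 ∷ 8 ∷ [])) ∷
  (37 , inPrimeField 37 2 (2 ∷ 13 ∷ []) (8 ∷ 31 ∷ 31 ∷ [])) ∷
  (43 , inPrimeField 43 3 (2 ∷ 5 ∷ []) (11 ∷ 39 ∷ 39 ∷ [])) ∷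
  (49 , explicit 7 3 (1 , 1) ((2 , 0) ∷ (3 , 0) ∷ []) ((6 , 2) ∷ (6 , 5) ∷ (6 , 5) ∷ [])) ∷
  (55 , composite 5 11) ∷
  (61 , inPrimeField 61 2 (2 ∷ 6 ∷ []) (13 ∷ 15 ∷ 15 ∷ [])) ∷
  (67 , inPrimeField 67 2 (2 ∷ 5 ∷ []) (3 ∷ 24 ∷ 24 ∷ [])) ∷
  []

table-2-6 : List (ℕ × Entry)
table-2-6 =
  (19 , inPrimeField 19 2 (2 ∷ 8 ∷ []) (3 ∷ 5 ∷ 5 ∷ 11 ∷ 7 ∷ 12 ∷ [])) ∷
  (25 , explicit 5 2 (2 , 1) ((2 , 0) ∷ (3 , 0) ∷ []) ((3 , 0) ∷ (4 , 0) ∷ (4 , 0) ∷ (4 , 0) ∷ (4 , 0) ∷ (4 , 0) ∷ [])) ∷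
  (31 , inPrimeField 31 3 (19 ∷ 2 ∷ []) (3 ∷ 17 ∷ 17 ∷ 17 ∷ 17 ∷ 17 ∷ [])) ∷
  (37 , inPrimeField 37 2 (2 ∷ 5 ∷ []) (28 ∷ 12 ∷ 12 ∷ 12 ∷ 12 ∷ 12 ∷ [])) ∷
  (43 , inPrimeField 43 3 (3 ∷ 8 ∷ []) (2 ∷ 42 ∷ 42 ∷ 42 ∷ 42 ∷ 42 ∷ [])) ∷
  (49 , explicit 7 3 (1 , 1) ((2 , 0) ∷ (3 , 0) ∷ []) ((6 , 1) ∷ (6 , 6) ∷ (6 , 6) ∷ (6 , 6) ∷ (6 , 6) ∷ (6 , 6) ∷ [])) ∷
  (55 , composite 5 11) ∷
  (61 , inPrimeField 61 2 (2 ∷ 6 ∷ []) (59 ∷ 21 ∷ 21 ∷ 21 ∷ 21 ∷ 21 ∷ [])) ∷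
  (67 , inPrimeField 67 2 (5 ∷ 2 ∷ []) (35 ∷ 33 ∷ 33 ∷ 33 ∷ 33 ∷ 33 ∷ [])) ∷
  []

table-3-6 : List (ℕ × Entry)
table-3-6 =
  (13 , inPrimeField 13 2 (2 ∷ 3 ∷ 10 ∷ []) (3 ∷ 4 ∷ 5 ∷ 8 ∷ 10 ∷ 4 ∷ [])) ∷
  (19 , inPrimeField 19 2 (3 ∷ 17 ∷ 17 ∷ []) (2 ∷ 5 ∷ 16 ∷ 15 ∷ 15 ∷ 13 ∷ [])) ∷
  (25 , explicit 5 2 (2 , 1) ((2 , 0) ∷ (3 , 0) ∷ (3 , 0) ∷ []) ((3 , 0) ∷ (4 , 0) ∷ (4 , 0) ∷ (4 , 0) ∷ (4 , 0) ∷ (4 , 0) ∷ [])) ∷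
  (31 , inPrimeField 31 3 (12 ∷ 14 ∷ 14 ∷ []) (7 ∷ 25 ∷ 25 ∷ 25 ∷ 25 ∷ 25 ∷ [])) ∷
  (37 , inPrimeField 37 2 (2 ∷ 9 ∷ 9 ∷ []) (31 ∷ 8 ∷ 8 ∷ 8 ∷ 8 ∷ 8 ∷ [])) ∷
  (43 , inPrimeField 43 3 (3 ∷ 23 ∷ 23 ∷ []) (42 ∷ 2 ∷ 2 ∷ 2 ∷ 2 ∷ 2 ∷ [])) ∷
  (49 , explicit 7 3 (1 , 1) ((2 , 0) ∷ (3 , 2) ∷ (3 , 2) ∷ []) ((0 , 6) ∷ (0 , 1) ∷ (0 , 1) ∷ (0 , 1) ∷ (0 , 1) ∷ (0 , 1) ∷ [])) ∷
  (55 , composite 5 11) ∷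
  (61 , inPrimeField 61 2 (2 ∷ 21 ∷ 21 ∷ []) (4 ∷ 42 ∷ 42 ∷ 42 ∷ 42 ∷ 42 ∷ [])) ∷
  (67 , inPrimeField 67 2 (6 ∷ 2 ∷ 2 ∷ []) (20 ∷ 7 ∷ 7 ∷ 7 ∷ 7 ∷ 7 ∷ [])) ∷
  (73 , inPrimeField 73 5 (2 ∷ 18 ∷ 18 ∷ []) (50 ∷ 4 ∷ 4 ∷ 4 ∷ 4 ∷ 4 ∷ [])) ∷
  (79 , inPrimeField 79 3 (2 ∷ 13 ∷ 13 ∷ []) (74 ∷ 6 ∷ 6 ∷ 6 ∷ 6 ∷ 6 ∷ [])) ∷
  (85 , composite 5 17) ∷
  (91 , composite 7 13) ∷
  (97 , inPrimeField 97 5 (2 ∷ 13 ∷ 13 ∷ []) (6 ∷ 93 ∷ 93 ∷ 93 ∷ 93 ∷ 93 ∷ [])) ∷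
  (103 , inPrimeField 103 5 (2 ∷ 25 ∷ 25 ∷ []) (69 ∷ 42 ∷ 42 ∷ 42 ∷ 42 ∷ 42 ∷ [])) ∷
  (109 , inPrimeField 109 6 (2 ∷ 17 ∷ 17 ∷ []) (17 ∷ 76 ∷ 76 ∷ 76 ∷ 76 ∷ 76 ∷ [])) ∷
  (115 , composite 5 23) ∷
  (121 , explicit 11 2 (2 , 1) ((2 , 0) ∷ (3 , 0) ∷ (3 , 0) ∷ []) ((3 , 0) ∷ (4 , 0) ∷ (4 , 0) ∷ (4 , 0) ∷ (4 , 0) ∷ (4 , 0) ∷ [])) ∷
  (127 , inPrimeField 127 3 (2 ∷ 5 ∷ 5 ∷ []) (25 ∷ 8 ∷ 8 ∷ 8 ∷ 8 ∷ 8 ∷ [])) ∷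
  (133 , composite 7 19) ∷
  (139 , inPrimeField 139 2 (2 ∷ 9 ∷ 9 ∷ []) (42 ∷ 5 ∷ 5 ∷ 5 ∷ 5 ∷ 5 ∷ [])) ∷
  (145 , composite 5 29) ∷
  (151 , inPrimeField 151 6 (2 ∷ 21 ∷ 21 ∷ []) (4 ∷ 42 ∷ 42 ∷ 42 ∷ 42 ∷ 42 ∷ [])) ∷
  (157 , inPrimeField 157 5 (2 ∷ 8 ∷ 8 ∷ []) (28 ∷ 65 ∷ 65 ∷ 65 ∷ 65 ∷ 65 ∷ [])) ∷
  (163 , inPrimeField 163 2 (2 ∷ 7 ∷ 7 ∷ []) (3 ∷ 148 ∷ 148 ∷ 148 ∷ 148 ∷ 148 ∷ [])) ∷
  (169 , explicit 13 2 (2 , 1) ((2 , 0) ∷ (10 , 1) ∷ (10 , 1) ∷ []) ((3 , 3) ∷ (12 , 3) ∷ (12 , 3) ∷ (12 , 3) ∷ (12 , 3) ∷ (12 , 3) ∷ [])) ∷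
  (175 , composite 5 7) ∷
  (181 , inPrimeField 181 2 (2 ∷ 9 ∷ 9 ∷ []) (50 ∷ 134 ∷ 134 ∷ 134 ∷ 134 ∷ 134 ∷ [])) ∷
  []

-- Models of the fields of order 3, 4, 5, 7, 9 and 13

module F₃ = IndexedField 3 3 0 0 (primeMinus 3) (2 , 0) (0 ∷ 0 ∷ 1 ∷ [])
-- Here u² = 1 + u. Squaring is injective in characteristic 2, so this extension of ℤ/2 cannot be
-- generated by a square root; this is the purpose of the parameter e.
module F₄ = IndexedField 4 2 1 1 (quadraticMinus 2 1 1) (0 , 1) (0 ∷ 0 ∷ 1 ∷ 2 ∷ [])
module F₅ = IndexedField 5 5 0 0 (primeMinus 5) (2 , 0) (0 ∷ 0 ∷ 1 ∷ 3 ∷ 2 ∷ [])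
module F₇ = IndexedField 7 7 0 0 (primeMinus 7) (3 , 0) (0 ∷ 0 ∷ 2 ∷ 1 ∷ 4 ∷ 5 ∷ 3 ∷ [])
module F₉ = IndexedField 9 3 2 0 (quadraticMinus 3 2 0) (1 , 1) (0 ∷ 0 ∷ 4 ∷ 6 ∷ 1 ∷ 7 ∷ 2 ∷ 3 ∷ 5 ∷ [])
module F₁₃ = IndexedField 13 13 0 0 (primeMinus 13) (2 , 0) (0 ∷ 0 ∷ 1 ∷ 4 ∷ 2 ∷ 9 ∷ 5 ∷ 11 ∷ 3 ∷ 8 ∷ 10 ∷ 7 ∷ 6 ∷ [])

-- The field of order 16, and nonexistence in small fields

module _ {q : ℕ} (K : FiniteField q) (g : FiniteField.F K) (gen : FiniteField.IsGenerator K g) where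
  open LargeFields K g gen
  open Characteristic K
  open ≡-Reasoning

  -- A nontrivial cube root of unity ω in characteristic 2 has ω - 1 ≡ ω².
  module CubeRoot (ι2≡0 : ι 2 ≡ 0F) {ω : F} (ω³≡1 : ω ^ 3 ≡ 1F) (ω≢1 : ω ≢ 1F) where

    ω²+ω+1≡0 : ω * ω + ω + 1F ≡ 0F
    ω²+ω+1≡0 = *-cancelˡ (-‿≢0 ω≢1) (begin
      (ω - 1F) * (ω * ω + ω + 1F)
        ≡⟨ solve 1 (λ w → (w :- con (1 , 0)) :* (w :* w :+ w :+ con (1 , 0)) :=
             w :* (w :* (w :* con (1 , 0))) :- con (1 , 0)) refl ω ⟩
      ω ^ 3 - 1F         ≡⟨ trans (cong (_- 1F) ω³≡1) (-‿inverseʳ 1F) ⟩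
      0F                 ≡⟨ sym (zeroʳ _) ⟩
      (ω - 1F) * 0F      ∎)

    ω-1≡ω² : ω - 1F ≡ ω * ω
    ω-1≡ω² = begin
      ω - 1F
        ≡⟨ solve 1 (λ w → w :- con (1 , 0) := w :* w :- (w :* w :+ w :+ con (1 , 0)) :+ con (2 , 0) :* w) refl ω ⟩
      ω * ω - (ω * ω + ω + 1F) + ι 2 * ω  ≡⟨ cong₂ (λ s t → ω * ω - s + t * ω) ω²+ω+1≡0 ι2≡0 ⟩
      ω * ω - 0F + 0F * ω
        ≡⟨ solve 1 (λ w → w :* w :- con (0 , 0) :+ con (0 , 0) :* w := w :* w) refl ω ⟩
      ω * ω              ∎

    ω²-1≡ω : ω * ω - 1F ≡ ω
    ω²-1≡ω = begin
      ω * ω - 1F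
        ≡⟨ solve 1 (λ w → w :* w :- con (1 , 0) := w :+ (w :* w :+ w :+ con (1 , 0)) :- con (2 , 0) :* (w :+ con (1 , 0))) refl ω ⟩
      ω + (ω * ω + ω + 1F) - ι 2 * (ω + 1F)  ≡⟨ cong₂ (λ s t → ω + s - t * (ω + 1F)) ω²+ω+1≡0 ι2≡0 ⟩
      ω + 0F - 0F * (ω + 1F)
        ≡⟨ solve 1 (λ w → w :+ con (0 , 0) :- con (0 , 0) :* (w :+ con (1 , 0)) := w) refl ω ⟩
      ω                  ∎

    ω²³≡1 : (ω * ω) ^ 3 ≡ 1F
    ω²³≡1 = trans (*-^ ω ω 3) (trans (cong₂ _*_ ω³≡1 ω³≡1) (*-identityˡ 1F))

    ω≢0 : ω ≢ 0F
    ω≢0 e = 1≢0 (trans (sym ω³≡1) (trans (cong (_^ 3) e) (zeroˡ _)))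

    ω²≢1 : ω * ω ≢ 1F
    ω²≢1 e = ω≢0 (trans (sym ω²-1≡ω) (trans (cong (_- 1F) e) (-‿inverseʳ 1F)))

    ω,ω²-sameType : SameType 3 ω (ω * ω)
    ω,ω²-sameType = record
      { x≢y = λ e → ω≢1 (sym (*-cancelˡ ω≢0 (trans (*-identityʳ ω) e)))
      ; x≢0 = ω≢0 ; y≢0 = *-≢0 ω≢0 ω≢0 ; x≢1 = ω≢1 ; y≢1 = ω²≢1
      ; x~y = trans ω³≡1 (sym ω²³≡1)
      ; x-1~y-1 = begin
          (ω - 1F) ^ 3      ≡⟨ cong (_^ 3) ω-1≡ω² ⟩
          (ω * ω) ^ 3       ≡⟨ trans ω²³≡1 (sym ω³≡1) ⟩
          ω ^ 3             ≡⟨ cong (_^ 3) (sym ω²-1≡ω) ⟩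
          (ω * ω - 1F) ^ 3  ∎ }

  g^≢1 : ∀ i → 0 < i → i < q ∸ 1 → g ^ i ≢ 1F
  g^≢1 i 0<i i<q-1 e = ℕP.<⇒≱ i<q-1 (order-minimal i 0<i e)

  -- The order 16 is below the swapping bound 5² + 2, and its field is not a quadratic extension of
  -- a prime field. But ω = g^5 has order 3 = 15 / 5, so ω, ω², and with them ω - 1 and ω² - 1, are
  -- all fifth powers.
  pair₁₆ : q ≡ 16 → OrthogonalPair 5 5
  pair₁₆ refl = swapped-pair 3 5 refl (-1^odd-index {3} 4 refl (from-yes (2 ∣? 4)))
    (CubeRoot.ω,ω²-sameType (ι-prime-divisor (from-yes (prime? 2)) (from-yes (2 ∣? 16))) {g ^ 5}
      (trans (sym (^-* g 5 3)) g^[q-1]≡1) (g^≢1 5 (from-yes (0 ℕ.<? 5)) (from-yes (5 ℕ.<? 15))))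

  0²≡0 : QuadraticRoot 0 0 0F
  0²≡0 = solve 0 (con (0 , 0) :* con (0 , 0) := con (0 , 0) :+ con (0 , 0) :* con (0 , 0)) refl

  -- The generator has order 3 and is itself a root: g² = g - 1 = 1 + g in characteristic 2.
  root₄ : q ≡ 4 → ∃ (QuadraticRoot 1 1)
  root₄ refl = g , trans (sym (CubeRoot.ω-1≡ω² ι2≡0 {g} g^[q-1]≡1 g≢1)) (begin
    g - 1F               ≡⟨ solve 1 (λ g → g :- con (1 , 0) := con (1 , 0) :+ con (1 , 0) :* g :- con (2 , 0)) refl g ⟩
    1F + 1F * g - ι 2    ≡⟨ cong (λ t → 1F + 1F * g - t) ι2≡0 ⟩
    1F + 1F * g - 0F     ≡⟨ solve 1 (λ t → t :- con (0 , 0) := t) refl _ ⟩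
    1F + 1F * g          ∎)
    where
    ι2≡0 = ι-prime-divisor (from-yes (prime? 2)) (from-yes (2 ∣? 4))
    g≢1 : g ≢ 1F
    g≢1 e = g^≢1 1 (from-yes (0 ℕ.<? 1)) (from-yes (1 ℕ.<? 3)) (trans (*-identityʳ g) e)

  root₉ : q ≡ 9 → ∃ (QuadraticRoot 2 0)
  root₉ refl = square-root K g gen 3 2 (ι-prime-divisor (from-yes (prime? 3)) (from-yes (3 ∣? 9)))
    (inj₂ (from-yes (2 ∣? 8) , refl))

  no-pair₃ : q ≡ 3 → ∀ {a b} .{{_ : NonZero a}} .{{_ : NonZero b}} → a ∣ 2 → b ∣ 2 → 1 < a → 1 < b → ¬ OrthogonalPair a b
  no-pair₃ refl = F₃.no-pair K g gen (ι-prime-divisor (from-yes (prime? 3)) (from-yes (3 ∣? 3))) 0F 0²≡0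
    (from-yes F₃.correct?) {2} {2} {1} (from-yes (2 ∣? 2)) (from-yes (1 ∣? 2)) (from-yes (2 ∣? 2)) refl

  no-pair₄ : q ≡ 4 → ∀ {a b} .{{_ : NonZero a}} .{{_ : NonZero b}} → a ∣ 3 → b ∣ 3 → 1 < a → 1 < b → ¬ OrthogonalPair a b
  no-pair₄ refl = F₄.no-pair K g gen (ι-prime-divisor (from-yes (prime? 2)) (from-yes (2 ∣? 4)))
    (proj₁ (root₄ refl)) (proj₂ (root₄ refl))
    (from-yes F₄.correct?) {3} {3} {1} (from-yes (3 ∣? 3)) (from-yes (1 ∣? 3)) (from-yes (3 ∣? 3)) refl

  no-pair₅ : q ≡ 5 → ∀ {a b} .{{_ : NonZero a}} .{{_ : NonZero b}} → a ∣ 4 → b ∣ 4 → 1 < a → 1 < b → ¬ OrthogonalPair a b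
  no-pair₅ refl = F₅.no-pair K g gen (ι-prime-divisor (from-yes (prime? 5)) (from-yes (5 ∣? 5))) 0F 0²≡0
    (from-yes F₅.correct?) {4} {4} {1} (from-yes (4 ∣? 4)) (from-yes (1 ∣? 4)) (from-yes (4 ∣? 4)) refl

  no-pair₇ : q ≡ 7 → ∀ {a b} .{{_ : NonZero a}} .{{_ : NonZero b}} → a ∣ 6 → b ∣ 6 → 1 < a → 1 < b → ¬ OrthogonalPair a b
  no-pair₇ refl = F₇.no-pair K g gen (ι-prime-divisor (from-yes (prime? 7)) (from-yes (7 ∣? 7))) 0F 0²≡0
    (from-yes F₇.correct?) {6} {6} {1} (from-yes (6 ∣? 6)) (from-yes (1 ∣? 6)) (from-yes (6 ∣? 6)) refl

  no-pair₉ : q ≡ 9 → ∀ {a b} .{{_ : NonZero a}} .{{_ : NonZero b}} → a ∣ 2 → b ∣ 4 → 1 < a → 2 < b → ¬ OrthogonalPair a b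
  no-pair₉ refl = F₉.no-pair K g gen (ι-prime-divisor (from-yes (prime? 3)) (from-yes (3 ∣? 9)))
    (proj₁ (root₉ refl)) (proj₂ (root₉ refl))
    (from-yes F₉.correct?) {2} {4} {2} (from-yes (2 ∣? 4)) (from-yes (2 ∣? 4)) (from-yes (4 ∣? 8)) refl

  -- One search serves b = 3 and b = 6: unless the first map has index 1, the second turns out to
  -- have index 2, which is smaller than either.
  no-pair₁₃ : q ≡ 13 → ∀ {a b} .{{_ : NonZero a}} .{{_ : NonZero b}} → a ∣ 2 → b ∣ 6 → 1 < a → 2 < b → ¬ OrthogonalPair a b
  no-pair₁₃ refl = F₁₃.no-pair K g gen (ι-prime-divisor (from-yes (prime? 13)) (from-yes (13 ∣? 13))) 0F 0²≡0
    (from-yes F₁₃.correct?) {2} {6} {2} (from-yes (2 ∣? 6)) (from-yes (2 ∣? 6)) (from-yes (6 ∣? 12)) refl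

  no-pair-below-8 : ∀ {a b} .{{_ : NonZero a}} .{{_ : NonZero b}} → q < 8 → a ∣ q ∸ 1 → b ∣ q ∸ 1 →
                    1 < a → 1 < b → ¬ OrthogonalPair a b
  no-pair-below-8 {a} {b} q<8 a∣ b∣ 1<a 1<b = go q refl q<8
    where
    too-small : q ∸ 1 < 2 → ¬ OrthogonalPair a b
    too-small q-1<2 _ = ℕP.<⇒≱ (ℕP.<-≤-trans 1<a (Div.∣⇒≤ a∣)) (ℕP.≤-pred q-1<2)
    at : ∀ n → q ≡ suc n → ∀ {d} → d ∣ q ∸ 1 → d ∣ n
    at n e = subst (λ m → _ ∣ m ∸ 1) e
    go : ∀ n → q ≡ n → n < 8 → ¬ OrthogonalPair a b
    go 0 e _ = too-small (subst (λ m → m ∸ 1 < 2) (sym e) (from-yes (0 ℕ.<? 2)))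
    go 1 e _ = too-small (subst (λ m → m ∸ 1 < 2) (sym e) (from-yes (0 ℕ.<? 2)))
    go 2 e _ = too-small (subst (λ m → m ∸ 1 < 2) (sym e) (from-yes (1 ℕ.<? 2)))
    go 3 e _ = no-pair₃ e (at 2 e a∣) (at 2 e b∣) 1<a 1<b
    go 4 e _ = no-pair₄ e (at 3 e a∣) (at 3 e b∣) 1<a 1<b
    go 5 e _ = no-pair₅ e (at 4 e a∣) (at 4 e b∣) 1<a 1<b
    go 6 e _ _ = contradiction
      (prime-divisor-unique (from-yes (prime? 2)) (from-yes (prime? 3))
        (subst (2 ∣_) (sym e) (from-yes (2 ∣? 6))) (subst (3 ∣_) (sym e) (from-yes (3 ∣? 6))))
      (λ ())
    go 7 e _ = no-pair₇ e (at 6 e a∣) (at 6 e b∣) 1<a 1<b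
    go (suc (suc (suc (suc (suc (suc (suc (suc n)))))))) _ n<8 _ =
      contradiction n<8 (ℕP.≤⇒≯ (ℕP.m≤m+n 8 n))

-- Existence for every order above 7

Swappable : (k : ℕ) .{{_ : NonZero k}} → ℕ → Set
Swappable k q = (2 ∣ k ∸ 1 ⊎ 2 ∣ (q ∸ 1) / k) × k ℕ.* k ℕ.+ 2 < q ⊎ (k ≡ 5 × q ≡ 16)

swappable? : ∀ k .{{_ : NonZero k}} q → Dec (Swappable k q)
swappable? k q = (2 ∣? k ∸ 1 ⊎-dec 2 ∣? (q ∸ 1) / k) ×-dec k ℕ.* k ℕ.+ 2 ℕ.<? q ⊎-dec (k ℕ.≟ 5 ×-dec q ℕ.≟ 16)

-- The bound is where `reciprocal-pair` takes over, as it asks for k³ + 3 < q.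
EqualTable : (k : ℕ) .{{_ : NonZero k}} → List (ℕ × Entry) → Set
EqualTable k table = ∀ {q} → q < k ℕ.* (k ℕ.* k) ℕ.+ 4 → Covered k k k (Swappable k) table q

equalTable? : ∀ k .{{_ : NonZero k}} table → Dec (EqualTable k table)
equalTable? k table = ℕP.allUpTo? (covered? k k k (swappable? k) table) (k ℕ.* (k ℕ.* k) ℕ.+ 4)

-- From q ≥ (a³ + 3) c + 2 on, (q - 1) / c exceeds a³ + 3, the number of boxes and excluded points
-- in `mixed-pair`.
MixedTable : (a b c : ℕ) .{{_ : NonZero a}} .{{_ : NonZero b}} .{{_ : NonZero c}} → ℕ → List (ℕ × Entry) → Set
MixedTable a b c exception table = ∀ {q} → q < (a ℕ.* (a ℕ.* a) ℕ.+ 3) ℕ.* c ℕ.+ 2 → Covered a b c (_≡ exception) table q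

mixedTable? : ∀ a b c .{{_ : NonZero a}} .{{_ : NonZero b}} .{{_ : NonZero c}} exception table →
              Dec (MixedTable a b c exception table)
mixedTable? a b c exception table =
  ℕP.allUpTo? (covered? a b c (ℕ._≟ exception) table) ((a ℕ.* (a ℕ.* a) ℕ.+ 3) ℕ.* c ℕ.+ 2)

module _ {q : ℕ} (K : FiniteField q) (g : FiniteField.F K) (gen : FiniteField.IsGenerator K g) (7<q : 7 < q) where
  open LargeFields K g gen

  equal-pair : ∀ k .{{_ : NonZero k}} table → EqualTable k table → k ∣ q ∸ 1 → OrthogonalPair k k
  equal-pair k table covered k∣q-1 = by-size (q ℕ.<? k ℕ.* (k ℕ.* k) ℕ.+ 4)
    where
    mk : (q ∸ 1) / k ℕ.* k ≡ q ∸ 1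
    mk = m/n*n≡m k∣q-1
    swapped : 2 ∣ k ∸ 1 ⊎ 2 ∣ (q ∸ 1) / k → k ℕ.* k ℕ.+ 2 < q → OrthogonalPair k k
    swapped parity large =
      let _ , _ , xy = sameType-exists ((q ∸ 1) / k) k mk large
      in swapped-pair ((q ∸ 1) / k) k mk (-1~1 parity) xy
      where
      -1~1 : 2 ∣ k ∸ 1 ⊎ 2 ∣ (q ∸ 1) / k → (- 1F) ^ ((q ∸ 1) / k) ≡ 1F
      -1~1 (inj₁ 2∣k-1) = -1^odd-index {(q ∸ 1) / k} (k ∸ 1)
        (trans (cong ((q ∸ 1) / k ℕ.*_) (ℕP.suc-pred k)) mk) 2∣k-1
      -1~1 (inj₂ 2∣m)   = -1^even 2∣m
    by-table : Covered k k k (Swappable k) table q → OrthogonalPair k k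
    by-table (inj₁ q<8)                                   = contradiction q<8 (ℕP.≤⇒≯ 7<q)
    by-table (inj₂ (inj₁ k∤q-1))                          = contradiction k∣q-1 k∤q-1
    by-table (inj₂ (inj₂ (inj₁ (inj₁ (parity , large))))) = swapped parity large
    by-table (inj₂ (inj₂ (inj₁ (inj₂ (k≡5 , q≡16)))))     =
      subst (λ k → OrthogonalPair k k) (sym k≡5) (pair₁₆ K g gen q≡16)
    by-table (inj₂ (inj₂ (inj₂ found)))                   =
      SmallFields.table⇒pair k k k K g gen Div.∣-refl Div.∣-refl k∣q-1 table found
    by-size : Dec (q < k ℕ.* (k ℕ.* k) ℕ.+ 4) → OrthogonalPair k k
    by-size (yes small) = by-table (covered small)
    by-size (no large)  = reciprocal-pair ((q ∸ 1) / k) k mk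
      (subst (_≤ q) (ℕP.+-suc (k ℕ.* (k ℕ.* k)) 3) (ℕP.≮⇒≥ large))

  mixed-pair-from-table : ∀ a b c .{{_ : NonZero a}} .{{_ : NonZero b}} .{{_ : NonZero c}} exception table →
    MixedTable a b c exception table → a ∣ c → b ∣ c →
    c ℕ.* c ℕ.+ 2 < (a ℕ.* (a ℕ.* a) ℕ.+ 3) ℕ.* c ℕ.+ 2 →
    c ∣ q ∸ 1 → q ≢ exception → OrthogonalPair a b
  mixed-pair-from-table a b c exception table covered a∣c b∣c c²+2<bound c∣q-1 q≢exception =
    by-size (q ℕ.<? bound)
    where
    a³+3 = a ℕ.* (a ℕ.* a) ℕ.+ 3
    bound = a³+3 ℕ.* c ℕ.+ 2
    M = (q ∸ 1) / c
    by-table : Covered a b c (_≡ exception) table q → OrthogonalPair a b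
    by-table (inj₁ q<8)                  = contradiction q<8 (ℕP.≤⇒≯ 7<q)
    by-table (inj₂ (inj₁ c∤q-1))         = contradiction c∣q-1 c∤q-1
    by-table (inj₂ (inj₂ (inj₁ q≡)))     = contradiction q≡ q≢exception
    by-table (inj₂ (inj₂ (inj₂ found)))  = SmallFields.table⇒pair a b c K g gen a∣c b∣c c∣q-1 table found
    by-size : Dec (q < bound) → OrthogonalPair a b
    by-size (yes small) = by-table (covered small)
    by-size (no large)  = Mixed.mixed-pair a b c ((q ∸ 1) / a) ((q ∸ 1) / b) M a∣c b∣c
      (m/n*n≡m (Div.∣-trans a∣c c∣q-1)) (m/n*n≡m (Div.∣-trans b∣c c∣q-1)) (m/n*n≡m c∣q-1)
      (ℕP.<-≤-trans c²+2<bound (ℕP.≮⇒≥ large))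
      (ℕP.*-cancelʳ-< c a³+3 M (ℕP.≤-trans
        (ℕP.≤-trans (ℕP.≤-reflexive (ℕP.+-comm 1 (a³+3 ℕ.* c)))
          (ℕP.≤-trans (ℕP.≤-reflexive (sym (ℕP.+-∸-assoc (a³+3 ℕ.* c) {2} {1} (s≤s z≤n)))) (ℕP.∸-monoˡ-≤ 1 (ℕP.≮⇒≥ large))))
        (ℕP.≤-reflexive (sym (m/n*n≡m c∣q-1)))))

-- The nine index pairs and the theorem

index-pairs : List (ℕ × ℕ)
index-pairs = (2 , 2) ∷ (3 , 3) ∷ (4 , 4) ∷ (5 , 5) ∷ (6 , 6) ∷ (2 , 4) ∷ (2 , 3) ∷ (2 , 6) ∷ (3 , 6) ∷ []

-- Both a and b divide their positive least common multiple, hence are below 7, and a finite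
-- enumeration remains.
index-pair : ∀ {a b} → 1 < a → a ≤ b → lcm a b ≤ 6 → (a , b) ∈ index-pairs
index-pair {a} {b} 1<a a≤b lcm≤6 = enumerate (s≤s (≤6 (m∣lcm[m,n] a b))) (s≤s (≤6 (n∣lcm[m,n] a b))) 1<a a≤b lcm≤6
  where
  instance
    a-nonZero : NonZero a
    a-nonZero = ℕ.>-nonZero (ℕP.<-trans (s≤s z≤n) 1<a)
    b-nonZero : NonZero b
    b-nonZero = ℕ.>-nonZero (ℕP.<-≤-trans (ℕP.<-trans (s≤s z≤n) 1<a) a≤b)
    lcm-nonZero : NonZero (lcm a b)
    lcm-nonZero = ℕ.≢-nonZero λ lcm≡0 → ℕ.≢-nonZero⁻¹ (a ℕ.* b) {{ℕP.m*n≢0 a b}}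
      (Div.0∣⇒≡0 (subst (_∣ a ℕ.* b) lcm≡0 (lcm-least {a} {b} (Div.m∣m*n b) (Div.n∣m*n a))))
  ≤6 : ∀ {d} → d ∣ lcm a b → d ≤ 6
  ≤6 d∣lcm = ℕP.≤-trans (Div.∣⇒≤ d∣lcm) lcm≤6
  enumerate : ∀ {a} → a < 7 → ∀ {b} → b < 7 → 1 < a → a ≤ b → lcm a b ≤ 6 → (a , b) ∈ index-pairs
  enumerate = from-yes (ℕP.allUpTo? (λ a → ℕP.allUpTo? (λ b →
    1 ℕ.<? a →-dec a ℕ.≤? b →-dec lcm a b ℕ.≤? 6 →-dec (a , b) ∈? index-pairs) 7) 7)
    where open DecMembership (≡-dec ℕ._≟_ ℕ._≟_) using (_∈?_)

theorem4p8 : (q : ℕ) (K : FiniteField q) (g : FiniteField.F K) →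
    FiniteField.IsGenerator K g →
    (a b : ℕ) → 1 < a → a ≤ b → lcm a b ≤ 6 → lcm a b ∣ (q ∸ 1) →
    (Σ (FiniteField.F K → FiniteField.F K) λ θ →
    Σ (FiniteField.F K → FiniteField.F K) λ θ' →
    FiniteField.InD K g a θ × FiniteField.InD K g b θ' × FiniteField.Orthogonal K θ θ')
    ⇔
    ((7 < q) × ¬ ((q , a , b) ≡ (9 , 2 , 4)) × ¬ ((q , a , b) ≡ (13 , 2 , 3))
    × ¬ ((q , a , b) ≡ (13 , 2 , 6)))
theorem4p8 q K g gen a b 1<a a≤b lcm≤6 lcm∣q-1 = mk⇔ necessary
  λ (7<q , no-9 , no-13 , no-13′) → sufficient 7<q no-9 no-13 no-13′ (index-pair 1<a a≤b lcm≤6) lcm∣q-1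
  where
  open Cyclotomic K g gen using (OrthogonalPair)
  instance
    a-nonZero : NonZero a
    a-nonZero = ℕ.>-nonZero (ℕP.<-trans (s≤s z≤n) 1<a)
    b-nonZero : NonZero b
    b-nonZero = ℕ.>-nonZero (ℕP.<-≤-trans (ℕP.<-trans (s≤s z≤n) 1<a) a≤b)
  necessary : OrthogonalPair a b → (7 < q) × ¬ ((q , a , b) ≡ (9 , 2 , 4)) × ¬ ((q , a , b) ≡ (13 , 2 , 3))
    × ¬ ((q , a , b) ≡ (13 , 2 , 6))
  necessary pair =
    ℕP.≰⇒> (λ q≤7 → no-pair-below-8 K g gen (s≤s q≤7) (Div.∣-trans (m∣lcm[m,n] a b) lcm∣q-1)
      (Div.∣-trans (n∣lcm[m,n] a b) lcm∣q-1) 1<a (ℕP.<-≤-trans 1<a a≤b) pair) ,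
    (λ { refl → no-pair₉ K g gen refl (from-yes (2 ∣? 2)) (from-yes (4 ∣? 4)) 1<a (from-yes (2 ℕ.<? 4)) pair }) ,
    (λ { refl → no-pair₁₃ K g gen refl (from-yes (2 ∣? 2)) (from-yes (3 ∣? 6)) 1<a (from-yes (2 ℕ.<? 3)) pair }) ,
    (λ { refl → no-pair₁₃ K g gen refl (from-yes (2 ∣? 2)) (from-yes (6 ∣? 6)) 1<a (from-yes (2 ℕ.<? 6)) pair })
  sufficient : 7 < q → ∀ {a b} → ¬ ((q , a , b) ≡ (9 , 2 , 4)) → ¬ ((q , a , b) ≡ (13 , 2 , 3)) →
    ¬ ((q , a , b) ≡ (13 , 2 , 6)) → (a , b) ∈ index-pairs → lcm a b ∣ q ∸ 1 → OrthogonalPair a b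
  sufficient 7<q _ _ _ (here refl) = equal-pair K g gen 7<q 2 table-2-2 (from-yes (equalTable? 2 table-2-2))
  sufficient 7<q _ _ _ (there (here refl)) = equal-pair K g gen 7<q 3 table-3-3 (from-yes (equalTable? 3 table-3-3))
  sufficient 7<q _ _ _ (there (there (here refl))) = equal-pair K g gen 7<q 4 table-4-4 (from-yes (equalTable? 4 table-4-4))
  sufficient 7<q _ _ _ (there (there (there (here refl)))) = equal-pair K g gen 7<q 5 table-5-5 (from-yes (equalTable? 5 table-5-5))
  sufficient 7<q _ _ _ (there (there (there (there (here refl))))) = equal-pair K g gen 7<q 6 table-6-6 (from-yes (equalTable? 6 table-6-6))
  sufficient 7<q no-9 _ _ (there (there (there (there (there (here refl)))))) lcm∣q-1 =
    mixed-pair-from-table K g gen 7<q 2 4 4 9 table-2-4 (from-yes (mixedTable? 2 4 4 9 table-2-4))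
      (from-yes (2 ∣? 4)) (from-yes (4 ∣? 4)) (from-yes (18 ℕ.<? 46)) lcm∣q-1 (λ q≡9 → no-9 (cong (_, 2 , 4) q≡9))
  sufficient 7<q _ no-13 _ (there (there (there (there (there (there (here refl))))))) lcm∣q-1 =
    mixed-pair-from-table K g gen 7<q 2 3 6 13 table-2-3 (from-yes (mixedTable? 2 3 6 13 table-2-3))
      (from-yes (2 ∣? 6)) (from-yes (3 ∣? 6)) (from-yes (38 ℕ.<? 68)) lcm∣q-1 (λ q≡13 → no-13 (cong (_, 2 , 3) q≡13))
  sufficient 7<q _ _ no-13 (there (there (there (there (there (there (there (here refl)))))))) lcm∣q-1 =
    mixed-pair-from-table K g gen 7<q 2 6 6 13 table-2-6 (from-yes (mixedTable? 2 6 6 13 table-2-6))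
      (from-yes (2 ∣? 6)) (from-yes (6 ∣? 6)) (from-yes (38 ℕ.<? 68)) lcm∣q-1 (λ q≡13 → no-13 (cong (_, 2 , 6) q≡13))
  sufficient 7<q _ _ _ (there (there (there (there (there (there (there (there (here refl))))))))) lcm∣q-1 =
    -- The exception 0 stands for none, as 7 < q rules it out.
    mixed-pair-from-table K g gen 7<q 3 6 6 0 table-3-6 (from-yes (mixedTable? 3 6 6 0 table-3-6))
      (from-yes (3 ∣? 6)) (from-yes (6 ∣? 6)) (from-yes (38 ℕ.<? 182)) lcm∣q-1 (λ q≡0 → ℕP.<⇒≢ (ℕP.<-trans (s≤s z≤n) 7<q) (sym q≡0))
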